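{- Let $q=2^n$ with $n\ge 3$, let $h$ be a positive integer with $\gcd(n,h)=1$, and let $\mathcal A\subset\mathrm{PG}(3,q)$, $G_h$, $\mathfrak s$ and $\mathcal O_0,\mathcal O_1,\mathcal O_2,\mathcal O_3$ be as defined in the context. Then $G_h$ has exactly five orbits on the planes of $\mathrm{PG}(3,q)$: (1) the $q+1$ osculating planes; (2) $\mathcal O_0^{\mathfrak s}$, of size $(q^3-q)/3$, consisting of the planes containing no point of $\mathcal A$; (3) $\mathcal O_1^{\mathfrak s}$, of size $(q^3-q)/2$, consisting of the non-osculating planes containing exactly one point of $\mathcal A$; (4) $\mathcal O_2^{\mathfrak s}$, of size $q^2+q$, consisting of the planes containing exactly two points of $\mathcal A$; (5) $\mathcal O_3^{\mathfrak s}$, of size $(q^3-q)/6$, consisting of the planes containing exactly three points of $\mathcal A$.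
   Context: Points of $\mathrm{PG}(3,q)$ have homogeneous coordinates $(X_1,X_2,X_3,X_4)$, written as column vectors when acted on by matrices; $U_i$ is the point with $1$ in position $i$ and $0$ elsewhere. $\mathcal A=\{P_t=(1,t,t^{2^h},t^{2^h+1})\mid t\in\mathbb F_q\}\cup\{U_4\}$. $G_h\simeq \mathrm{PGL}(2,q)$ is the group of projectivities of $\mathrm{PG}(3,q)$ stabilizing $\mathcal A$; its elements are represented by the matrices $$M_{a,b,c,d}=\begin{pmatrix} a^{2^h+1}&a^{2^h}b&ab^{2^h}&b^{2^h+1}\\ a^{2^h}c&a^{2^h}d&b^{2^h}c&b^{2^h}d\\ ac^{2^h}&bc^{2^h}&ad^{2^h}&bd^{2^h}\\ c^{2^h+1}&c^{2^h}d&cd^{2^h}&d^{2^h+1}\end{pmatrix},\quad a,b,c,d\in\mathbb F_q,\ ad+bc=1.$$ $\mathfrak s$ is the symplectic polarity of $\mathrm{PG}(3,q)$ defined by the alternating form $x_1y_4+x_2y_3+x_3y_2+x_4y_1$. The osculating planes are the $q+1$ planes $P^{\mathfrak s}$, $P\in\mathcal A$: $P_t^{\mathfrak s}: t^{2^h+1}X_1+t^{2^h}X_2+tX_3+X_4=0$ and $U_4^{\mathfrak s}:X_1=0$. For $i\in\{0,1,2,3\}$, $\mathcal O_i$ is the set of points of $\mathrm{PG}(3,q)\setminus\mathcal A$ lying on exactly $i$ osculating planes, and $\mathcal O_i^{\mathfrak s}=\{P^{\mathfrak s}\mid P\in\mathcal O_i\}$. -}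

module Defs where

open import Level using (Level; _⊔_) renaming (suc to lsuc)
open import Algebra.Bundles using (CommutativeRing)
open import Algebra.Structures using (IsCommutativeRing)
import Algebra.Properties.Semiring.Exp as Exp
import Algebra.Properties.Semiring.Sum as Sum
open import Data.Bool.Base using (if_then_else_)
open import Data.Fin.Base using (Fin; zero; suc; opposite)
open import Data.Fin.Properties using (_≟_; opposite-involutive)
open import Data.Nat.Base as ℕ using (ℕ)
open import Data.Product using (∃; ∃-syntax; ∃!; _×_; _,_; proj₁; proj₂)
open import Data.Sum.Base using (_⊎_)
open import Data.Vec.Base as Vec using (Vec)
open import Data.Vec.Functional using (Vector; []; _∷_)
open import Function.Bundles using (Inverse; _↔_)
open import Relation.Binary.Bundles using (Setoid)
import Relation.Binary.Construct.On as On
open import Relation.Binary.PropositionalEquality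
open import Relation.Nullary using (¬_)
open import Relation.Nullary.Decidable using (⌊_⌋)
open import Relation.Unary using (Pred; _≐_; _∩_)

record FiniteField (c : Level) (q : ℕ) : Set (lsuc c) where
  infixl 6 _+_
  infixl 7 _*_
  infix  8 -_
  field
    Carrier           : Set c
    _+_ _*_           : Carrier → Carrier → Carrier
    -_                : Carrier → Carrier
    0# 1#             : Carrier
    isCommutativeRing : IsCommutativeRing _≡_ _+_ _*_ -_ 0# 1#
    0#≢1#             : 0# ≢ 1#
    inverse           : ∀ x → x ≢ 0# → ∃[ y ] x * y ≡ 1#
    enumeration       : Carrier ↔ Fin q

  commutativeRing : CommutativeRing c c
  commutativeRing = record { isCommutativeRing = isCommutativeRing }

-- Elements are counted up to the equality of S.
HasCardinality : ∀ {a ℓ p} (S : Setoid a ℓ) → Pred (Setoid.Carrier S) p → ℕ →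
                 Set (a ⊔ ℓ ⊔ p)
HasCardinality S P k = Inverse (On.setoid S (proj₁ {B = P})) (setoid (Fin k))

module PG3 {c : Level} {q : ℕ} (F : FiniteField c q) where

  open FiniteField F
  open CommutativeRing commutativeRing
    using (semiring; *-comm; *-assoc; *-identityˡ; +-comm; +-identityʳ)
  open Exp semiring using (_^_)
  open Sum semiring using (sum)

  infix  4 _∝_
  infixl 7 _∙_ _·_ _⊡_

  _∙_ : Vector Carrier 4 → Vector Carrier 4 → Carrier
  x ∙ y = sum (λ i → x i * y i)

  _∝_ : Vector Carrier 4 → Vector Carrier 4 → Set c
  x ∝ y = ∃[ k ] k ≢ 0# × (∀ i → x i ≡ k * y i)

  private
    ∝-refl : ∀ {x} → x ∝ x
    ∝-refl = 1# , (λ e → 0#≢1# (sym e)) , λ i → sym (*-identityˡ _)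

    cancel : ∀ {k l} → k * l ≡ 1# → ∀ x → l * (k * x) ≡ x
    cancel {k} {l} kl≡1 x = begin
      l * (k * x) ≡⟨ *-assoc l k x ⟨
      l * k * x   ≡⟨ cong (_* x) (*-comm l k) ⟩
      k * l * x   ≡⟨ cong (_* x) kl≡1 ⟩
      1# * x      ≡⟨ *-identityˡ x ⟩
      x           ∎
      where open ≡-Reasoning

    unit≢0 : ∀ {k l} → k * l ≡ 1# → l ≢ 0#
    unit≢0 {k} {l} kl≡1 refl = 0#≢1# (trans (sym (zeroʳ k)) kl≡1)
      where open CommutativeRing commutativeRing using (zeroʳ)

    ∝-sym : ∀ {x y} → x ∝ y → y ∝ x
    ∝-sym {x} {y} (k , k≢0 , x≡ky) =
      let l , kl≡1 = inverse k k≢0 in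
      l , unit≢0 kl≡1 , λ i →
        sym (trans (cong (l *_) (x≡ky i)) (cancel kl≡1 (y i)))

    ∝-trans : ∀ {x y z} → x ∝ y → y ∝ z → x ∝ z
    ∝-trans {x} {y} {z} (k , k≢0 , x≡ky) (l , l≢0 , y≡lz) =
      k * l , kl≢0 , λ i →
        trans (x≡ky i) (trans (cong (k *_) (y≡lz i)) (sym (*-assoc k l (z i))))
      where
      open CommutativeRing commutativeRing using (zeroʳ)
      kl≢0 : k * l ≢ 0#
      kl≢0 kl≡0 =
        let m , km≡1 = inverse k k≢0 in
        l≢0 (trans (sym (cancel km≡1 l)) (trans (cong (m *_) kl≡0) (zeroʳ m)))

  record Point : Set c where
    constructor mkPoint
    field
      coords  : Vector Carrier 4
      nonzero : ∃[ i ] coords i ≢ 0#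

  open Point public using (coords)

  pointSetoid : Setoid c c
  pointSetoid = record
    { Carrier       = Point
    ; _≈_           = λ P Q → coords P ∝ coords Q
    ; isEquivalence = record { refl = ∝-refl ; sym = ∝-sym ; trans = ∝-trans }
    }

  -- The plane with equation  coeffs ∙ X = 0.
  record Plane : Set c where
    constructor mkPlane
    field
      coeffs  : Vector Carrier 4
      nonzero : ∃[ i ] coeffs i ≢ 0#

  open Plane public using (coeffs)

  points : Plane → Pred Point c
  points π P = coeffs π ∙ coords P ≡ 0#

  planeSetoid : Setoid c c
  planeSetoid = record
    { Carrier       = Plane
    ; _≈_           = λ π π′ → points π ≐ points π′
    ; isEquivalence = record
      { refl  = (λ {X} X∈ → X∈) , λ {X} X∈ → X∈
      ; sym   = λ (⊆ , ⊇) → (λ {X} → ⊇ {X}) , λ {X} → ⊆ {X}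
      ; trans = λ (⊆₁ , ⊇₁) (⊆₂ , ⊇₂) →
          (λ {X} X∈ → ⊆₂ {X} (⊆₁ {X} X∈)) , λ {X} X∈ → ⊇₁ {X} (⊇₂ {X} X∈)
      }
    }

  open Setoid pointSetoid public using () renaming (_≈_ to _≈ₚ_)
  open Setoid planeSetoid public using () renaming (_≈_ to _≈ₗ_)

  Matrix : Set c
  Matrix = Fin 4 → Vector Carrier 4

  _·_ : Matrix → Vector Carrier 4 → Vector Carrier 4
  (M · x) i = M i ∙ x

  _⊡_ : Matrix → Matrix → Matrix
  (M ⊡ N) i j = M i ∙ (λ k → N k j)

  I : Matrix
  I i j = if ⌊ i ≟ j ⌋ then 1# else 0#

  record Projectivity : Set c where
    field
      matrix matrix⁻¹ : Matrix
      inverseˡ        : ∀ i j → (matrix⁻¹ ⊡ matrix) i j ≡ I i j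
      inverseʳ        : ∀ i j → (matrix ⊡ matrix⁻¹) i j ≡ I i j

  open Projectivity public using (matrix)

  image : Projectivity → Pred Point c → Pred Point c
  image g S Q = ∃[ P ] S P × coords Q ∝ matrix g · coords P

  module _ (G : Pred Projectivity c) where

    orbit : Plane → Pred Plane c
    orbit π π′ = ∃[ g ] G g × image g (points π) ≐ points π′

    PlaneOrbitsAre : ∀ {k} → Vec (Pred Plane c) k → Set c
    PlaneOrbitsAre Os =
      (∀ i → ∃[ π ] Vec.lookup Os i ≐ orbit π) ×
      (∀ π → ∃! _≡_ λ i → Vec.lookup Os i π)

  form : Vector Carrier 4 → Vector Carrier 4 → Carrier
  form x y = x₁ * y₄ + x₂ * y₃ + x₃ * y₂ + x₄ * y₁
    where
    x₁ = x zero
    x₂ = x (suc zero)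
    x₃ = x (suc (suc zero))
    x₄ = x (suc (suc (suc zero)))
    y₁ = y zero
    y₂ = y (suc zero)
    y₃ = y (suc (suc zero))
    y₄ = y (suc (suc (suc zero)))

  infix 9 _ˢ

  _ˢ : Point → Plane
  mkPoint x (i , xᵢ≢0) ˢ = mkPlane (λ j → x (opposite j))
    (opposite i , λ e → xᵢ≢0 (trans (cong x (sym (opposite-involutive i))) e))

  -- P ˢ is the polar plane of P with respect to form.
  ˢ-polar : ∀ P → points (P ˢ) ≐ λ X → form (coords P) (coords X) ≡ 0#
  ˢ-polar P = (λ {X} e → trans (sym (dot≡form X)) e) , λ {X} e → trans (dot≡form X) e
    where
    open ≡-Reasoning
    swap : ∀ a b d e → a + (b + (d + (e + 0#))) ≡ e + d + b + a
    swap a b d e = begin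
      a + (b + (d + (e + 0#))) ≡⟨ cong (λ z → a + (b + (d + z))) (+-identityʳ e) ⟩
      a + (b + (d + e))        ≡⟨ +-comm a _ ⟩
      b + (d + e) + a          ≡⟨ cong (_+ a) (+-comm b _) ⟩
      d + e + b + a            ≡⟨ cong (λ z → z + b + a) (+-comm d e) ⟩
      e + d + b + a            ∎
    dot≡form : ∀ X → coeffs (P ˢ) ∙ coords X ≡ form (coords P) (coords X)
    dot≡form X = swap _ _ _ _

  module Arc (h : ℕ) where

    P[_] : Carrier → Point
    P[ t ] = mkPoint
      (1# ∷ t ∷ t ^ (2 ℕ.^ h) ∷ t ^ (2 ℕ.^ h ℕ.+ 1) ∷ [])
      (zero , λ e → 0#≢1# (sym e))

    U₄ : Point
    U₄ = mkPoint (0# ∷ 0# ∷ 0# ∷ 1# ∷ [])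
      (suc (suc (suc zero)) , λ e → 0#≢1# (sym e))

    𝒜 : Pred Point c
    𝒜 P = (∃[ t ] P ≈ₚ P[ t ]) ⊎ P ≈ₚ U₄

    G : Pred Projectivity c
    G g = image g 𝒜 ≐ 𝒜

    polars : Pred Point c → Pred Plane c
    polars S π = ∃[ P ] S P × π ≈ₗ P ˢ

    Osculating : Pred Plane c
    Osculating = polars 𝒜

    𝒪 : ℕ → Pred Point c
    𝒪 i P = ¬ 𝒜 P ×
      HasCardinality planeSetoid (λ π → Osculating π × points π P) i

    𝒪ˢ : ℕ → Pred Plane c
    𝒪ˢ i = polars (𝒪 i)

    Meets𝒜In : ℕ → Pred Plane c
    Meets𝒜In i π = HasCardinality pointSetoid (points π ∩ 𝒜) i

{-# OPTIONS --safe #-}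
module Submission where

-- Write σ(t) = t^(2^h).  A plane a X₁ + b X₂ + c X₃ + d X₄ = 0 is a 2×2 matrix
-- up to scalars, i.e. the form a xσ(x) + b yσ(x) + c xσ(y) + d yσ(y), whose
-- zeros on the projective line are the points of the arc on the plane, and
-- SL(2,q) acts by substitution.  The singular matrices are the pairs (u , w) of
-- points of the line: those with u = w are the osculating planes, the others
-- meet the arc in u and w exactly, and SL(2,q) is 2-transitive on the line.
-- Scaled to determinant 1, the regular matrices form a copy of SL(2,q), and
-- have 0, 1 or 3 zeros, because two zeros can be moved to ∞ and 0, where
-- b t + c σ(t) has exactly one further root.  Each of the three classes has an
-- element with a stabiliser of at most 3, 2 and 6 elements respectively, and
-- 1/3 + 1/2 + 1/6 = 1: so each class is a single orbit, of the stated size.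
-- Finally, an arbitrary projectivity preserving the arc preserves the number of
-- zeros; it also preserves osculating planes, by a computation with additive
-- functions after normalising it to fix ∞ and 0.

open import Defs
open import Level using (Level)
open import Algebra.Bundles using (CommutativeMonoid; CommutativeRing)
import Algebra.Properties.CommutativeSemiring.Exp as CommutativeExp
import Algebra.Properties.Monoid.Mult as Mult
import Algebra.Properties.Semiring.Exp as Exp
import Algebra.Properties.Semiring.Mult as SemiringMult
import Algebra.Properties.Semiring.Sum as Sum
import Algebra.Solver.Ring as RingSolver
open import Algebra.Solver.Ring.AlmostCommutativeRing using (fromCommutativeSemiring; _-Raw-AlmostCommutative⟶_)
open import Algebra.Structures using (IsCommutativeMonoid)
open import Data.Bool.Base using (Bool; true; false; _∧_; _xor_; if_then_else_)
open import Data.Bool.Properties using (xor-∧-commutativeRing)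
open import Data.Fin.Base using (Fin; toℕ)
open import Data.Fin.Patterns using (0F; 1F; 2F; 3F; 4F)
open import Data.Fin.Permutation using (↔⇒≡)
import Data.Fin.Properties as Fin
open import Data.List.Base using (List; []; _∷_; _++_; length; map; filter; foldr; lookup; tabulate; cartesianProduct; cartesianProductWith)
open import Data.List.Membership.Propositional using (_∈_; _∉_; find; lose)
open import Data.List.Membership.Propositional.Properties
open import Data.List.Membership.Propositional.Properties.WithK using (unique∧set⇒bag)
open import Data.List.Properties using (filter-accept; filter-reject; length-++; length-map; length-tabulate)
open import Data.List.Relation.Binary.BagAndSetEquality using (∼bag⇒↭)
open import Data.List.Relation.Binary.Permutation.Propositional using (_↭_; ↭⇒↭ₛ′)
import Data.List.Relation.Binary.Permutation.Setoid.Properties as PermSetoid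
open import Data.List.Relation.Binary.Subset.Propositional using (_⊆_)
import Data.List.Relation.Unary.All as All
open import Data.List.Relation.Unary.All.Properties using (¬Any⇒All¬)
open import Data.List.Relation.Unary.AllPairs using ([]; _∷_)
open import Data.List.Relation.Unary.Any using (Any; any?; here; there; index)
open import Data.List.Relation.Unary.Any.Properties using (lookup-index)
open import Data.List.Relation.Unary.Unique.Propositional using (Unique)
import Data.List.Relation.Unary.Unique.Propositional.Properties as Unique
open import Data.Maybe.Base using (Maybe; just; nothing)
open import Data.Maybe.Properties using (just-injective; ≡-dec)
open import Data.Nat.Base as ℕ using (ℕ; zero; suc; z≤n; s≤s)
open import Data.Nat.DivMod using (m*n/n≡m)
open import Data.Nat.GCD using (gcd; gcd-GCD; module Bézout)
import Data.Nat.Properties as ℕ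
import Data.Nat.Solver as ℕSolver
open import Data.Product.Base using (∃; ∃-syntax; _×_; _,_; proj₁; proj₂)
open import Data.Sum.Base using (_⊎_; inj₁; inj₂; [_,_]′)
import Data.Vec.Base as Vec
open import Data.Vec.Functional using (Vector)
open import Function.Base using (_∘_; id; case_of_)
open import Function.Bundles using (Injection; Inverse; mk⇔)
import Function.Construct.Composition as Compose
import Function.Construct.Symmetry as Symmetry
open import Function.Properties.Inverse using (↔⇒↣; ↔-sym)
open import Relation.Binary.Bundles using (Setoid)
open import Relation.Binary.Definitions using (DecidableEquality)
open import Relation.Binary.PropositionalEquality
open import Relation.Nullary using (¬_; Dec; yes; no; ¬?; contradiction)
open import Relation.Nullary.Decidable using (map′; _×-dec_)
open import Relation.Unary using (Pred; Decidable; _≐_; _∩_; ∁)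

-- Counting with lists

-- `G` consists of all projectivities stabilising the arc; no matrix form is given in advance. Each
-- class therefore needs two separate facts: SL(2,q), embedded by `Mat`, is transitive on it, and
-- every element of `G` preserves it. Transitivity on the regular classes is not shown by exhibiting
-- group elements. Upper bounds on three stabilisers give lower bounds on three orbits, which lie in
-- disjoint classes and already exhaust the available forms. For invariance the number of arc points
-- on a plane settles everything except one ambiguity: an osculating plane and a regular plane with
-- one zero both meet the arc once. This is why osculating planes need an argument of their own. The
-- condition gcd(n,h) = 1 enters as the statement that σ fixes only 0 and 1. It makes σ(t)/t a
-- bijection of the field and it bounds all three stabilisers. From n ≥ 3 comes an element ρ outside
-- {0, 1}, without which t and σ(t) would be the same function. Characteristic 2 makes every
-- determinant a square and removes all signs.

private variable
  ℓ₁ ℓ₂ ℓ₃ : Level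
  𝔸 : Set ℓ₁
  𝔹 : Set ℓ₂

∉⇒unique : ∀ {x : 𝔸} {xs} → x ∉ xs → Unique xs → Unique (x ∷ xs)
∉⇒unique x∉xs uniq = ¬Any⇒All¬ _ x∉xs ∷ uniq

unique-⊆⇒length≤ : {xs ys : List 𝔸} → Unique xs → xs ⊆ ys → length xs ℕ.≤ length ys
unique-⊆⇒length≤ {xs = []}     _ _ = z≤n
unique-⊆⇒length≤ {xs = x ∷ xs} uniq@(_ ∷ uniq′) xs⊆ys
  with as , bs , refl ← ∈-∃++ (xs⊆ys (here refl)) = begin
  suc (length xs)             ≤⟨ s≤s (unique-⊆⇒length≤ uniq′ xs⊆as++bs) ⟩
  suc (length (as ++ bs))     ≡⟨ cong suc (length-++ as) ⟩
  suc (length as ℕ.+ length bs) ≡⟨ ℕ.+-suc (length as) (length bs) ⟨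
  length as ℕ.+ length (x ∷ bs) ≡⟨ length-++ as ⟨
  length (as ++ x ∷ bs)       ∎
  where
  open ℕ.≤-Reasoning
  xs⊆as++bs : xs ⊆ as ++ bs
  xs⊆as++bs y∈xs with ∈-++⁻ as (xs⊆ys (there y∈xs))
  ... | inj₁ y∈as         = ∈-++⁺ˡ y∈as
  ... | inj₂ (there y∈bs) = ∈-++⁺ʳ as y∈bs
  ... | inj₂ (here refl)  = contradiction y∈xs (Unique.Unique[x∷xs]⇒x∉xs uniq)

unique-⊆⊇⇒length≡ : {xs ys : List 𝔸} → Unique xs → Unique ys → xs ⊆ ys → ys ⊆ xs →
                    length xs ≡ length ys
unique-⊆⊇⇒length≡ xs! ys! xs⊆ys ys⊆xs =
  ℕ.≤-antisym (unique-⊆⇒length≤ xs! xs⊆ys) (unique-⊆⇒length≤ ys! ys⊆xs)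

module _ (_≟_ : DecidableEquality 𝔸) where

  open import Data.List.Membership.DecPropositional _≟_ using (_∈?_)

  -- A missing `y` could be put in front of `xs`, giving a duplicate-free list inside `ys` that is
  -- too long.
  unique-⊆⇒⊇ : {xs ys : List 𝔸} → Unique xs → xs ⊆ ys → length ys ℕ.≤ length xs → ys ⊆ xs
  unique-⊆⇒⊇ {xs} {ys} xs! xs⊆ys ys≤xs {y} y∈ys with y ∈? xs
  ... | yes y∈xs = y∈xs
  ... | no  y∉xs = contradiction (unique-⊆⇒length≤ (∉⇒unique y∉xs xs!) y∷xs⊆ys) (ℕ.≤⇒≯ ys≤xs)
    where
    y∷xs⊆ys : (y ∷ xs) ⊆ ys
    y∷xs⊆ys (here refl)  = y∈ys
    y∷xs⊆ys (there x∈xs) = xs⊆ys x∈xs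

  ∃∉ : {xs ys : List 𝔸} → Unique xs → length ys ℕ.< length xs → ∃[ x ] x ∈ xs × x ∉ ys
  ∃∉ {xs} {ys} xs! ys<xs with any? (λ x → ¬? (x ∈? ys)) xs
  ... | yes ∃x = find ∃x
  ... | no ∄x = contradiction (unique-⊆⇒length≤ xs! xs⊆ys) (ℕ.<⇒≱ ys<xs)
    where
    xs⊆ys : xs ⊆ ys
    xs⊆ys {x} x∈xs with x ∈? ys
    ... | yes x∈ys = x∈ys
    ... | no  x∉ys = contradiction (lose x∈xs x∉ys) ∄x

lookup-injective : {xs : List 𝔸} → Unique xs → ∀ {i j} → lookup xs i ≡ lookup xs j → i ≡ j
lookup-injective {xs = _ ∷ _} xs! {Fin.zero} {Fin.zero} _ = refl
lookup-injective {xs = _ ∷ xs} xs! {Fin.zero} {Fin.suc j} refl =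
  contradiction (∈-lookup {xs = xs} j) (Unique.Unique[x∷xs]⇒x∉xs xs!)
lookup-injective {xs = _ ∷ xs} xs! {Fin.suc i} {Fin.zero} refl =
  contradiction (∈-lookup {xs = xs} i) (Unique.Unique[x∷xs]⇒x∉xs xs!)
lookup-injective {xs = _ ∷ _} (_ ∷ xs!) {Fin.suc i} {Fin.suc j} eq = cong Fin.suc (lookup-injective xs! eq)

module _ (S : Setoid ℓ₁ ℓ₂) (P : Pred (Setoid.Carrier S) ℓ₃) where

  open Setoid S using (_≈_) renaming (refl to ≈-refl; sym to ≈-sym; trans to ≈-trans; Carrier to C)

  -- The list is a transversal. `to` reads its index from the choice made by `complete`; that this
  -- choice respects the equality of `S` follows from `injective`.
  hasCardinality : (r : 𝔹 → C) {xs : List 𝔹} → Unique xs →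
                   (∀ {x} → x ∈ xs → P (r x)) →
                   (∀ {x y} → x ∈ xs → y ∈ xs → r x ≈ r y → x ≡ y) →
                   (∀ {c} → P c → ∃[ x ] x ∈ xs × c ≈ r x) →
                   HasCardinality S P (length xs)
  hasCardinality r {xs} xs! sound injective complete = record
    { to        = to
    ; from      = from
    ; to-cong   = λ {x} {y} x≈y → rep-injective
        (≈-trans (≈-sym (to-rep x)) (≈-trans x≈y (to-rep y)))
    ; from-cong = λ { refl → ≈-refl }
    ; inverse   = (λ {i} {x} x≈i → rep-injective (≈-trans (≈-sym (to-rep x)) x≈i))
                , λ { {x} refl → ≈-sym (to-rep x) }
    }
    where
    to : ∃ P → Fin (length xs)
    to (c , Pc) = index (proj₁ (proj₂ (complete Pc)))
    from : Fin (length xs) → ∃ P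
    from i = r (lookup xs i) , sound (∈-lookup i)
    to-rep : ∀ x → proj₁ x ≈ proj₁ (from (to x))
    to-rep (c , Pc) with x , x∈xs , c≈x ← complete Pc =
      subst (λ y → c ≈ r y) (lookup-index x∈xs) c≈x
    rep-injective : ∀ {i j} → proj₁ (from i) ≈ proj₁ (from j) → i ≡ j
    rep-injective {i} {j} eq =
      lookup-injective xs! (injective (∈-lookup i) (∈-lookup j) eq)

  -- Allows the cardinalities inside `𝒪` and `Meets𝒜In` to be compared with a number of zeros.
  hasCardinality-unique : ∀ {k l} → HasCardinality S P k → HasCardinality S P l → k ≡ l
  hasCardinality-unique f g = ↔⇒≡ (Compose.inverse (Symmetry.inverse f) g)

length-cartesianProductWith : ∀ {a b c} {A : Set a} {B : Set b} {C : Set c} (f : A → B → C) xs ys →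
                              length (cartesianProductWith f xs ys) ≡ length xs ℕ.* length ys
length-cartesianProductWith f []       ys = refl
length-cartesianProductWith f (x ∷ xs) ys = trans (length-++ (map (f x) ys))
  (cong₂ ℕ._+_ (length-map (f x) ys) (length-cartesianProductWith f xs ys))

≤-sandwich : ∀ {a b c x y z} → a ℕ.≤ x → b ℕ.≤ y → c ℕ.≤ z → x ℕ.+ y ℕ.+ z ℕ.≤ a ℕ.+ b ℕ.+ c →
             x ≡ a × y ≡ b × z ≡ c
≤-sandwich {a} {b} {c} {x} {y} {z} a≤x b≤y c≤z sum≤ = x≡a , y≡b , z≡c
  where
  xy≤ab : x ℕ.+ y ℕ.≤ a ℕ.+ b
  xy≤ab = ℕ.+-cancelʳ-≤ c (x ℕ.+ y) (a ℕ.+ b) (ℕ.≤-trans (ℕ.+-monoʳ-≤ (x ℕ.+ y) c≤z) sum≤)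
  x≡a : x ≡ a
  x≡a = ℕ.≤-antisym (ℕ.+-cancelʳ-≤ b x a (ℕ.≤-trans (ℕ.+-monoʳ-≤ x b≤y) xy≤ab)) a≤x
  y≡b : y ≡ b
  y≡b = ℕ.≤-antisym (ℕ.+-cancelˡ-≤ a y b (ℕ.≤-trans (ℕ.+-monoˡ-≤ y a≤x) xy≤ab)) b≤y
  z≡c : z ≡ c
  z≡c = ℕ.≤-antisym (ℕ.+-cancelˡ-≤ (a ℕ.+ b) z c
    (ℕ.≤-trans (ℕ.+-monoˡ-≤ z (ℕ.+-mono-≤ a≤x b≤y)) sum≤)) c≤z

module _ {a} {A : Set a} (f : A → ℕ) where

  fibre : ℕ → List A → List A
  fibre i = filter (λ x → f x ℕ.≟ i)

  length-fibres : ∀ {i j k} → i ≢ j → i ≢ k → j ≢ k → ∀ xs → (∀ {x} → x ∈ xs → f x ≡ i ⊎ f x ≡ j ⊎ f x ≡ k) →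
                  length (fibre i xs) ℕ.+ length (fibre j xs) ℕ.+ length (fibre k xs) ≡ length xs
  length-fibres i≢j i≢k j≢k []       _     = refl
  length-fibres {i} {j} {k} i≢j i≢k j≢k (x ∷ xs) cases = split (cases (here refl))
    where
    ih = length-fibres i≢j i≢k j≢k xs (cases ∘ there)
    skip : ∀ {l m} → f x ≡ l → l ≢ m → fibre m (x ∷ xs) ≡ fibre m xs
    skip p l≢m = filter-reject (λ x → f x ℕ.≟ _) λ q → l≢m (trans (sym p) q)
    keep : ∀ {l} → f x ≡ l → fibre l (x ∷ xs) ≡ x ∷ fibre l xs
    keep = filter-accept (λ x → f x ℕ.≟ _)
    split : f x ≡ i ⊎ f x ≡ j ⊎ f x ≡ k →
            length (fibre i (x ∷ xs)) ℕ.+ length (fibre j (x ∷ xs)) ℕ.+ length (fibre k (x ∷ xs)) ≡ suc (length xs)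
    split (inj₁ p) rewrite keep p | skip p i≢j | skip p i≢k = cong suc ih
    split (inj₂ (inj₁ p)) rewrite skip p (≢-sym i≢j) | keep p | skip p j≢k =
      trans (cong (ℕ._+ length (fibre k xs)) (ℕ.+-suc (length (fibre i xs)) (length (fibre j xs)))) (cong suc ih)
    split (inj₂ (inj₂ p)) rewrite skip p (≢-sym i≢k) | skip p (≢-sym j≢k) | keep p =
      trans (ℕ.+-suc (length (fibre i xs) ℕ.+ length (fibre j xs)) (length (fibre k xs))) (cong suc ih)

-- The equation 1/3 + 1/2 + 1/6 = 1 cleared of denominators: the three bounds, multiplied by 2, 3
-- and 1, add up to 6 s, and `x + y + z ≤ s` leaves no room for a strict one.
tight : ∀ {s} x y z → s ℕ.≤ 3 ℕ.* x → s ℕ.≤ 2 ℕ.* y → s ℕ.≤ 6 ℕ.* z → x ℕ.+ y ℕ.+ z ℕ.≤ s →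
        3 ℕ.* x ≡ s × 2 ℕ.* y ≡ s × 6 ℕ.* z ≡ s
tight {s} x y z s≤3x s≤2y s≤6z sum≤ =
  let eq₁ , eq₂ , eq₃ = ≤-sandwich (ℕ.*-monoʳ-≤ 2 s≤3x) (ℕ.*-monoʳ-≤ 3 s≤2y) s≤6z sixfold in
  ℕ.*-cancelˡ-≡ (3 ℕ.* x) s 2 eq₁ , ℕ.*-cancelˡ-≡ (2 ℕ.* y) s 3 eq₂ , eq₃
  where
  open ℕSolver.+-*-Solver
  open ℕ.≤-Reasoning
  sixfold : 2 ℕ.* (3 ℕ.* x) ℕ.+ 3 ℕ.* (2 ℕ.* y) ℕ.+ 6 ℕ.* z ℕ.≤ 2 ℕ.* s ℕ.+ 3 ℕ.* s ℕ.+ s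
  sixfold = begin
    2 ℕ.* (3 ℕ.* x) ℕ.+ 3 ℕ.* (2 ℕ.* y) ℕ.+ 6 ℕ.* z
      ≡⟨ solve 3 (λ x y z → con 2 :* (con 3 :* x) :+ con 3 :* (con 2 :* y) :+ con 6 :* z := con 6 :* (x :+ y :+ z)) refl x y z ⟩
    6 ℕ.* (x ℕ.+ y ℕ.+ z)
      ≤⟨ ℕ.*-monoʳ-≤ 6 sum≤ ⟩
    6 ℕ.* s
      ≡⟨ solve 1 (λ s → con 6 :* s := con 2 :* s :+ con 3 :* s :+ s) refl s ⟩
    2 ℕ.* s ℕ.+ 3 ℕ.* s ℕ.+ s ∎

-- Here n = q - 1 is the number of nonzero elements, and the two summands count the matrices of
-- determinant 1 with nonzero and with zero upper left entry.
special-size : ∀ n q → suc n ≡ q → n ℕ.* (q ℕ.* q) ℕ.+ n ℕ.* q ≡ q ℕ.^ 3 ℕ.∸ q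
special-size n q refl = sym (trans (cong (ℕ._∸ q) cube) (ℕ.m+n∸n≡m (n ℕ.* (q ℕ.* q) ℕ.+ n ℕ.* q) q))
  where
  open ℕSolver.+-*-Solver
  cube : suc n ℕ.^ 3 ≡ n ℕ.* (suc n ℕ.* suc n) ℕ.+ n ℕ.* suc n ℕ.+ suc n
  cube = solve 1 (λ n → let q = con 1 :+ n in
    q :* (q :* (q :* con 1)) := n :* (q :* q) :+ n :* q :+ q) refl n

-- Finite fields of characteristic 2

module FiniteFieldProperties {c q} (F : FiniteField c q) where

  open FiniteField F
  open CommutativeRing commutativeRing public
    using ( semiring; commutativeSemiring; +-isCommutativeMonoid; *-isCommutativeMonoid; *-comm; *-assoc; *-identityˡ; *-identityʳ
          ; +-identityˡ; +-identityʳ; zeroˡ; zeroʳ; +-comm; +-assoc )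
  open Exp semiring public using (_^_)

  private
    module E = Inverse enumeration

  infix 4 _≟_
  abstract
    _≟_ : DecidableEquality Carrier
    x ≟ y = map′ (Injection.injective (↔⇒↣ enumeration)) (cong E.to) (E.to x Fin.≟ E.to y)

  elements : List Carrier
  elements = tabulate E.from

  elements-unique : Unique elements
  elements-unique = Unique.tabulate⁺ (Injection.injective (↔⇒↣ (↔-sym enumeration)))

  ∈-elements : ∀ x → x ∈ elements
  ∈-elements x = subst (_∈ elements) (E.strictlyInverseʳ x) (∈-tabulate⁺ (E.to x))

  length-elements : length elements ≡ q
  length-elements = length-tabulate E.from

  infix 9 _⁻¹
  abstract
    _⁻¹ : Carrier → Carrier
    x ⁻¹ with x ≟ 0#
    ... | yes _   = 0#
    ... | no  x≢0 = proj₁ (inverse x x≢0)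

    *-inverseʳ : ∀ {x} → x ≢ 0# → x * x ⁻¹ ≡ 1#
    *-inverseʳ {x} x≢0 with x ≟ 0#
    ... | yes x≡0 = contradiction x≡0 x≢0
    ... | no  x≢0 = proj₂ (inverse x x≢0)

  *-cancelˡ : ∀ {x y z} → x ≢ 0# → x * y ≡ x * z → y ≡ z
  *-cancelˡ {x} {y} {z} x≢0 xy≡xz = begin
    y ≡⟨ undo y ⟨
    x ⁻¹ * (x * y) ≡⟨ cong (x ⁻¹ *_) xy≡xz ⟩
    x ⁻¹ * (x * z) ≡⟨ undo z ⟩
    z ∎
    where
    open ≡-Reasoning
    undo : ∀ y → x ⁻¹ * (x * y) ≡ y
    undo y = begin
      x ⁻¹ * (x * y) ≡⟨ *-assoc (x ⁻¹) x y ⟨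
      x ⁻¹ * x * y   ≡⟨ cong (_* y) (trans (*-comm (x ⁻¹) x) (*-inverseʳ x≢0)) ⟩
      1# * y ≡⟨ *-identityˡ y ⟩
      y ∎

  *-≡0 : ∀ {x y} → x * y ≡ 0# → x ≡ 0# ⊎ y ≡ 0#
  *-≡0 {x} {y} xy≡0 with x ≟ 0#
  ... | yes x≡0 = inj₁ x≡0
  ... | no  x≢0 = inj₂ (*-cancelˡ x≢0 (trans xy≡0 (sym (zeroʳ x))))

  *-≢0 : ∀ {x y} → x ≢ 0# → y ≢ 0# → x * y ≢ 0#
  *-≢0 x≢0 y≢0 xy≡0 = [ x≢0 , y≢0 ]′ (*-≡0 xy≡0)

  1≢0 : 1# ≢ 0#
  1≢0 = 0#≢1# ∘ sym

  unit≢0 : ∀ {x y} → x * y ≡ 1# → x ≢ 0#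
  unit≢0 {y = y} xy≡1 refl = 0#≢1# (trans (sym (zeroˡ y)) xy≡1)

  ⁻¹≢0 : ∀ {x} → x ≢ 0# → x ⁻¹ ≢ 0#
  ⁻¹≢0 {x} x≢0 = unit≢0 (trans (*-comm (x ⁻¹) x) (*-inverseʳ x≢0))

  ^≡0 : ∀ x n → x ^ n ≡ 0# → x ≡ 0#
  ^≡0 x zero    1≡0  = contradiction 1≡0 1≢0
  ^≡0 x (suc n) xx≡0 = [ id , ^≡0 x n ]′ (*-≡0 xx≡0)

  injective⇒surjective : ∀ (f : Carrier → Carrier) → (∀ {x y} → f x ≡ f y → x ≡ y) →
                         ∀ y → ∃[ x ] f x ≡ y
  injective⇒surjective f f-injective y
    with x , _ , y≡fx ← ∈-map⁻ f (unique-⊆⇒⊇ _≟_ (Unique.map⁺ f-injective elements-unique)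
                                   (λ {x} _ → ∈-elements x)
                                   (ℕ.≤-reflexive (sym (length-map f elements)))
                                   (∈-elements y))
    = x , sym y≡fx

  nonzeros : List Carrier
  nonzeros = filter (λ x → ¬? (x ≟ 0#)) elements

  nonzeros-unique : Unique nonzeros
  nonzeros-unique = Unique.filter⁺ _ elements-unique

  ∈-nonzeros : ∀ {x} → x ≢ 0# → x ∈ nonzeros
  ∈-nonzeros x≢0 = ∈-filter⁺ _ (∈-elements _) x≢0

  nonzeros⇒≢0 : ∀ {x} → x ∈ nonzeros → x ≢ 0#
  nonzeros⇒≢0 x∈ = proj₂ (∈-filter⁻ (λ x → ¬? (x ≟ 0#)) {xs = elements} x∈)

  length-nonzeros : suc (length nonzeros) ≡ q
  length-nonzeros = trans (unique-⊆⊇⇒length≡ (∉⇒unique 0∉ nonzeros-unique) elements-unique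
                             (λ {x} _ → ∈-elements x) elements⊆) length-elements
    where
    0∉ : 0# ∉ nonzeros
    0∉ 0∈ = nonzeros⇒≢0 0∈ refl
    elements⊆ : elements ⊆ (0# ∷ nonzeros)
    elements⊆ {x} _ with x ≟ 0#
    ... | yes x≡0 = here x≡0
    ... | no  x≢0 = there (∈-nonzeros x≢0)

  -- There are q values but q - 1 nonzero arguments. This supplies the constant m in `base₁` and
  -- `base₀`.
  misses-value : ∀ (f : Carrier → Carrier) → ∃[ m ] (∀ {t} → t ≢ 0# → f t ≢ m)
  misses-value f = let m , _ , m∉ = ∃∉ _≟_ {ys = map f nonzeros} elements-unique fewer in
    m , λ t≢0 ft≡m → m∉ (subst (_∈ map f nonzeros) ft≡m (∈-map⁺ f (∈-nonzeros t≢0)))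
    where
    fewer : length (map f nonzeros) ℕ.< length elements
    fewer = ℕ.≤-reflexive (trans (cong suc (length-map f nonzeros)) (trans length-nonzeros (sym length-elements)))

  -- For the addition this gives q · 1 = 0, for the multiplication xᵠ⁻¹ = 1.
  module _ {_∙_ : Carrier → Carrier → Carrier} {ε : Carrier}
           (isCommutativeMonoid : IsCommutativeMonoid _≡_ _∙_ ε) where

    private
      M : CommutativeMonoid c c
      M = record { isCommutativeMonoid = isCommutativeMonoid }
      module M = CommutativeMonoid M
      open Mult M.monoid using () renaming (_×_ to _×ₘ_)

    foldr-translate : ∀ a xs → foldr _∙_ ε (map (a ∙_) xs) ≡ (length xs ×ₘ a) ∙ foldr _∙_ ε xs
    foldr-translate a []       = sym (M.identityˡ ε)
    foldr-translate a (x ∷ xs) = begin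
      (a ∙ x) ∙ foldr _∙_ ε (map (a ∙_) xs) ≡⟨ cong ((a ∙ x) ∙_) (foldr-translate a xs) ⟩
      (a ∙ x) ∙ (n ∙ s) ≡⟨ M.assoc a x (n ∙ s) ⟩
      a ∙ (x ∙ (n ∙ s)) ≡⟨ cong (a ∙_) (M.assoc x n s) ⟨
      a ∙ ((x ∙ n) ∙ s) ≡⟨ cong (λ z → a ∙ (z ∙ s)) (M.comm x n) ⟩
      a ∙ ((n ∙ x) ∙ s) ≡⟨ cong (a ∙_) (M.assoc n x s) ⟩
      a ∙ (n ∙ (x ∙ s)) ≡⟨ M.assoc a n (x ∙ s) ⟨
      (a ∙ n) ∙ (x ∙ s) ∎
      where
      open ≡-Reasoning
      n = length xs ×ₘ a
      s = foldr _∙_ ε xs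

    -- An injective translation that maps a finite list into itself permutes it, so both lists have
    -- the same fold.
    translate-invariant : ∀ a {xs} → (∀ {x y} → a ∙ x ≡ a ∙ y → x ≡ y) → Unique xs →
                          map (a ∙_) xs ⊆ xs →
                          foldr _∙_ ε xs ≡ (length xs ×ₘ a) ∙ foldr _∙_ ε xs
    translate-invariant a {xs} injective xs! closed =
      trans (sym (PermSetoid.foldr-commMonoid (setoid Carrier) isCommutativeMonoid
                    (↭⇒↭ₛ′ isEquivalence axs↭xs)))
            (foldr-translate a xs)
      where
      axs! = Unique.map⁺ injective xs!
      axs↭xs : map (a ∙_) xs ↭ xs
      axs↭xs = ∼bag⇒↭ (unique∧set⇒bag axs! xs! (mk⇔ closed
        (unique-⊆⇒⊇ _≟_ axs! closed (ℕ.≤-reflexive (sym (length-map (a ∙_) xs))))))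

  fermat : ∀ x → x ^ q ≡ x
  fermat x with x ≟ 0#
  ... | yes refl = trans (cong (0# ^_) (sym length-nonzeros)) (zeroˡ _)
  ... | no x≢0 = trans (cong (x ^_) (sym length-nonzeros)) (trans (cong (x *_) x^[q-1]≡1) (*-identityʳ x))
    where
    Π = foldr _*_ 1# nonzeros
    Π≢0 : ∀ xs → xs ⊆ nonzeros → foldr _*_ 1# xs ≢ 0#
    Π≢0 []       _   = 1≢0
    Π≢0 (x ∷ xs) xs⊆ = *-≢0 (nonzeros⇒≢0 (xs⊆ (here refl))) (Π≢0 xs (xs⊆ ∘ there))
    closed : map (x *_) nonzeros ⊆ nonzeros
    closed xy∈ with y , y∈ , refl ← ∈-map⁻ (x *_) xy∈ = ∈-nonzeros (*-≢0 x≢0 (nonzeros⇒≢0 y∈))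
    x^[q-1]≡1 : x ^ length nonzeros ≡ 1#
    x^[q-1]≡1 = *-cancelˡ (Π≢0 nonzeros id) (begin
      Π * x ^ length nonzeros ≡⟨ *-comm Π _ ⟩
      x ^ length nonzeros * Π ≡⟨ translate-invariant *-isCommutativeMonoid x (*-cancelˡ x≢0) nonzeros-unique closed ⟨
      Π ≡⟨ *-identityʳ Π ⟨
      Π * 1# ∎)
      where open ≡-Reasoning

  open SemiringMult semiring using (×1-homo-*) renaming (_×_ to _×′_)
  open import Algebra.Properties.AbelianGroup (CommutativeRing.+-abelianGroup commutativeRing)
    using (∙-cancelˡ; identityˡ-unique)

  q×1≡0 : q ×′ 1# ≡ 0#
  q×1≡0 = trans (cong (_×′ 1#) (sym length-elements)) (identityˡ-unique _ _ (sym
    (translate-invariant +-isCommutativeMonoid 1# (∙-cancelˡ 1# _ _) elements-unique (λ {x} _ → ∈-elements x))))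

  -- The power (1 + 1)^n equals 2^n · 1 = q · 1 = 0, and a field has no nonzero nilpotents.
  characteristic-2 : ∀ n → q ≡ 2 ℕ.^ n → 1# + 1# ≡ 0#
  characteristic-2 n refl = ^≡0 (1# + 1#) n (trans (sym (2^n×1 n)) q×1≡0)
    where
    2^n×1 : ∀ n → (2 ℕ.^ n) ×′ 1# ≡ (1# + 1#) ^ n
    2^n×1 zero    = +-identityʳ 1#
    2^n×1 (suc n) = trans (×1-homo-* 2 (2 ℕ.^ n))
      (cong₂ _*_ (cong (1# +_) (+-identityʳ 1#)) (2^n×1 n))

-- 2×2 matrices and bilinear forms

record Quad {a} (R : Set a) : Set a where
  constructor quad
  field e₁ e₂ e₃ e₄ : R

-- A quad is both the 2×2 matrix with rows (e₁ , e₂) and (e₃ , e₄), and the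
-- coefficient vector of a plane, seen as the form `bil` below.  The operations
-- are generic so that the same formulas serve field elements and the
-- polynomials of the ring solver.
module Forms {a} {R : Set a} (_+_ _*_ : R → R → R) where

  infixl 6 _⊞_
  _⊞_ : R → R → R
  _⊞_ = _+_
  infixl 7 _⊠_
  _⊠_ : R → R → R
  _⊠_ = _*_

  det : Quad R → R
  det (quad a b c d) = a ⊠ d ⊞ b ⊠ c

  trace : Quad R → R
  trace (quad a b c d) = a ⊞ d

  bracket : R × R → R × R → R
  bracket (x , y) (x′ , y′) = x ⊠ y′ ⊞ y ⊠ x′

  infixr 8 _•_
  _•_ : R → R × R → R × R
  k • (x , y) = k ⊠ x , k ⊠ y

  scale : R → Quad R → Quad R
  scale k (quad a b c d) = quad (k ⊠ a) (k ⊠ b) (k ⊠ c) (k ⊠ d)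

  apply : Quad R → R × R → R × R
  apply (quad a b c d) (x , y) = a ⊠ x ⊞ b ⊠ y , c ⊠ x ⊞ d ⊠ y

  column₁ column₂ : Quad R → R × R
  column₁ (quad a b c d) = a , c
  column₂ (quad a b c d) = b , d

  columns : R × R → R × R → Quad R
  columns (a , c) (b , d) = quad a b c d

  mul : Quad R → Quad R → Quad R
  mul g h = columns (apply g (column₁ h)) (apply g (column₂ h))

  -- The adjugate, with signs dropped because the characteristic will be 2; it inverts matrices of
  -- determinant 1.
  inv : Quad R → Quad R
  inv (quad a b c d) = quad d b c a

  -- The monomials are ordered so that (1 , t) and (1 , σ(t)) give 1, t, σ(t), t σ(t), the
  -- coordinates of the arc point at t.
  bil : Quad R → R × R → R × R → R
  bil (quad a b c d) (x , y) (x′ , y′) = a ⊠ (x ⊠ x′) ⊞ b ⊠ (y ⊠ x′) ⊞ c ⊠ (x ⊠ y′) ⊞ d ⊠ (y ⊠ y′)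

  -- Substitution of `g` in the first argument of the form and of `g′` in the second. Keeping the
  -- two independent makes the identities polynomial; later `g′` is σ(g).
  pull : Quad R → Quad R → Quad R → Quad R
  pull g g′ A = quad
    (bil A (column₁ g) (column₁ g′)) (bil A (column₂ g) (column₁ g′))
    (bil A (column₁ g) (column₂ g′)) (bil A (column₂ g) (column₂ g′))

  outer : R × R → R × R → Quad R
  outer (x , y) (x′ , y′) = quad (x ⊠ x′) (y ⊠ x′) (x ⊠ y′) (y ⊠ y′)

  lin : Quad R → Quad R → R
  lin (quad a b c d) (quad x y z w) = a ⊠ x ⊞ b ⊠ y ⊞ c ⊠ z ⊞ d ⊠ w

  row₁ row₂ : Quad R → R × R
  row₁ (quad a b c d) = a , b
  row₂ (quad a b c d) = c , d

  -- The Kronecker product of `g` and `g′` applied to `X`.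
  transform : Quad R → Quad R → Quad R → Quad R
  transform g g′ X = quad
    (lin (outer (row₁ g) (row₁ g′)) X) (lin (outer (row₂ g) (row₁ g′)) X)
    (lin (outer (row₁ g) (row₂ g′)) X) (lin (outer (row₂ g) (row₂ g′)) X)

  -- The coefficients of the product of the linear forms `bracket u` and `bracket w′`, that is, a
  -- form of rank one.
  join : R × R → R × R → Quad R
  join (x , y) (x′ , y′) = quad (y ⊠ y′) (x ⊠ y′) (y ⊠ x′) (x ⊠ x′)

quad≡ : ∀ {a} {A : Set a} {a b c d a′ b′ c′ d′ : A} → a ≡ a′ → b ≡ b′ → c ≡ c′ → d ≡ d′ → quad a b c d ≡ quad a′ b′ c′ d′
quad≡ refl refl refl refl = refl

-- The ring solver over 𝔽₂ and the powers of the Frobenius map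

module CharacteristicTwo {c q} (F : FiniteField c q)
  (1+1≡0 : FiniteField._+_ F (FiniteField.1# F) (FiniteField.1# F) ≡ FiniteField.0# F) where

  open FiniteField F
  open FiniteFieldProperties F

  -- With 𝔽₂ as its coefficient ring the solver knows that 1 + 1 = 0, so it proves identities that
  -- hold only in characteristic 2.
  fromBool : Bool → Carrier
  fromBool b = if b then 1# else 0#

  fromBool-xor : ∀ a b → fromBool (a xor b) ≡ fromBool a + fromBool b
  fromBool-xor false b     = sym (+-identityˡ _)
  fromBool-xor true  false = sym (+-identityʳ _)
  fromBool-xor true  true  = sym 1+1≡0

  fromBool-∧ : ∀ a b → fromBool (a ∧ b) ≡ fromBool a * fromBool b
  fromBool-∧ false b = sym (zeroˡ _)
  fromBool-∧ true  b = sym (*-identityˡ _)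

  private
    𝔽₂ = CommutativeRing.rawRing xor-∧-commutativeRing
    R  = fromCommutativeSemiring commutativeSemiring

    fromBool-homomorphism : 𝔽₂ -Raw-AlmostCommutative⟶ R
    fromBool-homomorphism = record
      { ⟦_⟧    = fromBool
      ; +-homo = fromBool-xor
      ; *-homo = fromBool-∧
      ; -‿homo = λ _ → refl
      ; 0-homo = refl
      ; 1-homo = refl
      }

    _≟₂_ : ∀ b b′ → Maybe (fromBool b ≡ fromBool b′)
    false ≟₂ false = just refl
    true  ≟₂ true  = just refl
    _     ≟₂ _     = nothing

  open RingSolver 𝔽₂ R fromBool-homomorphism _≟₂_ public
    using (solve; _:=_; _:+_; _:*_; con; Polynomial)

  ⟨0⟩ ⟨1⟩ : ∀ {m} → Polynomial m
  ⟨0⟩ = con false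
  ⟨1⟩ = con true

  module S {m : ℕ} = Forms {R = Polynomial m} _:+_ _:*_

  x+x≡0 : ∀ x → x + x ≡ 0#
  x+x≡0 = solve 1 (λ x → x :+ x := ⟨0⟩) refl

  +≡0⇒≡ : ∀ {x y} → x + y ≡ 0# → x ≡ y
  +≡0⇒≡ {x} {y} x+y≡0 = begin
    x ≡⟨ solve 2 (λ x y → x := (x :+ y) :+ y) refl x y ⟩
    x + y + y   ≡⟨ cong (_+ y) x+y≡0 ⟩
    0# + y      ≡⟨ +-identityˡ y ⟩
    y ∎
    where open ≡-Reasoning

  ≡⇒+≡0 : ∀ {x y} → x ≡ y → x + y ≡ 0#
  ≡⇒+≡0 refl = x+x≡0 _

  +-moveˡ : ∀ {x y z} → x + y ≡ z → x ≡ z + y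
  +-moveˡ {x} {y} refl = solve 2 (λ x y → x := (x :+ y) :+ y) refl x y

  square-injective : ∀ {x y} → x * x ≡ y * y → x ≡ y
  square-injective {x} {y} x²≡y² = +≡0⇒≡ ([ id , id ]′ (*-≡0 (begin
    (x + y) * (x + y) ≡⟨ solve 2 (λ x y → (x :+ y) :* (x :+ y) := x :* x :+ y :* y) refl x y ⟩
    x * x + y * y     ≡⟨ ≡⇒+≡0 x²≡y² ⟩
    0# ∎)))
    where open ≡-Reasoning

  √ : ∀ y → ∃[ x ] x * x ≡ y
  √ = injective⇒surjective (λ x → x * x) square-injective

  idempotent⇒0∨1 : ∀ {x} → x * x ≡ x → x ≡ 0# ⊎ x ≡ 1#
  idempotent⇒0∨1 {x} x²≡x = [ inj₁ , inj₂ ∘ +≡0⇒≡ ]′ (*-≡0 (begin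
    x * (x + 1#) ≡⟨ solve 1 (λ x → x :* (x :+ ⟨1⟩) := x :* x :+ x) refl x ⟩
    x * x + x    ≡⟨ ≡⇒+≡0 x²≡x ⟩
    0# ∎))
    where open ≡-Reasoning

  φ : ℕ → Carrier → Carrier
  φ k x = x ^ (2 ℕ.^ k)

  φ-homo-∘ : ∀ j k x → φ (j ℕ.+ k) x ≡ φ k (φ j x)
  φ-homo-∘ j k x = trans (cong (x ^_) (ℕ.^-distribˡ-+-* 2 j k))
    (sym (Exp.^-assocʳ semiring x (2 ℕ.^ j) (2 ℕ.^ k)))

  φ-one : ∀ x → φ 1 x ≡ x * x
  φ-one x = cong (x *_) (*-identityʳ x)

  φ-homo-+ : ∀ k x y → φ k (x + y) ≡ φ k x + φ k y
  φ-homo-+ zero    x y = trans (*-identityʳ _) (sym (cong₂ _+_ (*-identityʳ x) (*-identityʳ y)))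
  φ-homo-+ (suc k) x y = begin
    φ (suc k) (x + y) ≡⟨ φ-suc (x + y) ⟩
    φ k ((x + y) * (x + y))       ≡⟨ cong (φ k) (solve 2 (λ x y → (x :+ y) :* (x :+ y) := x :* x :+ y :* y) refl x y) ⟩
    φ k (x * x + y * y) ≡⟨ φ-homo-+ k (x * x) (y * y) ⟩
    φ k (x * x) + φ k (y * y)     ≡⟨ cong₂ _+_ (φ-suc x) (φ-suc y) ⟨
    φ (suc k) x + φ (suc k) y     ∎
    where
    open ≡-Reasoning
    φ-suc : ∀ x → φ (suc k) x ≡ φ k (x * x)
    φ-suc x = trans (φ-homo-∘ 1 k x) (cong (φ k) (φ-one x))

  φ-fixed-* : ∀ j k {x} → φ k x ≡ x → φ (j ℕ.* k) x ≡ x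
  φ-fixed-* zero    k {x} _     = *-identityʳ x
  φ-fixed-* (suc j) k {x} fixed = begin
    φ (k ℕ.+ j ℕ.* k) x     ≡⟨ φ-homo-∘ k (j ℕ.* k) x ⟩
    φ (j ℕ.* k) (φ k x)     ≡⟨ cong (φ (j ℕ.* k)) fixed ⟩
    φ (j ℕ.* k) x ≡⟨ φ-fixed-* j k fixed ⟩
    x ∎
    where open ≡-Reasoning

  -- Bézout in the exponents without subtraction: `φ (j * k)` fixes `x`, so applying it before `φ d`
  -- changes nothing and turns d into the multiple i m.
  φ-fixed-difference : ∀ i m j k d {x} → φ m x ≡ x → φ k x ≡ x →
                       d ℕ.+ j ℕ.* k ≡ i ℕ.* m → φ d x ≡ x
  φ-fixed-difference i m j k d {x} m-fixed k-fixed eq = begin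
    φ d x ≡⟨ cong (φ d) (φ-fixed-* j k k-fixed) ⟨
    φ d (φ (j ℕ.* k) x)     ≡⟨ φ-homo-∘ (j ℕ.* k) d x ⟨
    φ (j ℕ.* k ℕ.+ d) x     ≡⟨ cong (λ e → φ e x) (trans (ℕ.+-comm (j ℕ.* k) d) eq) ⟩
    φ (i ℕ.* m) x ≡⟨ φ-fixed-* i m m-fixed ⟩
    x ∎
    where open ≡-Reasoning

  φ-fixed-gcd : ∀ n h {x} → φ n x ≡ x → φ h x ≡ x → φ (gcd n h) x ≡ x
  φ-fixed-gcd n h n-fixed h-fixed with Bézout.identity (gcd-GCD n h)
  ... | Bézout.+- i j eq = φ-fixed-difference i n j h _ n-fixed h-fixed eq
  ... | Bézout.-+ i j eq = φ-fixed-difference j h i n _ h-fixed n-fixed eq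

  -- By `fermat`, `φ n` is the identity. An element fixed by `φ h` as well is fixed by `φ 1`, hence
  -- satisfies x² = x.
  φ-fixed⇒0∨1 : ∀ n h → q ≡ 2 ℕ.^ n → gcd n h ≡ 1 → ∀ {x} → φ h x ≡ x → x ≡ 0# ⊎ x ≡ 1#
  φ-fixed⇒0∨1 n h q≡2^n coprime {x} fixed = idempotent⇒0∨1 (begin
    x * x ≡⟨ φ-one x ⟨
    φ 1 x ≡⟨ cong (λ e → φ e x) coprime ⟨
    φ (gcd n h) x   ≡⟨ φ-fixed-gcd n h (trans (cong (x ^_) (sym q≡2^n)) (fermat x)) fixed ⟩
    x ∎)
    where open ≡-Reasoning

-- The automorphism σ and its fixed field

module TwistedForms {c q} (F : FiniteField c q)
  (1+1≡0 : FiniteField._+_ F (FiniteField.1# F) (FiniteField.1# F) ≡ FiniteField.0# F)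
  (h : ℕ)
  (φ-fixed : ∀ {x} → CharacteristicTwo.φ F 1+1≡0 h x ≡ x → x ≡ FiniteField.0# F ⊎ x ≡ FiniteField.1# F)
  where

  open FiniteField F
  open FiniteFieldProperties F
  open CharacteristicTwo F 1+1≡0
  open Forms _+_ _*_ public
  open ≡-Reasoning

  -- Sealed: σ is used through these laws, and `σ-def` reopens it where the coordinates of the arc
  -- are compared.
  abstract

    σ : Carrier → Carrier
    σ = φ h

    σ-def : ∀ x → σ x ≡ φ h x
    σ-def _ = refl

    σ-+ : ∀ x y → σ (x + y) ≡ σ x + σ y
    σ-+ = φ-homo-+ h

    σ-* : ∀ x y → σ (x * y) ≡ σ x * σ y
    σ-* x y = CommutativeExp.^-distrib-* commutativeSemiring x y (2 ℕ.^ h)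

    σ-≡0 : ∀ {x} → σ x ≡ 0# → x ≡ 0#
    σ-≡0 {x} = ^≡0 x (2 ℕ.^ h)

    σ-fixed : ∀ {x} → σ x ≡ x → x ≡ 0# ⊎ x ≡ 1#
    σ-fixed = φ-fixed

  σ-≢0 : ∀ {x} → x ≢ 0# → σ x ≢ 0#
  σ-≢0 x≢0 = x≢0 ∘ σ-≡0

  σ-0 : σ 0# ≡ 0#
  σ-0 = trans (cong σ (sym (+-identityˡ 0#))) (trans (σ-+ 0# 0#) (x+x≡0 (σ 0#)))

  σ-1 : σ 1# ≡ 1#
  σ-1 = [ (λ σ1≡0 → contradiction (σ-≡0 σ1≡0) 1≢0) , id ]′
    (idempotent⇒0∨1 (trans (sym (σ-* 1# 1#)) (cong σ (*-identityˡ 1#))))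

  σ-injective : ∀ {x y} → σ x ≡ σ y → x ≡ y
  σ-injective {x} {y} σx≡σy = +≡0⇒≡ (σ-≡0 (trans (σ-+ x y) (≡⇒+≡0 σx≡σy)))

  σ-surjective : ∀ y → ∃[ x ] σ x ≡ y
  σ-surjective = injective⇒surjective σ σ-injective

  -- The ratio x / y is fixed by σ and nonzero, hence equal to 1.
  σ-proportional : ∀ {x y} → x ≢ 0# → y ≢ 0# → x * σ y ≡ σ x * y → x ≡ y
  σ-proportional {x} {y} x≢0 y≢0 xσy≡σxy = [
    (λ r≡0 → contradiction (trans (sym ry≡x) (trans (cong (_* y) r≡0) (zeroˡ y))) x≢0) ,
    (λ r≡1 → trans (sym ry≡x) (trans (cong (_* y) r≡1) (*-identityˡ y))) ]′ (σ-fixed (sym r≡σr))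
    where
    r = x * y ⁻¹
    ry≡x : r * y ≡ x
    ry≡x = begin
      x * y ⁻¹ * y   ≡⟨ solve 3 (λ x y z → x :* z :* y := x :* (y :* z)) refl x y (y ⁻¹) ⟩
      x * (y * y ⁻¹) ≡⟨ cong (x *_) (*-inverseʳ y≢0) ⟩
      x * 1# ≡⟨ *-identityʳ x ⟩
      x ∎
    r≡σr : r ≡ σ r
    r≡σr = *-cancelˡ (*-≢0 y≢0 (σ-≢0 y≢0)) (begin
      y * σ y * r ≡⟨ solve 3 (λ y s r → y :* s :* r := (r :* y) :* s) refl y (σ y) r ⟩
      r * y * σ y ≡⟨ cong (_* σ y) ry≡x ⟩
      x * σ y ≡⟨ xσy≡σxy ⟩
      σ x * y ≡⟨ cong (λ z → σ z * y) ry≡x ⟨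
      σ (r * y) * y       ≡⟨ cong (_* y) (σ-* r y) ⟩
      σ r * σ y * y       ≡⟨ solve 3 (λ y s r → r :* s :* y := y :* s :* r) refl y (σ y) (σ r) ⟩
      y * σ y * σ r       ∎)

  -- On nonzero t the map σ(t)/t is injective by `σ-proportional` and avoids 0; at t = 0 the product
  -- σ(0) · 0⁻¹ is 0. So it is an injection of the whole finite field into itself.
  σ-ratio : ∀ k → ∃[ t ] σ t * t ⁻¹ ≡ k
  σ-ratio = injective⇒surjective ψ ψ-injective
    where
    ψ : Carrier → Carrier
    ψ t = σ t * t ⁻¹
    ψ*t : ∀ {t} → t ≢ 0# → ψ t * t ≡ σ t
    ψ*t {t} t≢0 = begin
      σ t * t ⁻¹ * t   ≡⟨ solve 3 (λ x y z → x :* z :* y := x :* (y :* z)) refl (σ t) t (t ⁻¹) ⟩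
      σ t * (t * t ⁻¹) ≡⟨ cong (σ t *_) (*-inverseʳ t≢0) ⟩
      σ t * 1# ≡⟨ *-identityʳ (σ t) ⟩
      σ t ∎
    ψ0≡0 : ψ 0# ≡ 0#
    ψ0≡0 = trans (cong (_* 0# ⁻¹) σ-0) (zeroˡ _)
    ψ≡0⇒≡0 : ∀ {t} → ψ t ≡ 0# → t ≡ 0#
    ψ≡0⇒≡0 {t} ψt≡0 with t ≟ 0#
    ... | yes t≡0 = t≡0
    ... | no  t≢0 = contradiction ψt≡0 (*-≢0 (σ-≢0 t≢0) (⁻¹≢0 t≢0))
    ψ-injective : ∀ {t u} → ψ t ≡ ψ u → t ≡ u
    ψ-injective {t} {u} ψt≡ψu with t ≟ 0# | u ≟ 0#
    ... | yes refl | _        = sym (ψ≡0⇒≡0 (trans (sym ψt≡ψu) ψ0≡0))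
    ... | no _     | yes refl = ψ≡0⇒≡0 (trans ψt≡ψu ψ0≡0)
    ... | no t≢0   | no u≢0   = σ-proportional t≢0 u≢0 (begin
      t * σ u ≡⟨ cong (t *_) (ψ*t u≢0) ⟨
      t * (ψ u * u)   ≡⟨ cong (λ z → t * (z * u)) ψt≡ψu ⟨
      t * (ψ t * u)   ≡⟨ solve 3 (λ t p u → t :* (p :* u) := (p :* t) :* u) refl t (ψ t) u ⟩
      ψ t * t * u     ≡⟨ cong (_* u) (ψ*t t≢0) ⟩
      σ t * u ∎)

  -- In characteristic 2 the equation says σ(t)/t = b/c, which `σ-ratio` solves.
  σ-linear-root : ∀ {b c} → b ≢ 0# → c ≢ 0# → ∃[ t ] t ≢ 0# × b * t + c * σ t ≡ 0#
  σ-linear-root {b} {c} b≢0 c≢0 with t , eq ← σ-ratio (b * c ⁻¹) = t , t≢0 , ≡⇒+≡0 (sym (begin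
    c * σ t ≡⟨ *-identityʳ _ ⟨
    c * σ t * 1# ≡⟨ cong (c * σ t *_) (*-inverseʳ t≢0) ⟨
    c * σ t * (t * t ⁻¹)    ≡⟨ solve 4 (λ c s t i → c :* s :* (t :* i) := c :* t :* (s :* i)) refl c (σ t) t (t ⁻¹) ⟩
    c * t * (σ t * t ⁻¹)    ≡⟨ cong (c * t *_) eq ⟩
    c * t * (b * c ⁻¹)      ≡⟨ solve 4 (λ c t b i → c :* t :* (b :* i) := (c :* i) :* (b :* t)) refl c t b (c ⁻¹) ⟩
    c * c ⁻¹ * (b * t)      ≡⟨ cong (_* (b * t)) (*-inverseʳ c≢0) ⟩
    1# * (b * t) ≡⟨ *-identityˡ _ ⟩
    b * t ∎))
    where
    t≢0 : t ≢ 0#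
    t≢0 refl = *-≢0 b≢0 (⁻¹≢0 c≢0) (trans (sym eq) (trans (cong (_* 0# ⁻¹) σ-0) (zeroˡ _)))

  σ-linear-root-unique : ∀ {b c t u} → c ≢ 0# → t ≢ 0# → u ≢ 0# →
                         b * t + c * σ t ≡ 0# → b * u + c * σ u ≡ 0# → t ≡ u
  σ-linear-root-unique {b} {c} {t} {u} c≢0 t≢0 u≢0 eqₜ eqᵤ = σ-proportional t≢0 u≢0 (*-cancelˡ c≢0 (begin
    c * (t * σ u)   ≡⟨ solve 3 (λ c t s → c :* (t :* s) := t :* (c :* s)) refl c t (σ u) ⟩
    t * (c * σ u)   ≡⟨ cong (t *_) (+≡0⇒≡ eqᵤ) ⟨
    t * (b * u)     ≡⟨ solve 3 (λ t b u → t :* (b :* u) := (b :* t) :* u) refl t b u ⟩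
    b * t * u       ≡⟨ cong (_* u) (+≡0⇒≡ eqₜ) ⟩
    c * σ t * u     ≡⟨ *-assoc c (σ t) u ⟩
    c * (σ t * u)   ∎))

  -- The action of SL(2,q) on twisted forms

  σ² : Carrier × Carrier → Carrier × Carrier
  σ² (x , y) = σ x , σ y

  σ⁴ : Quad Carrier → Quad Carrier
  σ⁴ (quad a b c d) = quad (σ a) (σ b) (σ c) (σ d)

  form : Quad Carrier → Carrier × Carrier → Carrier
  form A v = bil A v (σ² v)

  -- Substitution is a right action: `act-mul` reverses the order of the factors.
  act : Quad Carrier → Quad Carrier → Quad Carrier
  act g = pull g (σ⁴ g)

  one : Quad Carrier
  one = quad 1# 0# 0# 1#

  σ²-apply : ∀ g v → σ² (apply g v) ≡ apply (σ⁴ g) (σ² v)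
  σ²-apply (quad a b c d) (x , y) = cong₂ _,_ (linear a x b y) (linear c x d y)
    where
    linear : ∀ a x b y → σ (a * x + b * y) ≡ σ a * σ x + σ b * σ y
    linear a x b y = trans (σ-+ (a * x) (b * y)) (cong₂ _+_ (σ-* a x) (σ-* b y))

  σ²-• : ∀ k v → σ² (k • v) ≡ σ k • σ² v
  σ²-• k (x , y) = cong₂ _,_ (σ-* k x) (σ-* k y)

  bil-pull : ∀ A g g′ u v → bil (pull g g′ A) u v ≡ bil A (apply g u) (apply g′ v)
  bil-pull (quad a b c d) (quad α β γ δ) (quad α′ β′ γ′ δ′) (u₁ , u₂) (v₁ , v₂) =
    solve 16 (λ a b c d α β γ δ α′ β′ γ′ δ′ u₁ u₂ v₁ v₂ →
      S.bil (S.pull (quad α β γ δ) (quad α′ β′ γ′ δ′) (quad a b c d)) (u₁ , u₂) (v₁ , v₂) :=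
      S.bil (quad a b c d) (S.apply (quad α β γ δ) (u₁ , u₂)) (S.apply (quad α′ β′ γ′ δ′) (v₁ , v₂)))
      refl a b c d α β γ δ α′ β′ γ′ δ′ u₁ u₂ v₁ v₂

  bil-• : ∀ A k l u v → bil A (k • u) (l • v) ≡ k * l * bil A u v
  bil-• (quad a b c d) k l (u₁ , u₂) (v₁ , v₂) =
    solve 10 (λ a b c d k l u₁ u₂ v₁ v₂ →
      S.bil (quad a b c d) (k S.• (u₁ , u₂)) (l S.• (v₁ , v₂)) := (k :* l) :* S.bil (quad a b c d) (u₁ , u₂) (v₁ , v₂))
      refl a b c d k l u₁ u₂ v₁ v₂

  bil-scale : ∀ k A u v → bil (scale k A) u v ≡ k * bil A u v
  bil-scale k (quad a b c d) (u₁ , u₂) (v₁ , v₂) =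
    solve 9 (λ a b c d k u₁ u₂ v₁ v₂ →
      S.bil (S.scale k (quad a b c d)) (u₁ , u₂) (v₁ , v₂) := k :* S.bil (quad a b c d) (u₁ , u₂) (v₁ , v₂))
      refl a b c d k u₁ u₂ v₁ v₂

  bil-join : ∀ u w′ v v′ → bil (join u w′) v v′ ≡ bracket u v * bracket w′ v′
  bil-join (u₁ , u₂) (w₁ , w₂) (v₁ , v₂) (z₁ , z₂) =
    solve 8 (λ u₁ u₂ w₁ w₂ v₁ v₂ z₁ z₂ →
      S.bil (S.join (u₁ , u₂) (w₁ , w₂)) (v₁ , v₂) (z₁ , z₂) :=
      S.bracket (u₁ , u₂) (v₁ , v₂) :* S.bracket (w₁ , w₂) (z₁ , z₂))
      refl u₁ u₂ w₁ w₂ v₁ v₂ z₁ z₂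

  det-mul : ∀ g h → det (mul g h) ≡ det g * det h
  det-mul (quad a b c d) (quad α β γ δ) =
    solve 8 (λ a b c d α β γ δ →
      S.det (S.mul (quad a b c d) (quad α β γ δ)) := S.det (quad a b c d) :* S.det (quad α β γ δ))
      refl a b c d α β γ δ

  det-pull : ∀ g g′ A → det (pull g g′ A) ≡ det g * det g′ * det A
  det-pull (quad a b c d) (quad a′ b′ c′ d′) (quad α β γ δ) =
    solve 12 (λ a b c d a′ b′ c′ d′ α β γ δ →
      S.det (S.pull (quad a b c d) (quad a′ b′ c′ d′) (quad α β γ δ)) :=
      S.det (quad a b c d) :* S.det (quad a′ b′ c′ d′) :* S.det (quad α β γ δ))
      refl a b c d a′ b′ c′ d′ α β γ δ

  det-inv : ∀ g → det (inv g) ≡ det g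
  det-inv (quad a b c d) = solve 4 (λ a b c d →
    S.det (S.inv (quad a b c d)) := S.det (quad a b c d)) refl a b c d

  det-scale : ∀ k A → det (scale k A) ≡ k * k * det A
  det-scale k (quad a b c d) = solve 5 (λ k a b c d →
    S.det (S.scale k (quad a b c d)) := k :* k :* S.det (quad a b c d)) refl k a b c d

  det-join : ∀ u v → det (join u v) ≡ 0#
  det-join (u₁ , u₂) (v₁ , v₂) = solve 4 (λ u₁ u₂ v₁ v₂ →
    S.det (S.join (u₁ , u₂) (v₁ , v₂)) := ⟨0⟩) refl u₁ u₂ v₁ v₂

  bracket-apply : ∀ g u v → bracket (apply g u) (apply g v) ≡ det g * bracket u v
  bracket-apply (quad a b c d) (u₁ , u₂) (v₁ , v₂) = solve 8 (λ a b c d u₁ u₂ v₁ v₂ →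
    S.bracket (S.apply (quad a b c d) (u₁ , u₂)) (S.apply (quad a b c d) (v₁ , v₂)) :=
    S.det (quad a b c d) :* S.bracket (u₁ , u₂) (v₁ , v₂)) refl a b c d u₁ u₂ v₁ v₂

  bracket-• : ∀ k l u v → bracket (k • u) (l • v) ≡ k * l * bracket u v
  bracket-• k l (u₁ , u₂) (v₁ , v₂) = solve 6 (λ k l u₁ u₂ v₁ v₂ →
    S.bracket (k S.• (u₁ , u₂)) (l S.• (v₁ , v₂)) := k :* l :* S.bracket (u₁ , u₂) (v₁ , v₂)) refl k l u₁ u₂ v₁ v₂

  bracket-self : ∀ v → bracket v v ≡ 0#
  bracket-self (x , y) = solve 2 (λ x y → S.bracket (x , y) (x , y) := ⟨0⟩) refl x y

  apply-mul : ∀ g h v → apply (mul g h) v ≡ apply g (apply h v)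
  apply-mul (quad a b c d) (quad α β γ δ) (x , y) = cong₂ _,_
    (solve 8 (λ a b α β γ δ x y →
       (a :* α :+ b :* γ) :* x :+ (a :* β :+ b :* δ) :* y :=
       a :* (α :* x :+ β :* y) :+ b :* (γ :* x :+ δ :* y)) refl a b α β γ δ x y)
    (solve 8 (λ a b α β γ δ x y →
       (a :* α :+ b :* γ) :* x :+ (a :* β :+ b :* δ) :* y :=
       a :* (α :* x :+ β :* y) :+ b :* (γ :* x :+ δ :* y)) refl c d α β γ δ x y)

  σ⁴-mul : ∀ g h → σ⁴ (mul g h) ≡ mul (σ⁴ g) (σ⁴ h)
  σ⁴-mul g h@(quad α β γ δ) = cong₂ columns (σ²-apply g (α , γ)) (σ²-apply g (β , δ))

  det-σ⁴ : ∀ g → det (σ⁴ g) ≡ σ (det g)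
  det-σ⁴ (quad a b c d) = sym (trans (σ-+ (a * d) (b * c)) (cong₂ _+_ (σ-* a d) (σ-* b c)))

  act-mul : ∀ g h A → act (mul g h) A ≡ act h (act g A)
  act-mul g h A = trans (cong (λ s → pull (mul g h) s A) (σ⁴-mul g h))
    (quad≡ (entry (column₁ h) (column₁ (σ⁴ h))) (entry (column₂ h) (column₁ (σ⁴ h)))
           (entry (column₁ h) (column₂ (σ⁴ h))) (entry (column₂ h) (column₂ (σ⁴ h))))
    where
    entry : ∀ u v → bil A (apply g u) (apply (σ⁴ g) v) ≡ bil (act g A) u v
    entry u v = sym (bil-pull A g (σ⁴ g) u v)

  act-one : ∀ A → act one A ≡ A
  act-one A@(quad a b c d) = trans (cong (λ s → pull one s A) (quad≡ σ-1 σ-0 σ-0 σ-1))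
    (quad≡
      (solve 4 (λ a b c d → S.bil (quad a b c d) (⟨1⟩ , ⟨0⟩) (⟨1⟩ , ⟨0⟩) := a) refl a b c d)
      (solve 4 (λ a b c d → S.bil (quad a b c d) (⟨0⟩ , ⟨1⟩) (⟨1⟩ , ⟨0⟩) := b) refl a b c d)
      (solve 4 (λ a b c d → S.bil (quad a b c d) (⟨1⟩ , ⟨0⟩) (⟨0⟩ , ⟨1⟩) := c) refl a b c d)
      (solve 4 (λ a b c d → S.bil (quad a b c d) (⟨0⟩ , ⟨1⟩) (⟨0⟩ , ⟨1⟩) := d) refl a b c d))

  mul-invʳ : ∀ {g} → det g ≡ 1# → mul g (inv g) ≡ one
  mul-invʳ {quad a b c d} det≡1 = quad≡ det≡1
    (solve 2 (λ a b → a :* b :+ b :* a := ⟨0⟩) refl a b)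
    (solve 2 (λ a b → a :* b :+ b :* a := ⟨0⟩) refl c d)
    (trans (solve 4 (λ a b c d → c :* b :+ d :* a := a :* d :+ b :* c) refl a b c d) det≡1)

  mul-invˡ : ∀ {g} → det g ≡ 1# → mul (inv g) g ≡ one
  mul-invˡ {g} det≡1 = mul-invʳ {inv g} (trans (det-inv g) det≡1)

  act-invʳ : ∀ {g} A → det g ≡ 1# → act (inv g) (act g A) ≡ A
  act-invʳ {g} A det≡1 = trans (sym (act-mul g (inv g) A))
    (trans (cong (λ e → act e A) (mul-invʳ det≡1)) (act-one A))

  mul-assoc : ∀ f g h → mul (mul f g) h ≡ mul f (mul g h)
  mul-assoc f g h = cong₂ columns (apply-mul f g (column₁ h)) (apply-mul f g (column₂ h))

  mul-one : ∀ g → mul g one ≡ g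
  mul-one (quad a b c d) = quad≡ (left a b) (right a b) (left c d) (right c d)
    where
    left : ∀ a b → a * 1# + b * 0# ≡ a
    left = solve 2 (λ a b → a :* ⟨1⟩ :+ b :* ⟨0⟩ := a) refl
    right : ∀ a b → a * 0# + b * 1# ≡ b
    right = solve 2 (λ a b → a :* ⟨0⟩ :+ b :* ⟨1⟩ := b) refl

  apply-one : ∀ v → apply one v ≡ v
  apply-one (x , y) = cong₂ _,_ (solve 2 (λ x y → ⟨1⟩ :* x :+ ⟨0⟩ :* y := x) refl x y)
                                (solve 2 (λ x y → ⟨0⟩ :* x :+ ⟨1⟩ :* y := y) refl x y)

  apply-invʳ : ∀ {g} v → det g ≡ 1# → apply g (apply (inv g) v) ≡ v
  apply-invʳ {g} v det≡1 = trans (sym (apply-mul g (inv g) v))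
    (trans (cong (λ e → apply e v) (mul-invʳ det≡1)) (apply-one v))

  form-act : ∀ A g v → form (act g A) v ≡ form A (apply g v)
  form-act A g v = trans (bil-pull A g (σ⁴ g) v (σ² v)) (cong (bil A (apply g v)) (sym (σ²-apply g v)))

  form-• : ∀ A k v → form A (k • v) ≡ k * σ k * form A v
  form-• A k v = trans (cong (bil A (k • v)) (σ²-• k v)) (bil-• A k (σ k) v (σ² v))

  det-act : ∀ g A → det g ≡ 1# → det A ≡ 1# → det (act g A) ≡ 1#
  det-act g A det-g≡1 det-A≡1 = begin
    det (act g A) ≡⟨ det-pull g (σ⁴ g) A ⟩
    det g * det (σ⁴ g) * det A  ≡⟨ cong₂ (λ x y → x * y * det A) det-g≡1 (trans (det-σ⁴ g) (cong σ det-g≡1)) ⟩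
    1# * σ 1# * det A ≡⟨ cong₂ (λ x y → 1# * x * y) σ-1 det-A≡1 ⟩
    1# * 1# * 1# ≡⟨ solve 0 (⟨1⟩ :* ⟨1⟩ :* ⟨1⟩ := ⟨1⟩) refl ⟩
    1# ∎

  -- Zeros on the projective line

  infix 4 _≟Q_
  _≟Q_ : DecidableEquality (Quad Carrier)
  quad a b c d ≟Q quad a′ b′ c′ d′ = map′
    (λ (p , q , r , s) → quad≡ p q r s)
    (λ eq → cong Quad.e₁ eq , cong Quad.e₂ eq , cong Quad.e₃ eq , cong Quad.e₄ eq)
    (a ≟ a′ ×-dec b ≟ b′ ×-dec c ≟ c′ ×-dec d ≟ d′)

  ℙ¹ : Set c
  ℙ¹ = Maybe Carrier

  pattern ∞ = nothing

  line : List ℙ¹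
  line = ∞ ∷ map just elements

  line-unique : Unique line
  line-unique = ∉⇒unique (λ ∞∈ → case ∈-map⁻ just ∞∈ of λ ()) (Unique.map⁺ just-injective elements-unique)

  ∈-line : ∀ x → x ∈ line
  ∈-line ∞        = here refl
  ∈-line (just t) = there (∈-map⁺ just (∈-elements t))

  length-line : length line ≡ suc q
  length-line = cong suc (trans (length-map just elements) length-elements)

  -- The normalisation matches the arc: (1 , t) belongs to the point `P[ t ]` and (0 , 1) to `U₄`.
  vec : ℙ¹ → Carrier × Carrier
  vec ∞        = 0# , 1#
  vec (just t) = 1# , t

  0⃗ : Carrier × Carrier
  0⃗ = 0# , 0#

  bracket-∞ : ∀ t → bracket (vec ∞) (vec (just t)) ≡ 1#
  bracket-∞ = solve 1 (λ t → S.bracket (⟨0⟩ , ⟨1⟩) (⟨1⟩ , t) := ⟨1⟩) refl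

  bracket-just : ∀ t u → bracket (vec (just t)) (vec (just u)) ≡ t + u
  bracket-just = solve 2 (λ t u → S.bracket (⟨1⟩ , t) (⟨1⟩ , u) := t :+ u) refl

  bracket-comm : ∀ u v → bracket u v ≡ bracket v u
  bracket-comm (a , b) (x , y) = solve 4 (λ a b x y → S.bracket (a , b) (x , y) := S.bracket (x , y) (a , b)) refl a b x y

  bracket≡0⇒≡ : ∀ x y → bracket (vec x) (vec y) ≡ 0# → x ≡ y
  bracket≡0⇒≡ ∞        ∞        _  = refl
  bracket≡0⇒≡ ∞        (just u) eq = contradiction (trans (sym (bracket-∞ u)) eq) 1≢0
  bracket≡0⇒≡ (just t) ∞        eq = contradiction (trans (sym (bracket-∞ t)) (trans (bracket-comm (vec ∞) (vec (just t))) eq)) 1≢0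
  bracket≡0⇒≡ (just t) (just u) eq = cong just (+≡0⇒≡ (trans (sym (bracket-just t u)) eq))

  abstract
    normalise : ∀ v → v ≢ 0⃗ → ∃[ x ] ∃[ k ] k ≢ 0# × v ≡ k • vec x
    normalise (x , y) v≢0 with x ≟ 0#
    ... | yes refl = ∞ , y , (λ { refl → v≢0 refl }) , cong₂ _,_ (sym (zeroʳ y)) (sym (*-identityʳ y))
    ... | no x≢0   = just (x ⁻¹ * y) , x , x≢0 , cong₂ _,_ (sym (*-identityʳ x)) (begin
      y ≡⟨ *-identityˡ y ⟨
      1# * y ≡⟨ cong (_* y) (*-inverseʳ x≢0) ⟨
      x * x ⁻¹ * y   ≡⟨ *-assoc x (x ⁻¹) y ⟩
      x * (x ⁻¹ * y) ∎)

  vec≢0 : ∀ x → vec x ≢ 0⃗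
  vec≢0 ∞        eq = 1≢0 (cong proj₂ eq)
  vec≢0 (just t) eq = 1≢0 (cong proj₁ eq)

  •-injective : ∀ {k l x y} → k ≢ 0# → l ≢ 0# → k • vec x ≡ l • vec y → x ≡ y
  •-injective {k} {l} {x} {y} k≢0 l≢0 eq = bracket≡0⇒≡ x y (*-cancelˡ (*-≢0 k≢0 l≢0) (begin
    k * l * bracket (vec x) (vec y)      ≡⟨ bracket-• k l (vec x) (vec y) ⟨
    bracket (k • vec x) (l • vec y)      ≡⟨ cong (λ v → bracket v (l • vec y)) eq ⟩
    bracket (l • vec y) (l • vec y)      ≡⟨ bracket-self (l • vec y) ⟩
    0# ≡⟨ zeroʳ (k * l) ⟨
    k * l * 0# ∎))

  apply-0⃗ : ∀ g → apply g 0⃗ ≡ 0⃗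
  apply-0⃗ (quad a b c d) = cong₂ _,_ (solve 2 (λ a b → a :* ⟨0⟩ :+ b :* ⟨0⟩ := ⟨0⟩) refl a b)
                                    (solve 2 (λ a b → a :* ⟨0⟩ :+ b :* ⟨0⟩ := ⟨0⟩) refl c d)

  apply-invˡ : ∀ {g} v → det g ≡ 1# → apply (inv g) (apply g v) ≡ v
  apply-invˡ {g} v det≡1 = apply-invʳ {inv g} v (trans (det-inv g) det≡1)

  apply≢0 : ∀ {g v} → det g ≡ 1# → v ≢ 0⃗ → apply g v ≢ 0⃗
  apply≢0 {g} {v} det≡1 v≢0 gv≡0 = v≢0 (begin
    v ≡⟨ apply-invˡ v det≡1 ⟨
    apply (inv g) (apply g v) ≡⟨ cong (apply (inv g)) gv≡0 ⟩
    apply (inv g) 0⃗ ≡⟨ apply-0⃗ (inv g) ⟩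
    0⃗ ∎)

  module Möbius {g} (det≡1 : det g ≡ 1#) where

    private
      image : ∀ x → ∃[ y ] ∃[ k ] k ≢ 0# × apply g (vec x) ≡ k • vec y
      image x = normalise (apply g (vec x)) (apply≢0 det≡1 (vec≢0 x))

    move : ℙ¹ → ℙ¹
    move x = proj₁ (image x)

    factor : ℙ¹ → Carrier
    factor x = proj₁ (proj₂ (image x))

    factor≢0 : ∀ x → factor x ≢ 0#
    factor≢0 x = proj₁ (proj₂ (proj₂ (image x)))

    apply-vec : ∀ x → apply g (vec x) ≡ factor x • vec (move x)
    apply-vec x = proj₂ (proj₂ (proj₂ (image x)))

    -- The bracket of two images is det g = 1 times the original bracket, and brackets of normalised
    -- vectors vanish exactly for equal points.
    move-injective : ∀ {x y} → move x ≡ move y → x ≡ y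
    move-injective {x} {y} eq = bracket≡0⇒≡ x y (begin
      bracket (vec x) (vec y) ≡⟨ *-identityˡ _ ⟨
      1# * bracket (vec x) (vec y) ≡⟨ cong (_* bracket (vec x) (vec y)) det≡1 ⟨
      det g * bracket (vec x) (vec y) ≡⟨ bracket-apply g (vec x) (vec y) ⟨
      bracket (apply g (vec x)) (apply g (vec y))   ≡⟨ cong₂ bracket (apply-vec x) (apply-vec y) ⟩
      bracket (factor x • vec (move x)) (factor y • vec (move y))
        ≡⟨ bracket-• (factor x) (factor y) (vec (move x)) (vec (move y)) ⟩
      factor x * factor y * bracket (vec (move x)) (vec (move y))
        ≡⟨ cong (λ z → factor x * factor y * bracket (vec z) (vec (move y))) eq ⟩
      factor x * factor y * bracket (vec (move y)) (vec (move y))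
        ≡⟨ cong (factor x * factor y *_) (bracket-self (vec (move y))) ⟩
      factor x * factor y * 0# ≡⟨ zeroʳ _ ⟩
      0# ∎)

  Zero : Quad Carrier → ℙ¹ → Set c
  Zero A x = form A (vec x) ≡ 0#

  zero? : ∀ A → Decidable (Zero A)
  zero? A x = form A (vec x) ≟ 0#

  abstract
    zeros : Quad Carrier → List ℙ¹
    zeros A = filter (zero? A) line

    zeros-unique : ∀ A → Unique (zeros A)
    zeros-unique A = Unique.filter⁺ (zero? A) line-unique

    ∈-zeros : ∀ A {x} → Zero A x → x ∈ zeros A
    ∈-zeros A = ∈-filter⁺ (zero? A) (∈-line _)

    ∈-zeros⁻ : ∀ A {x} → x ∈ zeros A → Zero A x
    ∈-zeros⁻ A x∈ = proj₂ (∈-filter⁻ (zero? A) {xs = line} x∈)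

  #zeros : Quad Carrier → ℕ
  #zeros A = length (zeros A)

  #zeros-mono : ∀ A B (τ : ℙ¹ → ℙ¹) → (∀ {x y} → τ x ≡ τ y → x ≡ y) →
                (∀ x → Zero A x → Zero B (τ x)) → #zeros A ℕ.≤ #zeros B
  #zeros-mono A B τ τ-injective preserves = subst (ℕ._≤ #zeros B) (length-map τ (zeros A))
    (unique-⊆⇒length≤ (Unique.map⁺ τ-injective (zeros-unique A)) τ-zeros⊆)
    where
    τ-zeros⊆ : map τ (zeros A) ⊆ zeros B
    τ-zeros⊆ y∈ with x , x∈ , refl ← ∈-map⁻ τ y∈ = ∈-zeros B (preserves x (∈-zeros⁻ A x∈))

  #zeros-list : ∀ A {xs} → Unique xs → (∀ {x} → x ∈ xs → Zero A x) → (∀ x → Zero A x → x ∈ xs) →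
                #zeros A ≡ length xs
  #zeros-list A xs! sound complete = unique-⊆⊇⇒length≡ (zeros-unique A) xs!
    (λ x∈ → complete _ (∈-zeros⁻ A x∈)) (λ x∈ → ∈-zeros A (sound x∈))

  -- By `form-act` the Möbius map of `g` injects the zeros of `act g A` into those of `A`; the
  -- inverse of `g` gives the opposite inequality.
  #zeros-act : ∀ g A → det g ≡ 1# → #zeros (act g A) ≡ #zeros A
  #zeros-act g A det≡1 = ℕ.≤-antisym (pushed g A det≡1)
    (subst (λ B → #zeros B ℕ.≤ #zeros (act g A)) (act-invʳ A det≡1)
      (pushed (inv g) (act g A) (trans (det-inv g) det≡1)))
    where
    pushed : ∀ g A → det g ≡ 1# → #zeros (act g A) ℕ.≤ #zeros A
    pushed g A det≡1 = #zeros-mono (act g A) A move move-injective λ x vanishes →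
      *-cancelˡ (*-≢0 (factor≢0 x) (σ-≢0 (factor≢0 x))) (begin
        factor x * σ (factor x) * form A (vec (move x)) ≡⟨ form-• A (factor x) (vec (move x)) ⟨
        form A (factor x • vec (move x)) ≡⟨ cong (form A) (apply-vec x) ⟨
        form A (apply g (vec x)) ≡⟨ form-act A g (vec x) ⟨
        form (act g A) (vec x) ≡⟨ vanishes ⟩
        0# ≡⟨ zeroʳ _ ⟨
        factor x * σ (factor x) * 0# ∎)
      where open Möbius {g} det≡1

  #zeros-scale : ∀ k A → k ≢ 0# → #zeros (scale k A) ≡ #zeros A
  #zeros-scale k A k≢0 = ℕ.≤-antisym
    (#zeros-mono (scale k A) A id id λ x vanishes →
      *-cancelˡ k≢0 (trans (sym (bil-scale k A _ _)) (trans vanishes (sym (zeroʳ k)))))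
    (#zeros-mono A (scale k A) id id λ x vanishes →
      trans (bil-scale k A _ _) (trans (cong (k *_) vanishes) (zeroʳ k)))

  apply-1,0 : ∀ g → apply g (1# , 0#) ≡ column₁ g
  apply-1,0 (quad a b c d) = cong₂ _,_ (entry a b) (entry c d)
    where
    entry : ∀ a b → a * 1# + b * 0# ≡ a
    entry = solve 2 (λ a b → a :* ⟨1⟩ :+ b :* ⟨0⟩ := a) refl

  apply-0,1 : ∀ g → apply g (0# , 1#) ≡ column₂ g
  apply-0,1 (quad a b c d) = cong₂ _,_ (entry a b) (entry c d)
    where
    entry : ∀ a b → a * 0# + b * 1# ≡ b
    entry = solve 2 (λ a b → a :* ⟨0⟩ :+ b :* ⟨1⟩ := b) refl

  -- Two-transitivity of SL(2,q) on the line. With the image of ∞ taken to be `vec u` itself,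
  -- determinant 1 forces a scalar on the other vector, namely the inverse of the bracket of `vec u`
  -- and `vec w`.
  Frame : ℙ¹ → ℙ¹ → Set c
  Frame u w = ∃[ g ] det g ≡ 1# × apply g (vec ∞) ≡ vec u × ∃[ k ] k ≢ 0# × apply g (vec (just 0#)) ≡ k • vec w

  abstract
    frame : ∀ {u w} → u ≢ w → Frame u w
    frame {u} {w} u≢w = columns (k • vec w) (vec u) , det≡1 , apply-0,1 (columns (k • vec w) (vec u)) ,
      k , k≢0 , apply-1,0 (columns (k • vec w) (vec u))
      where
      δ : Carrier
      δ = bracket (vec u) (vec w)
      δ≢0 : δ ≢ 0#
      δ≢0 = u≢w ∘ bracket≡0⇒≡ u w
      k : Carrier
      k = δ ⁻¹
      k≢0 : k ≢ 0#
      k≢0 = ⁻¹≢0 δ≢0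
      det≡1 : det (columns (k • vec w) (vec u)) ≡ 1#
      det≡1 = trans (expand (vec u) (vec w)) (*-inverseʳ δ≢0)
        where
        expand : ∀ u w → det (columns (k • w) u) ≡ bracket u w * k
        expand (x , y) (x′ , y′) = solve 5 (λ k x y x′ y′ →
          S.det (S.columns (k S.• (x′ , y′)) (x , y)) := S.bracket (x , y) (x′ , y′) :* k) refl k x y x′ y′

  form-∞ : ∀ A → form A (vec ∞) ≡ Quad.e₄ A
  form-∞ (quad a b c d) = begin
    bil (quad a b c d) (0# , 1#) (σ 0# , σ 1#) ≡⟨ cong₂ (λ x y → bil (quad a b c d) (0# , 1#) (x , y)) σ-0 σ-1 ⟩
    bil (quad a b c d) (0# , 1#) (0# , 1#)
      ≡⟨ solve 4 (λ a b c d → S.bil (quad a b c d) (⟨0⟩ , ⟨1⟩) (⟨0⟩ , ⟨1⟩) := d) refl a b c d ⟩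
    d ∎

  form-just : ∀ a b c d t → form (quad a b c d) (vec (just t)) ≡ a + b * t + c * σ t + d * (t * σ t)
  form-just a b c d t = begin
    bil (quad a b c d) (1# , t) (σ 1# , σ t)  ≡⟨ cong (λ x → bil (quad a b c d) (1# , t) (x , σ t)) σ-1 ⟩
    bil (quad a b c d) (1# , t) (1# , σ t)
      ≡⟨ solve 6 (λ a b c d t s → S.bil (quad a b c d) (⟨1⟩ , t) (⟨1⟩ , s) := a :+ b :* t :+ c :* s :+ d :* (t :* s)) refl a b c d t (σ t) ⟩
    a + b * t + c * σ t + d * (t * σ t)       ∎

  form-zero : ∀ A → form A (vec (just 0#)) ≡ Quad.e₁ A
  form-zero (quad a b c d) = trans (form-just a b c d 0#) (trans
    (cong (λ s → a + b * 0# + c * s + d * (0# * s)) σ-0)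
    (solve 4 (λ a b c d → a :+ b :* ⟨0⟩ :+ c :* ⟨0⟩ :+ d :* (⟨0⟩ :* ⟨0⟩) := a) refl a b c d))

  form-diagonal : ∀ b c t → form (quad 0# b c 0#) (vec (just t)) ≡ b * t + c * σ t
  form-diagonal b c t = trans (form-just 0# b c 0# t)
    (solve 4 (λ b c t s → ⟨0⟩ :+ b :* t :+ c :* s :+ ⟨0⟩ :* (t :* s) := b :* t :+ c :* s) refl b c t (σ t))

  -- The outer coefficients are the values at ∞ and 0, so both are zeros. The remaining zeros are
  -- the nonzero roots of b t + c σ(t), and there is exactly one.
  #zeros-diagonal : ∀ {b c} → b ≢ 0# → c ≢ 0# → #zeros (quad 0# b c 0#) ≡ 3
  #zeros-diagonal {b} {c} b≢0 c≢0 = count (σ-linear-root b≢0 c≢0)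
    where
    A = quad 0# b c 0#

    roots : Carrier → List ℙ¹
    roots t = ∞ ∷ just 0# ∷ just t ∷ []

    unique : ∀ {t} → t ≢ 0# → Unique (roots t)
    unique t≢0 = ((λ ()) All.∷ (λ ()) All.∷ All.[]) ∷ ((t≢0 ∘ sym ∘ just-injective) All.∷ All.[]) ∷ All.[] ∷ []

    sound : ∀ {t} → b * t + c * σ t ≡ 0# → ∀ {x} → x ∈ roots t → Zero A x
    sound {t} root = All.lookup {P = Zero A}
      (form-∞ A All.∷ form-zero A All.∷ trans (form-diagonal b c t) root All.∷ All.[])

    complete : ∀ {t} → t ≢ 0# → b * t + c * σ t ≡ 0# → ∀ x → Zero A x → x ∈ roots t
    complete t≢0 root ∞        _        = here refl
    complete t≢0 root (just u) vanishes with u ≟ 0#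
    ... | yes u≡0 = there (here (cong just u≡0))
    ... | no  u≢0 = there (there (here (cong just (σ-linear-root-unique c≢0 u≢0 t≢0
                      (trans (sym (form-diagonal b c u)) vanishes) root))))

    count : ∃[ t ] t ≢ 0# × b * t + c * σ t ≡ 0# → #zeros A ≡ 3
    count (t , t≢0 , root) = #zeros-list A (unique t≢0) (sound root) (complete t≢0 root)

  -- Two zeros can be moved to ∞ and 0, after which the form is b t + c σ(t).
  two-zeros⇒three : ∀ A {u w} → det A ≡ 1# → u ≢ w → Zero A u → Zero A w → #zeros A ≡ 3
  two-zeros⇒three A {u} {w} det≡1 u≢w u-vanishes w-vanishes = moved (frame u≢w)
    where
    diagonal : ∀ B → det B ≡ 1# → Quad.e₁ B ≡ 0# → Quad.e₄ B ≡ 0# → #zeros B ≡ 3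
    diagonal (quad _ b c _) det≡1 refl refl = #zeros-diagonal (unit≢0 bc≡1) (unit≢0 (trans (*-comm c b) bc≡1))
      where
      bc≡1 : b * c ≡ 1#
      bc≡1 = trans (solve 2 (λ b c → b :* c := ⟨0⟩ :* ⟨0⟩ :+ b :* c) refl b c) det≡1

    moved : Frame u w → #zeros A ≡ 3
    moved (g , det-g≡1 , g∞ , k , k≢0 , g0) = trans (sym (#zeros-act g A det-g≡1))
      (diagonal (act g A) (det-act g A det-g≡1 det≡1) (trans (sym (form-zero (act g A))) at-0)
                (trans (sym (form-∞ (act g A))) at-∞))
      where
      at-0 : form (act g A) (vec (just 0#)) ≡ 0#
      at-0 = begin
        form (act g A) (vec (just 0#))    ≡⟨ form-act A g (vec (just 0#)) ⟩
        form A (apply g (vec (just 0#)))  ≡⟨ cong (form A) g0 ⟩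
        form A (k • vec w) ≡⟨ form-• A k (vec w) ⟩
        k * σ k * form A (vec w) ≡⟨ cong (k * σ k *_) w-vanishes ⟩
        k * σ k * 0# ≡⟨ zeroʳ _ ⟩
        0# ∎
      at-∞ : form (act g A) (vec ∞) ≡ 0#
      at-∞ = begin
        form (act g A) (vec ∞) ≡⟨ form-act A g (vec ∞) ⟩
        form A (apply g (vec ∞)) ≡⟨ cong (form A) g∞ ⟩
        form A (vec u) ≡⟨ u-vanishes ⟩
        0# ∎

  -- As soon as two distinct zeros exist, `two-zeros⇒three` fixes the number, which excludes 2 and
  -- everything above 3.
  #zeros-cases : ∀ A → det A ≡ 1# → #zeros A ≡ 0 ⊎ #zeros A ≡ 1 ⊎ #zeros A ≡ 3
  #zeros-cases A det≡1 = cases (zeros A) refl (zeros-unique A)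
    where
    cases : ∀ xs → zeros A ≡ xs → Unique xs → #zeros A ≡ 0 ⊎ #zeros A ≡ 1 ⊎ #zeros A ≡ 3
    cases []          eq _ = inj₁ (cong length eq)
    cases (_ ∷ [])    eq _ = inj₂ (inj₁ (cong length eq))
    cases (u ∷ w ∷ _) eq ((u≢w All.∷ _) ∷ _) = inj₂ (inj₂ (two-zeros⇒three A det≡1 u≢w
      (∈-zeros⁻ A (subst (u ∈_) (sym eq) (here refl)))
      (∈-zeros⁻ A (subst (w ∈_) (sym eq) (there (here refl))))))

  -- Orbits and stabilisers under SL(2,q)

  -- The matrices of determinant 1, split by whether the upper left entry is 0.
  upper : Carrier × Carrier × Carrier → Quad Carrier
  upper (a , b , c) = quad a b c (a ⁻¹ * (1# + b * c))

  lower : Carrier × Carrier → Quad Carrier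
  lower (b , d) = quad 0# b (b ⁻¹) d

  uppers lowers : List (Quad Carrier)
  uppers = map upper (cartesianProduct nonzeros (cartesianProduct elements elements))
  lowers = map lower (cartesianProduct nonzeros elements)

  abstract
    ∈-uppers : ∀ {a} b c → a ≢ 0# → upper (a , b , c) ∈ uppers
    ∈-uppers b c a≢0 = ∈-map⁺ upper
      (∈-cartesianProduct⁺ (∈-nonzeros a≢0) (∈-cartesianProduct⁺ (∈-elements b) (∈-elements c)))

    ∈-uppers⁻ : ∀ {g} → g ∈ uppers → ∃[ a ] ∃[ b ] ∃[ c ] a ≢ 0# × g ≡ upper (a , b , c)
    ∈-uppers⁻ g∈ with (a , b , c) , abc∈ , eq ← ∈-map⁻ upper g∈ =
      a , b , c , nonzeros⇒≢0 (proj₁ (∈-cartesianProduct⁻ nonzeros (cartesianProduct elements elements) abc∈)) , eq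

    ∈-lowers : ∀ {b} d → b ≢ 0# → lower (b , d) ∈ lowers
    ∈-lowers d b≢0 = ∈-map⁺ lower (∈-cartesianProduct⁺ (∈-nonzeros b≢0) (∈-elements d))

    ∈-lowers⁻ : ∀ {g} → g ∈ lowers → ∃[ b ] ∃[ d ] b ≢ 0# × g ≡ lower (b , d)
    ∈-lowers⁻ g∈ with (b , d) , bd∈ , eq ← ∈-map⁻ lower g∈ =
      b , d , nonzeros⇒≢0 (proj₁ (∈-cartesianProduct⁻ nonzeros elements bd∈)) , eq

  special : List (Quad Carrier)
  special = uppers ++ lowers

  special-unique : Unique special
  special-unique = Unique.++⁺
    (Unique.map⁺ upper-injective (Unique.cartesianProduct⁺ nonzeros-unique
                                   (Unique.cartesianProduct⁺ elements-unique elements-unique)))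
    (Unique.map⁺ lower-injective (Unique.cartesianProduct⁺ nonzeros-unique elements-unique))
    λ (x∈ , y∈) → disjoint (∈-uppers⁻ x∈) (∈-lowers⁻ y∈)
    where
    upper-injective : ∀ {x y} → upper x ≡ upper y → x ≡ y
    upper-injective eq = cong (λ g → Quad.e₁ g , Quad.e₂ g , Quad.e₃ g) eq
    lower-injective : ∀ {x y} → lower x ≡ lower y → x ≡ y
    lower-injective eq = cong (λ g → Quad.e₂ g , Quad.e₄ g) eq
    disjoint : ∀ {g} → ∃[ a ] ∃[ b ] ∃[ c ] a ≢ 0# × g ≡ upper (a , b , c) →
               ¬ (∃[ b ] ∃[ d ] b ≢ 0# × g ≡ lower (b , d))
    disjoint (_ , _ , _ , a≢0 , refl) (_ , _ , _ , eq) = a≢0 (cong Quad.e₁ eq)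

  ∈-special : ∀ g → det g ≡ 1# → g ∈ special
  ∈-special (quad a b c d) det≡1 = cases (a ≟ 0#)
    where
    cases : Dec (a ≡ 0#) → quad a b c d ∈ special
    cases (yes refl) = ∈-++⁺ʳ uppers (subst (λ e → quad 0# b e d ∈ lowers) (sym c≡b⁻¹) (∈-lowers d b≢0))
      where
      bc≡1 : b * c ≡ 1#
      bc≡1 = trans (solve 3 (λ b c d → b :* c := ⟨0⟩ :* d :+ b :* c) refl b c d) det≡1
      b≢0 : b ≢ 0#
      b≢0 = unit≢0 bc≡1
      c≡b⁻¹ : c ≡ b ⁻¹
      c≡b⁻¹ = *-cancelˡ b≢0 (trans bc≡1 (sym (*-inverseʳ b≢0)))
    cases (no a≢0) = ∈-++⁺ˡ (subst (λ e → quad a b c e ∈ uppers) (sym d≡) (∈-uppers b c a≢0))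
      where
      d≡ : d ≡ a ⁻¹ * (1# + b * c)
      d≡ = *-cancelˡ a≢0 (begin
        a * d ≡⟨ +-moveˡ det≡1 ⟩
        1# + b * c ≡⟨ *-identityˡ _ ⟨
        1# * (1# + b * c) ≡⟨ cong (_* (1# + b * c)) (*-inverseʳ a≢0) ⟨
        a * a ⁻¹ * (1# + b * c)     ≡⟨ *-assoc a (a ⁻¹) (1# + b * c) ⟩
        a * (a ⁻¹ * (1# + b * c))   ∎)

  ∈-special⁻ : ∀ {g} → g ∈ special → det g ≡ 1#
  ∈-special⁻ g∈ = [ det-upper ∘ ∈-uppers⁻ , det-lower ∘ ∈-lowers⁻ ]′ (∈-++⁻ uppers g∈)
    where
    det-upper : ∀ {g} → ∃[ a ] ∃[ b ] ∃[ c ] a ≢ 0# × g ≡ upper (a , b , c) → det g ≡ 1#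
    det-upper (a , b , c , a≢0 , refl) = begin
      a * (a ⁻¹ * (1# + b * c)) + b * c
        ≡⟨ solve 4 (λ a i b c → a :* (i :* (⟨1⟩ :+ b :* c)) :+ b :* c := (a :* i) :* (⟨1⟩ :+ b :* c) :+ b :* c) refl a (a ⁻¹) b c ⟩
      a * a ⁻¹ * (1# + b * c) + b * c
        ≡⟨ cong (λ e → e * (1# + b * c) + b * c) (*-inverseʳ a≢0) ⟩
      1# * (1# + b * c) + b * c
        ≡⟨ solve 2 (λ b c → ⟨1⟩ :* (⟨1⟩ :+ b :* c) :+ b :* c := ⟨1⟩) refl b c ⟩
      1# ∎
    det-lower : ∀ {g} → ∃[ b ] ∃[ d ] b ≢ 0# × g ≡ lower (b , d) → det g ≡ 1#
    det-lower (b , d , b≢0 , refl) = trans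
      (solve 3 (λ b i d → ⟨0⟩ :* d :+ b :* i := b :* i) refl b (b ⁻¹) d)
      (*-inverseʳ b≢0)

  length-special : length special ≡ length nonzeros ℕ.* (q ℕ.* q) ℕ.+ length nonzeros ℕ.* q
  length-special = trans (length-++ uppers) (cong₂ ℕ._+_
    (trans (length-map upper (cartesianProduct nonzeros (cartesianProduct elements elements)))
      (trans (length-cartesianProductWith _,_ nonzeros (cartesianProduct elements elements))
        (cong (length nonzeros ℕ.*_) (trans (length-cartesianProductWith _,_ elements elements)
          (cong₂ ℕ._*_ length-elements length-elements)))))
    (trans (length-map lower (cartesianProduct nonzeros elements))
      (trans (length-cartesianProductWith _,_ nonzeros elements)
        (cong (length nonzeros ℕ.*_) length-elements))))

  Orbit : Quad Carrier → Quad Carrier → Set c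
  Orbit A B = ∃[ g ] det g ≡ 1# × act g A ≡ B

  abstract
    orbit? : ∀ A → Decidable (Orbit A)
    orbit? A B = map′
      (λ ∃g → let g , g∈ , eq = find ∃g in g , ∈-special⁻ g∈ , eq)
      (λ (g , det≡1 , eq) → lose (∈-special g det≡1) eq)
      (any? (λ g → act g A ≟Q B) special)

  -- `special` serves both as the list of group elements and as the list of forms of determinant 1.
  orbit : Quad Carrier → List (Quad Carrier)
  orbit A = filter (orbit? A) special

  -- Every `g` is a product of a stabiliser element and the chosen element moving `A` to `act g A`.
  -- Any list containing the stabiliser gives a bound in this direction.
  orbit-stabiliser : ∀ A (stab : List (Quad Carrier)) → det A ≡ 1# →
                     (∀ g → det g ≡ 1# → act g A ≡ A → g ∈ stab) →
                     length special ℕ.≤ length stab ℕ.* length (orbit A)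
  orbit-stabiliser A stab det-A≡1 stabiliser = subst (length special ℕ.≤_)
    (length-cartesianProductWith (λ k B → mul k (mover B (orbit? A B))) stab (orbit A))
    (unique-⊆⇒length≤ special-unique (λ {g} g∈ → decompose g (∈-special⁻ g∈)))
    where
    mover : ∀ B → Dec (Orbit A B) → Quad Carrier
    mover B (yes (g , _)) = g
    -- A default outside the orbit; `recompose` and `quotient∈stab` refute this case.
    mover B (no _)        = one
    decompose : ∀ g → det g ≡ 1# → g ∈ cartesianProductWith (λ k B → mul k (mover B (orbit? A B))) stab (orbit A)
    decompose g det≡1 = subst (_∈ _) (recompose (orbit? A B))
      (∈-cartesianProductWith⁺ (λ k B → mul k (mover B (orbit? A B))) (quotient∈stab (orbit? A B))
        (∈-filter⁺ (orbit? A) (∈-special B (det-act g A det≡1 det-A≡1)) (g , det≡1 , refl)))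
      where
      B = act g A
      recompose : ∀ B∈ → mul (mul g (inv (mover B B∈))) (mover B B∈) ≡ g
      recompose (no B∉) = contradiction (g , det≡1 , refl) B∉
      recompose (yes (k , det-k≡1 , _)) = trans (mul-assoc g (inv k) k)
        (trans (cong (mul g) (mul-invˡ det-k≡1)) (mul-one g))
      quotient∈stab : ∀ B∈ → mul g (inv (mover B B∈)) ∈ stab
      quotient∈stab (no B∉) = contradiction (g , det≡1 , refl) B∉
      quotient∈stab (yes (k , det-k≡1 , kA≡B)) = stabiliser (mul g (inv k))
        (trans (det-mul g (inv k)) (trans (cong₂ _*_ det≡1 (trans (det-inv k) det-k≡1)) (*-identityʳ 1#)))
        (begin
          act (mul g (inv k)) A   ≡⟨ act-mul g (inv k) A ⟩
          act (inv k) (act g A)   ≡⟨ cong (act (inv k)) kA≡B ⟨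
          act (inv k) (act k A)   ≡⟨ act-invʳ A det-k≡1 ⟩
          A ∎)

  -- act g A = A rewritten as A σ(g) = g⁻ᵀ A.
  stabiliser-equations : ∀ a b c d α β γ δ → det (quad α β γ δ) ≡ 1# →
    act (quad α β γ δ) (quad a b c d) ≡ quad a b c d →
    (a * σ α + c * σ γ ≡ a * δ + b * γ × a * σ β + c * σ δ ≡ c * δ + d * γ) ×
    (b * σ α + d * σ γ ≡ a * β + b * α × b * σ β + d * σ δ ≡ c * β + d * α)
  stabiliser-equations a b c d α β γ δ det≡1 fixes =
    (compare (apply-1,0 (inv g)) (apply-1,0 (σ⁴ g)) (left₁ _) (right₁ _) ,
     compare (apply-1,0 (inv g)) (apply-0,1 (σ⁴ g)) (left₁ _) (right₂ _)) ,
    (compare (apply-0,1 (inv g)) (apply-1,0 (σ⁴ g)) (left₂ _) (right₁ _) ,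
     compare (apply-0,1 (inv g)) (apply-0,1 (σ⁴ g)) (left₂ _) (right₂ _))
    where
    A = quad a b c d
    g = quad α β γ δ
    -- Moving `g` across with its adjugate leaves equations linear in the entries of `g` and of
    -- σ(g), whereas invariance itself multiplies the two.
    compare : ∀ {u v u′ v′ x y} → apply (inv g) u ≡ u′ → apply (σ⁴ g) v ≡ v′ →
              bil A u v′ ≡ x → bil A u′ v ≡ y → x ≡ y
    compare {u} {v} {x = x} {y} refl refl lhs rhs = begin
      x ≡⟨ lhs ⟨
      bil A u (apply (σ⁴ g) v) ≡⟨ cong (λ u → bil A u (apply (σ⁴ g) v)) (apply-invʳ u det≡1) ⟨
      bil A (apply g (apply (inv g) u)) (apply (σ⁴ g) v) ≡⟨ bil-pull A g (σ⁴ g) (apply (inv g) u) v ⟨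
      bil (act g A) (apply (inv g) u) v ≡⟨ cong (λ B → bil B (apply (inv g) u) v) fixes ⟩
      bil A (apply (inv g) u) v ≡⟨ rhs ⟩
      y ∎
    left₁ : ∀ ((x , y) : Carrier × Carrier) → bil A (1# , 0#) (x , y) ≡ a * x + c * y
    left₁ (x , y) = solve 6 (λ a b c d x y → S.bil (quad a b c d) (⟨1⟩ , ⟨0⟩) (x , y) := a :* x :+ c :* y) refl a b c d x y
    left₂ : ∀ ((x , y) : Carrier × Carrier) → bil A (0# , 1#) (x , y) ≡ b * x + d * y
    left₂ (x , y) = solve 6 (λ a b c d x y → S.bil (quad a b c d) (⟨0⟩ , ⟨1⟩) (x , y) := b :* x :+ d :* y) refl a b c d x y
    right₁ : ∀ ((x , y) : Carrier × Carrier) → bil A (x , y) (1# , 0#) ≡ a * x + b * y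
    right₁ (x , y) = solve 6 (λ a b c d x y → S.bil (quad a b c d) (x , y) (⟨1⟩ , ⟨0⟩) := a :* x :+ b :* y) refl a b c d x y
    right₂ : ∀ ((x , y) : Carrier × Carrier) → bil A (x , y) (0# , 1#) ≡ c * x + d * y
    right₂ (x , y) = solve 6 (λ a b c d x y → S.bil (quad a b c d) (x , y) (⟨0⟩ , ⟨1⟩) := c :* x :+ d :* y) refl a b c d x y

  -- Three sample forms and their stabilisers

  record Base (i k : ℕ) : Set c where
    field
      base         : Quad Carrier
      det≡1        : det base ≡ 1#
      #zeros≡      : #zeros base ≡ i
      -- A list that contains the stabiliser: an upper bound is what the orbit count uses.
      stabiliser   : List (Quad Carrier)
      small        : length stabiliser ℕ.≤ k
      ∈-stabiliser : ∀ g → det g ≡ 1# → act g base ≡ base → g ∈ stabiliser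

  -- The form t + σ(t) vanishes exactly on the projective line over 𝔽₂. Its stabiliser equations say
  -- that each entry of `g` is fixed by σ, so the stabiliser is SL(2,2), of order 6.
  base₃ : Base 3 6
  base₃ = record
    { base         = quad 0# 1# 1# 0#
    ; det≡1        = solve 0 (⟨0⟩ :* ⟨0⟩ :+ ⟨1⟩ :* ⟨1⟩ := ⟨1⟩) refl
    ; #zeros≡      = #zeros-diagonal 1≢0 1≢0
    ; stabiliser   = quad 1# 0# 0# 1# ∷ quad 0# 1# 1# 0# ∷ quad 1# 1# 0# 1# ∷
                     quad 1# 0# 1# 1# ∷ quad 0# 1# 1# 1# ∷ quad 1# 1# 1# 0# ∷ []
    ; small        = ℕ.≤-refl
    ; ∈-stabiliser = fixing
    }
    where
    bit : ∀ {x} → σ x ≡ x → ∃[ b ] x ≡ fromBool b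
    bit σx≡x = [ (λ x≡0 → false , x≡0) , (λ x≡1 → true , x≡1) ]′ (σ-fixed σx≡x)

    simplify : ∀ {x y z w} → 0# * x + 1# * y ≡ 0# * z + 1# * w → y ≡ w
    simplify {x} {y} {z} {w} eq = trans (drop x y) (trans eq (sym (drop z w)))
      where
      drop : ∀ x y → y ≡ 0# * x + 1# * y
      drop = solve 2 (λ x y → y := ⟨0⟩ :* x :+ ⟨1⟩ :* y) refl

    det-bits : ∀ p q r s → det (quad (fromBool p) (fromBool q) (fromBool r) (fromBool s)) ≡ fromBool ((p ∧ s) xor (q ∧ r))
    det-bits p q r s = sym (trans (fromBool-xor (p ∧ s) (q ∧ r)) (cong₂ _+_ (fromBool-∧ p s) (fromBool-∧ q r)))

    fromBool-true : ∀ {b} → fromBool b ≡ 1# → b ≡ true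
    fromBool-true {false} eq = contradiction eq 0#≢1#
    fromBool-true {true}  _  = refl

    members : ∀ p q r s → (p ∧ s) xor (q ∧ r) ≡ true →
              quad (fromBool p) (fromBool q) (fromBool r) (fromBool s) ∈ _
    -- The other ten patterns have determinant 0 and contradict the premise.
    members true  false false true  _ = here refl
    members false true  true  false _ = there (here refl)
    members true  true  false true  _ = there (there (here refl))
    members true  false true  true  _ = there (there (there (here refl)))
    members false true  true  true  _ = there (there (there (there (here refl))))
    members true  true  true  false _ = there (there (there (there (there (here refl)))))

    fixing : ∀ g → det g ≡ 1# → act g (quad 0# 1# 1# 0#) ≡ quad 0# 1# 1# 0# → g ∈ _
    fixing (quad α β γ δ) det≡1 fixes =
      let (eq₁ , eq₂) , (eq₃ , eq₄) = stabiliser-equations 0# 1# 1# 0# α β γ δ det≡1 fixes in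
      collect (bit (simplify (trans (+-comm _ _) eq₃))) (bit (simplify (trans (+-comm _ _) (trans eq₄ (+-comm _ _)))))
              (bit (simplify eq₁)) (bit (simplify (trans eq₂ (+-comm _ _))))
      where
      collect : ∃[ p ] α ≡ fromBool p → ∃[ q ] β ≡ fromBool q → ∃[ r ] γ ≡ fromBool r → ∃[ s ] δ ≡ fromBool s →
                quad α β γ δ ∈ _
      collect (p , refl) (q , refl) (r , refl) (s , refl) =
        members p q r s (fromBool-true (trans (sym (det-bits p q r s)) det≡1))

  -- The map t + σ(t) identifies 0 and 1, so it misses some m, and the form m + t + σ(t) vanishes
  -- only at ∞. What fixes the form is the identity and the translation t ↦ t + 1.
  base₁ : Base 1 2
  base₁ = construct (let m , m∉ = misses-value (λ t → t + σ t) in m , everywhere m∉)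
    where
    everywhere : ∀ {m} → (∀ {t} → t ≢ 0# → t + σ t ≢ m) → ∀ t → t + σ t ≢ m
    everywhere m∉ t eq with t ≟ 0#
    ... | no t≢0   = m∉ t≢0 eq
    -- `misses-value` speaks of nonzero arguments only, but the value 0 at t = 0 is taken at t = 1
    -- as well.
    ... | yes refl = m∉ 1≢0 (trans (trans (cong (1# +_) σ-1) (trans 1+1≡0 (sym (trans (+-identityˡ _) σ-0)))) eq)

    construct : ∃[ m ] (∀ t → t + σ t ≢ m) → Base 1 2
    construct (m , m∉) = record
      { base         = quad m 1# 1# 0#
      ; det≡1        = solve 1 (λ m → m :* ⟨0⟩ :+ ⟨1⟩ :* ⟨1⟩ := ⟨1⟩) refl m
      ; #zeros≡      = #zeros-list (quad m 1# 1# 0#) {∞ ∷ []} (All.[] ∷ [])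
                         (λ { (here refl) → form-∞ (quad m 1# 1# 0#) }) only-∞
      ; stabiliser   = quad 1# 0# 0# 1# ∷ quad 1# 0# 1# 1# ∷ []
      ; small        = ℕ.≤-refl
      ; ∈-stabiliser = fixing
      }
      where
      only-∞ : ∀ x → Zero (quad m 1# 1# 0#) x → x ∈ (∞ ∷ [])
      only-∞ ∞        _        = here refl
      only-∞ (just t) vanishes = contradiction (sym (+≡0⇒≡ (begin
        m + (t + σ t) ≡⟨ solve 3 (λ m t s → m :+ (t :+ s) := m :+ ⟨1⟩ :* t :+ ⟨1⟩ :* s :+ ⟨0⟩ :* (t :* s)) refl m t (σ t) ⟩
        m + 1# * t + 1# * σ t + 0# * (t * σ t)    ≡⟨ form-just m 1# 1# 0# t ⟨
        form (quad m 1# 1# 0#) (vec (just t))     ≡⟨ vanishes ⟩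
        0# ∎))) (m∉ t)

      fixing : ∀ g → det g ≡ 1# → act g (quad m 1# 1# 0#) ≡ quad m 1# 1# 0# → g ∈ _
      fixing (quad α β γ δ) det≡1 fixes =
        let (eq₁ , _) , (eq₃ , eq₄) = stabiliser-equations m 1# 1# 0# α β γ δ det≡1 fixes in
        upper-right eq₁
          (trans (solve 2 (λ s t → s := ⟨1⟩ :* s :+ ⟨0⟩ :* t) refl (σ α) (σ γ)) (trans eq₃ (cong (m * β +_) (*-identityˡ α))))
          (σ-fixed (begin
            σ β ≡⟨ solve 2 (λ s t → s := ⟨1⟩ :* s :+ ⟨0⟩ :* t) refl (σ β) (σ δ) ⟩
            1# * σ β + 0# * σ δ ≡⟨ eq₄ ⟩
            1# * β + 0# * α     ≡⟨ solve 2 (λ s t → ⟨1⟩ :* s :+ ⟨0⟩ :* t := s) refl β α ⟩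
            β ∎))
        where
        upper-right : m * σ α + 1# * σ γ ≡ m * δ + 1# * γ → σ α ≡ m * β + α → β ≡ 0# ⊎ β ≡ 1# → quad α β γ δ ∈ _
        -- If β = 1 then σ(α) = m + α, and m would be a value of t + σ(t).
        upper-right eq₁ eq₃ (inj₂ refl) = contradiction (begin
          α + σ α ≡⟨ cong (α +_) eq₃ ⟩
          α + (m * 1# + α)      ≡⟨ solve 2 (λ α m → α :+ (m :* ⟨1⟩ :+ α) := m) refl α m ⟩
          m ∎) (m∉ α)
        upper-right eq₁ eq₃ (inj₁ refl) = diagonal eq₁ (σ-fixed (trans eq₃
            (solve 2 (λ m α → m :* ⟨0⟩ :+ α := α) refl m α)))
          where
          αδ≡1 : α * δ ≡ 1#
          αδ≡1 = trans (solve 3 (λ α γ δ → α :* δ := α :* δ :+ ⟨0⟩ :* γ) refl α γ δ) det≡1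
          diagonal : m * σ α + 1# * σ γ ≡ m * δ + 1# * γ → α ≡ 0# ⊎ α ≡ 1# → quad α 0# γ δ ∈ _
          diagonal eq₁ (inj₁ α≡0)  = contradiction α≡0 (unit≢0 αδ≡1)
          diagonal eq₁ (inj₂ refl) = subst (λ δ → quad 1# 0# γ δ ∈ _) (sym δ≡1) (lower-left (σ-fixed (begin
            σ γ ≡⟨ solve 2 (λ m s → s := m :+ (m :* ⟨1⟩ :+ ⟨1⟩ :* s)) refl m (σ γ) ⟩
            m + (m * 1# + 1# * σ γ) ≡⟨ cong (λ e → m + (m * e + 1# * σ γ)) σ-1 ⟨
            m + (m * σ 1# + 1# * σ γ) ≡⟨ cong (m +_) eq₁ ⟩
            m + (m * δ + 1# * γ) ≡⟨ cong (λ e → m + (m * e + 1# * γ)) δ≡1 ⟩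
            m + (m * 1# + 1# * γ) ≡⟨ solve 2 (λ m s → m :+ (m :* ⟨1⟩ :+ ⟨1⟩ :* s) := s) refl m γ ⟩
            γ ∎)))
            where
            δ≡1 : δ ≡ 1#
            δ≡1 = trans (sym (*-identityˡ δ)) αδ≡1
            lower-left : γ ≡ 0# ⊎ γ ≡ 1# → quad 1# 0# γ 1# ∈ _
            lower-left (inj₁ refl) = here refl
            lower-left (inj₂ refl) = there (here refl)

  -- Cayley-Hamilton for 2×2 matrices: the adjugate of h is tr(h) · 1 + h in characteristic 2.
  trace-mul-inv : ∀ g h → trace (mul g (inv h)) ≡ trace g * trace h + trace (mul g h)
  trace-mul-inv (quad a b c d) (quad α β γ δ) = solve 8 (λ a b c d α β γ δ →
    S.trace (S.mul (quad a b c d) (S.inv (quad α β γ δ))) :=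
    S.trace (quad a b c d) :* S.trace (quad α β γ δ) :+ S.trace (S.mul (quad a b c d) (quad α β γ δ))) refl a b c d α β γ δ

  inv-uniqueˡ : ∀ {g h} → det g ≡ 1# → mul g h ≡ one → h ≡ inv g
  inv-uniqueˡ {g} {h} det≡1 gh≡1 = begin
    h ≡⟨ one-mul h ⟨
    mul one h ≡⟨ cong (λ e → mul e h) (mul-invˡ det≡1) ⟨
    mul (mul (inv g) g) h   ≡⟨ mul-assoc (inv g) g h ⟩
    mul (inv g) (mul g h)   ≡⟨ cong (mul (inv g)) gh≡1 ⟩
    mul (inv g) one ≡⟨ mul-one (inv g) ⟩
    inv g ∎
    where
    one-mul : ∀ g → mul one g ≡ g
    one-mul (quad a b c d) = cong₂ columns (apply-one (a , c)) (apply-one (b , d))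

  -- The form 1 + m σ(t) + t σ(t) takes the value 1 at 0 and ∞, and elsewhere equals σ(t) times m +
  -- t + σ(t)⁻¹. Choosing m among the values that t + σ(t)⁻¹ misses leaves no zero. The bound 3
  -- comes from traces: a nontrivial stabiliser element has trace 1.
  base₀ : Base 0 3
  base₀ = construct (misses-value (λ t → t + σ t ⁻¹))
    where
    construct : ∃[ m ] (∀ {t} → t ≢ 0# → t + σ t ⁻¹ ≢ m) → Base 0 3
    construct (m , m∉) = cyclic nontrivial?
      where
      A = quad 1# 0# m 1#

      value : ∀ t → form A (vec (just t)) ≡ 1# + m * σ t + t * σ t
      value t = trans (form-just 1# 0# m 1# t)
        (solve 3 (λ m t s → ⟨1⟩ :+ ⟨0⟩ :* t :+ m :* s :+ ⟨1⟩ :* (t :* s) := ⟨1⟩ :+ m :* s :+ t :* s) refl m t (σ t))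

      no-zero : ∀ x → ¬ Zero A x
      no-zero ∞        vanishes = 1≢0 (trans (sym (form-∞ A)) vanishes)
      no-zero (just t) vanishes = m∉ t≢0 (sym (*-cancelˡ (σ-≢0 t≢0) (begin
        σ t * m ≡⟨ solve 3 (λ m t s → s :* m := (⟨1⟩ :+ m :* s :+ t :* s) :+ (s :* t :+ ⟨1⟩)) refl m t (σ t) ⟩
        (1# + m * σ t + t * σ t) + (σ t * t + 1#) ≡⟨ cong (_+ (σ t * t + 1#)) (trans (sym (value t)) vanishes) ⟩
        0# + (σ t * t + 1#) ≡⟨ +-identityˡ _ ⟩
        σ t * t + 1# ≡⟨ cong (σ t * t +_) (*-inverseʳ (σ-≢0 t≢0)) ⟨
        σ t * t + σ t * σ t ⁻¹ ≡⟨ solve 3 (λ s t i → s :* t :+ s :* i := s :* (t :+ i)) refl (σ t) t (σ t ⁻¹) ⟩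
        σ t * (t + σ t ⁻¹) ∎)))
        where
        t≢0 : t ≢ 0#
        t≢0 refl = 1≢0 (begin
          1# ≡⟨ solve 1 (λ m → ⟨1⟩ := ⟨1⟩ :+ m :* ⟨0⟩ :+ ⟨0⟩ :* ⟨0⟩) refl m ⟩
          1# + m * 0# + 0# * 0# ≡⟨ cong (λ s → 1# + m * s + 0# * s) σ-0 ⟨
          1# + m * σ 0# + 0# * σ 0#      ≡⟨ value 0# ⟨
          form A (vec (just 0#)) ≡⟨ vanishes ⟩
          0# ∎)

      nonvanishing : ∀ {v} → v ≢ 0⃗ → form A v ≢ 0#
      nonvanishing {v} v≢0 vanishes = let x , k , k≢0 , v≡kx = normalise v v≢0 in
        no-zero x (*-cancelˡ (*-≢0 k≢0 (σ-≢0 k≢0)) (trans (sym (form-• A k (vec x)))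
          (trans (cong (form A) (sym v≡kx)) (trans vanishes (sym (zeroʳ _))))))

      anisotropic : ∀ {v} → form A v ≡ 0# → v ≡ 0⃗
      anisotropic {x , y} vanishes with x ≟ 0# | y ≟ 0#
      ... | yes x≡0 | yes y≡0 = cong₂ _,_ x≡0 y≡0
      ... | yes _   | no y≢0  = contradiction vanishes (nonvanishing λ eq → y≢0 (cong proj₂ eq))
      ... | no x≢0  | _       = contradiction vanishes (nonvanishing λ eq → x≢0 (cong proj₁ eq))

      det-A≡1 : det A ≡ 1#
      det-A≡1 = solve 1 (λ m → ⟨1⟩ :* ⟨1⟩ :+ ⟨0⟩ :* m := ⟨1⟩) refl m

      Fixes : Quad Carrier → Set c
      Fixes g = det g ≡ 1# × act g A ≡ A

      fixes-mul : ∀ {g h} → Fixes g → Fixes h → Fixes (mul g h)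
      fixes-mul {g} {h} (det-g≡1 , gA≡A) (det-h≡1 , hA≡A) =
        trans (det-mul g h) (trans (cong₂ _*_ det-g≡1 det-h≡1) (*-identityʳ 1#)) ,
        trans (act-mul g h A) (trans (cong (act h) gA≡A) hA≡A)

      fixes-inv : ∀ {g} → Fixes g → Fixes (inv g)
      fixes-inv {g} (det≡1 , gA≡A) = trans (det-inv g) det≡1 ,
        trans (cong (act (inv g)) (sym gA≡A)) (act-invʳ A det≡1)

      equations : ∀ {α β γ δ} → Fixes (quad α β γ δ) → (σ α + m * σ γ ≡ δ) × (σ γ ≡ β) × (σ δ ≡ m * β + α)
      equations {α} {β} {γ} {δ} (det≡1 , fixes) =
        let (eq₁ , _) , (eq₃ , eq₄) = stabiliser-equations 1# 0# m 1# α β γ δ det≡1 fixes in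
        trans (sym (cong (_+ m * σ γ) (*-identityˡ (σ α)))) (trans eq₁ (10-left δ γ)) ,
        trans (sym (01-left (σ α) (σ γ))) (trans eq₃ (10-left β α)) ,
        trans (sym (01-left (σ β) (σ δ))) (trans eq₄ (cong (m * β +_) (*-identityˡ α)))
        where
        10-left : ∀ x y → 1# * x + 0# * y ≡ x
        10-left = solve 2 (λ x y → ⟨1⟩ :* x :+ ⟨0⟩ :* y := x) refl
        01-left : ∀ x y → 0# * x + 1# * y ≡ y
        01-left = solve 2 (λ x y → ⟨0⟩ :* x :+ ⟨1⟩ :* y := y) refl

      -- Invariance makes σ(g) similar to the inverse transpose of g, whose trace is that of g
      -- because det g = 1. So the trace is fixed by σ.
      trace≡0∨1 : ∀ {g} → Fixes g → trace g ≡ 0# ⊎ trace g ≡ 1#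
      trace≡0∨1 {quad α β γ δ} fixes = let eq₁ , eq₃ , eq₄ = equations fixes in σ-fixed (begin
        σ (α + δ) ≡⟨ σ-+ α δ ⟩
        σ α + σ δ ≡⟨ cong₂ _+_ (+-moveˡ eq₁) eq₄ ⟩
        δ + m * σ γ + (m * β + α)        ≡⟨ cong (λ s → δ + m * s + (m * β + α)) eq₃ ⟩
        δ + m * β + (m * β + α) ≡⟨ solve 4 (λ m α β δ → δ :+ m :* β :+ (m :* β :+ α) := α :+ δ) refl m α β δ ⟩
        α + δ ∎)

      -- With trace 0 and determinant 1, g fixes the vector (1 + α , γ).
      -- The form vanishes there, so that vector is 0.
      trace≡0⇒one : ∀ {g} → Fixes g → trace g ≡ 0# → g ≡ one
      trace≡0⇒one {quad α β γ δ} fixes@(det≡1 , _) trace≡0 =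
        quad≡ α≡1 (trans (sym eq₃) (trans (cong σ γ≡0) σ-0)) γ≡0 (trans (sym α≡δ) α≡1)
        where
        α≡δ : α ≡ δ
        α≡δ = +≡0⇒≡ trace≡0
        eq₁ = proj₁ (equations fixes)
        eq₃ = proj₁ (proj₂ (equations fixes))
        fixed≡0 : (1# + α , γ) ≡ 0⃗
        fixed≡0 = anisotropic (begin
          bil A (1# + α , γ) (σ (1# + α) , σ γ)
            ≡⟨ cong₂ (λ x y → bil A (1# + α , γ) (x , y))
                 (trans (σ-+ 1# α) (cong₂ _+_ σ-1 (trans (+-moveˡ eq₁) (cong₂ (λ x y → x + m * y) (sym α≡δ) eq₃)))) eq₃ ⟩
          bil A (1# + α , γ) (1# + (α + m * β) , β)
            ≡⟨ solve 4 (λ m α β γ → S.bil (quad ⟨1⟩ ⟨0⟩ m ⟨1⟩) (⟨1⟩ :+ α , γ) (⟨1⟩ :+ (α :+ m :* β) , β) :=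
                 ⟨1⟩ :+ (α :* α :+ β :* γ)) refl m α β γ ⟩
          1# + (α * α + β * γ)
            ≡⟨ cong (1# +_) (trans (cong (λ x → α * x + β * γ) α≡δ) det≡1) ⟩
          1# + 1#
            ≡⟨ 1+1≡0 ⟩
          0# ∎)
        α≡1 : α ≡ 1#
        α≡1 = sym (+≡0⇒≡ (cong proj₁ fixed≡0))
        γ≡0 : γ ≡ 0#
        γ≡0 = cong proj₂ fixed≡0

      trace≡1 : ∀ {g} → Fixes g → g ≢ one → trace g ≡ 1#
      trace≡1 fixes g≢1 = [ (λ trace≡0 → contradiction (trace≡0⇒one fixes trace≡0) g≢1) , id ]′ (trace≡0∨1 fixes)

      -- The traces of g k and g k⁻¹ add up to tr g · tr k = 1, so one of them is 0.
      two-nontrivial : ∀ {g k} → Fixes g → Fixes k → g ≢ one → k ≢ one → k ≡ g ⊎ k ≡ inv g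
      two-nontrivial {g} {k} g-fixes k-fixes g≢1 k≢1 = [
        (λ trace≡0 → inj₂ (inv-uniqueˡ (proj₁ g-fixes) (trace≡0⇒one (fixes-mul g-fixes k-fixes) trace≡0))) ,
        (λ tr≡1 → inj₁ (cong inv (inv-uniqueˡ (proj₁ g-fixes) (trace≡0⇒one (fixes-mul g-fixes (fixes-inv k-fixes)) (begin
          trace (mul g (inv k)) ≡⟨ trace-mul-inv g k ⟩
          trace g * trace k + trace (mul g k)    ≡⟨ cong₂ _+_ (cong₂ _*_ (trace≡1 g-fixes g≢1) (trace≡1 k-fixes k≢1)) tr≡1 ⟩
          1# * 1# + 1# ≡⟨ trans (cong (_+ 1#) (*-identityʳ 1#)) 1+1≡0 ⟩
          0# ∎))))) ]′
        (trace≡0∨1 (fixes-mul g-fixes k-fixes))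

      with-stabiliser : (stab : List (Quad Carrier)) → length stab ℕ.≤ 3 →
                        (∀ k → Fixes k → k ≢ one → k ∈ stab) → one ∈ stab → Base 0 3
      with-stabiliser stab small nontrivial trivial = record
        { base         = A
        ; det≡1        = det-A≡1
        ; #zeros≡      = #zeros-list A [] (λ ()) (λ x vanishes → contradiction vanishes (no-zero x))
        ; stabiliser   = stab
        ; small        = small
        ; ∈-stabiliser = λ k det≡1 fixes → case k ≟Q one of λ
            { (yes refl) → trivial ; (no k≢1) → nontrivial k (det≡1 , fixes) k≢1 }
        }

      nontrivial? : Dec (∃[ g ] Fixes g × g ≢ one)
      nontrivial? = map′ found listed (any? (λ g → act g A ≟Q A ×-dec ¬? (g ≟Q one)) special)
        where
        found : Any (λ g → act g A ≡ A × g ≢ one) special → ∃[ g ] Fixes g × g ≢ one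
        found ∃g = let g , g∈ , fixes , g≢1 = find ∃g in g , (∈-special⁻ g∈ , fixes) , g≢1
        listed : ∃[ g ] Fixes g × g ≢ one → Any (λ g → act g A ≡ A × g ≢ one) special
        listed (g , (det≡1 , fixes) , g≢1) = lose (∈-special g det≡1) (fixes , g≢1)

      -- Either outcome meets the bound of 3, which is what the counting asks for.
      cyclic : Dec (∃[ g ] Fixes g × g ≢ one) → Base 0 3
      cyclic (no ∄g) = with-stabiliser (one ∷ []) (s≤s z≤n)
        (λ k fixes k≢1 → contradiction (k , fixes , k≢1) ∄g) (here refl)
      cyclic (yes (g , g-fixes , g≢1)) = with-stabiliser (one ∷ g ∷ inv g ∷ []) ℕ.≤-refl
        (λ k k-fixes k≢1 → [ there ∘ here , there ∘ there ∘ here ]′ (two-nontrivial g-fixes k-fixes g≢1 k≢1)) (here refl)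

  -- Comparing the orbits with the numbers of zeros

  fibreOf : ℕ → List (Quad Carrier)
  fibreOf i = fibre #zeros i special

  orbit⊆fibre : ∀ {i k} (b : Base i k) → orbit (Base.base b) ⊆ fibreOf i
  orbit⊆fibre {i} b {B} B∈ =
    let B∈special , (g , det-g≡1 , eq) = ∈-filter⁻ (orbit? (Base.base b)) {xs = special} B∈ in
    ∈-filter⁺ (λ A → #zeros A ℕ.≟ i) B∈special
      (trans (cong #zeros (sym eq)) (trans (#zeros-act g (Base.base b) det-g≡1) (Base.#zeros≡ b)))

  orbit-unique : ∀ A → Unique (orbit A)
  orbit-unique A = Unique.filter⁺ (orbit? A) special-unique

  length-orbit≤ : ∀ {i k} (b : Base i k) → length (orbit (Base.base b)) ℕ.≤ length (fibreOf i)
  length-orbit≤ b = unique-⊆⇒length≤ (orbit-unique (Base.base b)) (orbit⊆fibre b)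

  length-special≤ : ∀ {i k} (b : Base i k) → length special ℕ.≤ k ℕ.* length (orbit (Base.base b))
  length-special≤ b = ℕ.≤-trans (orbit-stabiliser base stabiliser det≡1 ∈-stabiliser)
    (ℕ.*-monoˡ-≤ (length (orbit base)) small)
    where open Base b

  orbit-sizes : 3 ℕ.* length (orbit (Base.base base₀)) ≡ length special ×
                2 ℕ.* length (orbit (Base.base base₁)) ≡ length special ×
                6 ℕ.* length (orbit (Base.base base₃)) ≡ length special
  fibre-sizes : 3 ℕ.* length (fibreOf 0) ≡ length special ×
                2 ℕ.* length (fibreOf 1) ≡ length special ×
                6 ℕ.* length (fibreOf 3) ≡ length special
  fibres-sum : length (fibreOf 0) ℕ.+ length (fibreOf 1) ℕ.+ length (fibreOf 3) ≡ length special

  fibres-sum = length-fibres #zeros (λ ()) (λ ()) (λ ()) special (λ {A} A∈ → #zeros-cases A (∈-special⁻ A∈))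

  -- The orbits through the three bases have at least |SL₂|/3, |SL₂|/2 and
  -- |SL₂|/6 elements; these add up to |SL₂|, so all the inequalities are equalities.
  orbit-sizes = tight (length (orbit (Base.base base₀))) (length (orbit (Base.base base₁))) (length (orbit (Base.base base₃)))
    (length-special≤ base₀) (length-special≤ base₁) (length-special≤ base₃)
    (ℕ.≤-trans (ℕ.+-mono-≤ (ℕ.+-mono-≤ (length-orbit≤ base₀) (length-orbit≤ base₁)) (length-orbit≤ base₃))
               (ℕ.≤-reflexive fibres-sum))

  -- The same squeeze applied to the fibres: they contain the orbits, so they satisfy the same lower
  -- bounds.
  fibre-sizes = tight (length (fibreOf 0)) (length (fibreOf 1)) (length (fibreOf 3))
    (bound base₀) (bound base₁) (bound base₃) (ℕ.≤-reflexive fibres-sum)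
    where
    bound : ∀ {i k} → Base i k → length special ℕ.≤ k ℕ.* length (fibreOf i)
    bound {k = k} b = ℕ.≤-trans (length-special≤ b) (ℕ.*-monoʳ-≤ k (length-orbit≤ b))

  -- The orbit lies in the fibre and has the same length, so it contains every form with i zeros.
  transitive : ∀ {i k} (b : Base i (suc k)) → suc k ℕ.* length (orbit (Base.base b)) ≡ length special →
               suc k ℕ.* length (fibreOf i) ≡ length special →
               ∀ {B} → det B ≡ 1# → #zeros B ≡ i → Orbit (Base.base b) B
  transitive {i} {k} b orbit-size fibre-size {B} det≡1 #zeros≡i =
    proj₂ (∈-filter⁻ (orbit? (Base.base b)) {xs = special}
      (unique-⊆⇒⊇ _≟Q_ (orbit-unique (Base.base b)) (orbit⊆fibre b)
        (ℕ.≤-reflexive (ℕ.*-cancelˡ-≡ (length (fibreOf i)) (length (orbit (Base.base b))) (suc k) (trans fibre-size (sym orbit-size))))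
        (∈-filter⁺ (λ A → #zeros A ℕ.≟ i) (∈-special B det≡1) #zeros≡i)))

  -- Singular forms

  -- A linear form in the vector times a linear form in its σ-image. The order of u and w matters,
  -- so these are counted by ordered pairs.
  plane : ℙ¹ → ℙ¹ → Quad Carrier
  plane u w = join (vec u) (σ² (vec w))

  bracket-σ² : ∀ u v → bracket (σ² u) (σ² v) ≡ σ (bracket u v)
  bracket-σ² (a , b) (x , y) = sym (trans (σ-+ (a * y) (b * x)) (cong₂ _+_ (σ-* a y) (σ-* b x)))

  form-plane : ∀ u w x → form (plane u w) (vec x) ≡ bracket (vec u) (vec x) * σ (bracket (vec w) (vec x))
  form-plane u w x = trans (bil-join (vec u) (σ² (vec w)) (vec x) (σ² (vec x)))
    (cong (bracket (vec u) (vec x) *_) (bracket-σ² (vec w) (vec x)))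

  plane-zeros : ∀ u w x → Zero (plane u w) x → x ≡ u ⊎ x ≡ w
  plane-zeros u w x vanishes = [ inj₁ ∘ sym ∘ bracket≡0⇒≡ u x , inj₂ ∘ sym ∘ bracket≡0⇒≡ w x ∘ σ-≡0 ]′
    (*-≡0 (trans (sym (form-plane u w x)) vanishes))

  plane-zeroˡ : ∀ u w → Zero (plane u w) u
  plane-zeroˡ u w = trans (form-plane u w u) (trans (cong (_* σ (bracket (vec w) (vec u))) (bracket-self (vec u))) (zeroˡ _))

  plane-zeroʳ : ∀ u w → Zero (plane u w) w
  plane-zeroʳ u w = trans (form-plane u w w)
    (trans (cong (λ b → bracket (vec u) (vec w) * σ b) (bracket-self (vec w)))
      (trans (cong (bracket (vec u) (vec w) *_) σ-0) (zeroʳ _)))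

  #zeros-osculating : ∀ u → #zeros (plane u u) ≡ 1
  #zeros-osculating u = #zeros-list (plane u u) {u ∷ []} (All.[] ∷ [])
    (λ { (here refl) → plane-zeroˡ u u })
    (λ x vanishes → here ([ id , id ]′ (plane-zeros u u x vanishes)))

  #zeros-plane : ∀ {u w} → u ≢ w → #zeros (plane u w) ≡ 2
  #zeros-plane {u} {w} u≢w = #zeros-list (plane u w) {u ∷ w ∷ []} ((u≢w All.∷ All.[]) ∷ All.[] ∷ [])
    (λ { (here refl) → plane-zeroˡ u w ; (there (here refl)) → plane-zeroʳ u w })
    (λ x vanishes → [ here , there ∘ here ]′ (plane-zeros u w x vanishes))

  -- An arbitrary second point, used to complete a frame and as a test point where a bracket is
  -- nonzero.
  other : ℙ¹ → ℙ¹
  other ∞        = just 0#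
  other (just _) = ∞

  other≢ : ∀ x → x ≢ other x
  other≢ ∞        ()
  other≢ (just _) ()

  infix 4 _∼_
  _∼_ : Quad Carrier → Quad Carrier → Set c
  A ∼ B = ∃[ k ] k ≢ 0# × A ≡ scale k B

  scale-one : ∀ A → scale 1# A ≡ A
  scale-one (quad a b c d) = quad≡ (*-identityˡ a) (*-identityˡ b) (*-identityˡ c) (*-identityˡ d)

  scale-scale : ∀ k l A → scale k (scale l A) ≡ scale (k * l) A
  scale-scale k l (quad a b c d) = sym (quad≡ (*-assoc k l a) (*-assoc k l b) (*-assoc k l c) (*-assoc k l d))

  ∼-reflexive : ∀ {A B} → A ≡ B → A ∼ B
  ∼-reflexive refl = 1# , 1≢0 , sym (scale-one _)

  ∼-sym : ∀ {A B} → A ∼ B → B ∼ A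
  ∼-sym {A} {B} (k , k≢0 , refl) = k ⁻¹ , ⁻¹≢0 k≢0 , sym (begin
    scale (k ⁻¹) (scale k B)   ≡⟨ scale-scale (k ⁻¹) k B ⟩
    scale (k ⁻¹ * k) B ≡⟨ cong (λ l → scale l B) (trans (*-comm (k ⁻¹) k) (*-inverseʳ k≢0)) ⟩
    scale 1# B ≡⟨ scale-one B ⟩
    B ∎)

  ∼-trans : ∀ {A B C} → A ∼ B → B ∼ C → A ∼ C
  ∼-trans (k , k≢0 , refl) (l , l≢0 , refl) = k * l , *-≢0 k≢0 l≢0 , scale-scale k l _

  #zeros-∼ : ∀ {A B} → A ∼ B → #zeros A ≡ #zeros B
  #zeros-∼ (k , k≢0 , refl) = #zeros-scale k _ k≢0

  pull-scale : ∀ g g′ k A → pull g g′ (scale k A) ≡ scale k (pull g g′ A)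
  pull-scale g g′ k A = quad≡ (bil-scale k A _ _) (bil-scale k A _ _) (bil-scale k A _ _) (bil-scale k A _ _)

  act-∼ : ∀ g {A B} → A ∼ B → act g A ∼ act g B
  act-∼ g (k , k≢0 , refl) = k , k≢0 , pull-scale g (σ⁴ g) k _

  join-• : ∀ k l u w → join (k • u) (l • w) ≡ scale (k * l) (join u w)
  join-• k l (x , y) (x′ , y′) = quad≡ (entry y y′) (entry x y′) (entry y x′) (entry x x′)
    where
    entry : ∀ x y → k * x * (l * y) ≡ k * l * (x * y)
    entry = solve 4 (λ k l x y → k :* x :* (l :* y) := k :* l :* (x :* y)) refl k l

  -- In each factor bracket(g u , g v) = det g · bracket(u , v).
  pull-join : ∀ g g′ u w → pull g g′ (join (apply g u) (apply g′ w)) ≡ scale (det g * det g′) (join u w)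
  pull-join g g′ u w = quad≡
    (entry (at-column₁ g u) (at-column₁ g′ w)) (entry (at-column₂ g u) (at-column₁ g′ w))
    (entry (at-column₁ g u) (at-column₂ g′ w)) (entry (at-column₂ g u) (at-column₂ g′ w))
    where
    at-column₁ : ∀ g v → bracket (apply g v) (column₁ g) ≡ det g * proj₂ v
    at-column₁ (quad a b c d) (x , y) = solve 6 (λ a b c d x y → let g = quad a b c d in
      S.bracket (S.apply g (x , y)) (S.column₁ g) := S.det g :* y) refl a b c d x y
    at-column₂ : ∀ g v → bracket (apply g v) (column₂ g) ≡ det g * proj₁ v
    at-column₂ (quad a b c d) (x , y) = solve 6 (λ a b c d x y → let g = quad a b c d in
      S.bracket (S.apply g (x , y)) (S.column₂ g) := S.det g :* x) refl a b c d x y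
    entry : ∀ {u v u′ v′ k l x y} → bracket u v ≡ k * x → bracket u′ v′ ≡ l * y →
            bil (join u u′) v v′ ≡ k * l * (x * y)
    entry {u} {v} {u′} {v′} {k} {l} {x} {y} eq eq′ = begin
      bil (join u u′) v v′ ≡⟨ bil-join u u′ v v′ ⟩
      bracket u v * bracket u′ v′  ≡⟨ cong₂ _*_ eq eq′ ⟩
      k * x * (l * y) ≡⟨ solve 4 (λ k l x y → k :* x :* (l :* y) := k :* l :* (x :* y)) refl k l x y ⟩
      k * l * (x * y) ∎

  act-plane : ∀ {g u₀ w₀ u w k l} → det g ≡ 1# → k ≢ 0# → l ≢ 0# →
              apply g (vec u₀) ≡ k • vec u → apply g (vec w₀) ≡ l • vec w → plane u₀ w₀ ∼ act g (plane u w)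
  act-plane {g} {u₀} {w₀} {u} {w} {k} {l} det≡1 k≢0 l≢0 gu₀ gw₀ = k * σ l , *-≢0 k≢0 (σ-≢0 l≢0) , (begin
    plane u₀ w₀ ≡⟨ scale-one _ ⟨
    scale 1# (plane u₀ w₀) ≡⟨ cong (λ e → scale e (plane u₀ w₀)) (trans (cong₂ _*_ det≡1 (trans (det-σ⁴ g) (trans (cong σ det≡1) σ-1))) (*-identityʳ 1#)) ⟨
    scale (det g * det (σ⁴ g)) (plane u₀ w₀) ≡⟨ pull-join g (σ⁴ g) (vec u₀) (σ² (vec w₀)) ⟨
    act g (join (apply g (vec u₀)) (apply (σ⁴ g) (σ² (vec w₀))))
      ≡⟨ cong₂ (λ x y → act g (join x y)) gu₀ (trans (sym (σ²-apply g (vec w₀))) (trans (cong σ² gw₀) (σ²-• l (vec w)))) ⟩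
    act g (join (k • vec u) (σ l • σ² (vec w))) ≡⟨ cong (act g) (join-• k (σ l) (vec u) (σ² (vec w))) ⟩
    act g (scale (k * σ l) (plane u w)) ≡⟨ pull-scale g (σ⁴ g) (k * σ l) (plane u w) ⟩
    scale (k * σ l) (act g (plane u w)) ∎)

  -- At `vec u` paired with a second vector where the twisted factor of `plane u′ w′` is nonzero,
  -- the left form vanishes; so the linear factor of the right form vanishes at u, and u = u′. The
  -- other factor is treated in the same way.
  plane-injective : ∀ {u w u′ w′} → plane u w ∼ plane u′ w′ → u ≡ u′ × w ≡ w′
  plane-injective {u} {w} {u′} {w′} (k , k≢0 , eq) =
    [ sym ∘ bracket≡0⇒≡ u′ u , (λ b≡0 → contradiction b≡0 (σ-bracket≢0 (other≢ w′) )) ]′ (*-≡0 first) ,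
    [ (λ b≡0 → contradiction (bracket≡0⇒≡ _ _ b≡0) (other≢ u′)) , sym ∘ bracket≡0⇒≡ w′ w ∘ σ-≡0 ∘ trans (sym (bracket-σ² _ _)) ]′ (*-≡0 second)
    where
    σ-bracket≢0 : ∀ {x y} → x ≢ y → bracket (σ² (vec x)) (σ² (vec y)) ≢ 0#
    σ-bracket≢0 x≢y b≡0 = x≢y (bracket≡0⇒≡ _ _ (σ-≡0 (trans (sym (bracket-σ² _ _)) b≡0)))
    transfer : ∀ v v′ → bracket (vec u) v * bracket (σ² (vec w)) v′ ≡ 0# → bracket (vec u′) v * bracket (σ² (vec w′)) v′ ≡ 0#
    transfer v v′ vanishes = *-cancelˡ k≢0 (begin
      k * (bracket (vec u′) v * bracket (σ² (vec w′)) v′)  ≡⟨ cong (k *_) (bil-join (vec u′) (σ² (vec w′)) v v′) ⟨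
      k * bil (plane u′ w′) v v′ ≡⟨ bil-scale k (plane u′ w′) v v′ ⟨
      bil (scale k (plane u′ w′)) v v′ ≡⟨ cong (λ A → bil A v v′) eq ⟨
      bil (plane u w) v v′ ≡⟨ bil-join (vec u) (σ² (vec w)) v v′ ⟩
      bracket (vec u) v * bracket (σ² (vec w)) v′ ≡⟨ vanishes ⟩
      0# ≡⟨ zeroʳ k ⟨
      k * 0# ∎)
    first : bracket (vec u′) (vec u) * bracket (σ² (vec w′)) (σ² (vec (other w′))) ≡ 0#
    first = transfer (vec u) (σ² (vec (other w′))) (trans (cong (_* bracket (σ² (vec w)) (σ² (vec (other w′)))) (bracket-self (vec u))) (zeroˡ _))
    second : bracket (vec u′) (vec (other u′)) * bracket (σ² (vec w′)) (σ² (vec w)) ≡ 0#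
    second = transfer (vec (other u′)) (σ² (vec w)) (trans (cong (bracket (vec u) (vec (other u′)) *_) (bracket-self (σ² (vec w)))) (zeroʳ _))

  0Q : Quad Carrier
  0Q = quad 0# 0# 0# 0#

  -- Scaling by k multiplies the determinant by k², and squaring is a bijection of the field.
  -- Injectivity of squaring also makes the scaled form unique.
  nondegenerate : ∀ A → det A ≢ 0# → ∃[ B ] det B ≡ 1# × A ∼ B
  nondegenerate A det≢0 = let k , k²≡det = √ (det A) in go k k²≡det
    where
    go : ∀ k → k * k ≡ det A → ∃[ B ] det B ≡ 1# × A ∼ B
    go k k²≡det = scale (k ⁻¹) A , det≡1 , ∼-sym (k ⁻¹ , ⁻¹≢0 k≢0 , refl)
      where
      k≢0 : k ≢ 0#
      k≢0 k≡0 = det≢0 (trans (sym k²≡det) (trans (cong (_* k) k≡0) (zeroˡ k)))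
      det≡1 : det (scale (k ⁻¹) A) ≡ 1#
      det≡1 = begin
        det (scale (k ⁻¹) A)     ≡⟨ det-scale (k ⁻¹) A ⟩
        k ⁻¹ * k ⁻¹ * det A      ≡⟨ cong (k ⁻¹ * k ⁻¹ *_) k²≡det ⟨
        k ⁻¹ * k ⁻¹ * (k * k)    ≡⟨ solve 2 (λ k i → i :* i :* (k :* k) := (k :* i) :* (k :* i)) refl k (k ⁻¹) ⟩
        k * k ⁻¹ * (k * k ⁻¹)    ≡⟨ cong₂ _*_ (*-inverseʳ k≢0) (*-inverseʳ k≢0) ⟩
        1# * 1# ≡⟨ *-identityʳ 1# ⟩
        1# ∎

  nondegenerate-unique : ∀ {A B} → det A ≡ 1# → det B ≡ 1# → A ∼ B → A ≡ B
  nondegenerate-unique {A} {B} det-A≡1 det-B≡1 (k , k≢0 , refl) = trans (cong (λ l → scale l B) k≡1) (scale-one B)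
    where
    k≡1 : k ≡ 1#
    k≡1 = square-injective (begin
      k * k ≡⟨ *-identityʳ _ ⟨
      k * k * 1#        ≡⟨ cong (k * k *_) det-B≡1 ⟨
      k * k * det B     ≡⟨ det-scale k B ⟨
      det (scale k B)   ≡⟨ det-A≡1 ⟩
      1# ≡⟨ *-identityʳ 1# ⟨
      1# * 1# ∎)

  -- A matrix of rank one is a product of two linear forms, and surjectivity of σ writes the second
  -- one as a twisted one. The first nonzero coefficient among d, b, c decides which of u and w is
  -- ∞: neither, w, or u; if all three vanish, both are.
  degenerate : ∀ A → A ≢ 0Q → det A ≡ 0# → ∃[ u ] ∃[ w ] A ∼ plane u w
  degenerate (quad a b c d) A≢0 det≡0 = cases (d ≟ 0#) (b ≟ 0#) (c ≟ 0#)
    where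
    preimage : ∀ x → ∃[ t ] σ t ≡ x
    preimage = σ-surjective

    divide : ∀ {k} → k ≢ 0# → ∀ x → k * (k ⁻¹ * x) ≡ x
    divide {k} k≢0 x = trans (sym (*-assoc k (k ⁻¹) x)) (trans (cong (_* x) (*-inverseʳ k≢0)) (*-identityˡ x))

    cases : Dec (d ≡ 0#) → Dec (b ≡ 0#) → Dec (c ≡ 0#) → ∃[ u ] ∃[ w ] quad a b c d ∼ plane u w
    cases (no d≢0) _ _ = let t , σt≡ = preimage (d ⁻¹ * b) in
      just (d ⁻¹ * c) , just t , d , d≢0 , quad≡
        (sym (trans (cong (λ s → d * (d ⁻¹ * c * s)) σt≡) (begin
          d * (d ⁻¹ * c * (d ⁻¹ * b))     ≡⟨ solve 4 (λ d i b c → d :* (i :* c :* (i :* b)) := (d :* i) :* (i :* (b :* c))) refl d (d ⁻¹) b c ⟩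
          d * d ⁻¹ * (d ⁻¹ * (b * c))     ≡⟨ cong (λ e → d * d ⁻¹ * (d ⁻¹ * e)) (+≡0⇒≡ det≡0) ⟨
          d * d ⁻¹ * (d ⁻¹ * (a * d))     ≡⟨ solve 3 (λ d i a → d :* i :* (i :* (a :* d)) := (d :* i) :* (d :* i) :* a) refl d (d ⁻¹) a ⟩
          d * d ⁻¹ * (d * d ⁻¹) * a       ≡⟨ cong (λ e → e * e * a) (*-inverseʳ d≢0) ⟩
          1# * 1# * a ≡⟨ solve 1 (λ a → ⟨1⟩ :* ⟨1⟩ :* a := a) refl a ⟩
          a ∎)))
        (sym (trans (cong (d *_) (trans (*-identityˡ (σ t)) σt≡)) (divide d≢0 b)))
        (sym (trans (cong (d *_) (trans (cong (d ⁻¹ * c *_) σ-1) (*-identityʳ _))) (divide d≢0 c)))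
        (sym (trans (cong (d *_) (trans (*-identityˡ (σ 1#)) σ-1)) (*-identityʳ d)))
    cases (yes refl) (no b≢0) _ = just (b ⁻¹ * a) , ∞ , b , b≢0 , quad≡
        (sym (trans (cong (b *_) (trans (cong (b ⁻¹ * a *_) σ-1) (*-identityʳ _))) (divide b≢0 a)))
        (sym (trans (cong (b *_) (trans (*-identityˡ (σ 1#)) σ-1)) (*-identityʳ b)))
        (trans c≡0 (sym (trans (cong (b *_) (trans (cong (b ⁻¹ * a *_) σ-0) (zeroʳ _))) (zeroʳ b))))
        (sym (trans (cong (b *_) (trans (*-identityˡ (σ 0#)) σ-0)) (zeroʳ b)))
      where
      c≡0 : c ≡ 0#
      c≡0 = *-cancelˡ b≢0 (trans (solve 3 (λ a b c → b :* c := a :* ⟨0⟩ :+ b :* c) refl a b c) (trans det≡0 (sym (zeroʳ b))))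
    cases (yes refl) (yes refl) (no c≢0) = let t , σt≡ = preimage (c ⁻¹ * a) in
      ∞ , just t , c , c≢0 , quad≡
        (sym (trans (cong (c *_) (trans (*-identityˡ (σ t)) σt≡)) (divide c≢0 a)))
        (sym (trans (cong (c *_) (zeroˡ (σ t))) (zeroʳ c)))
        (sym (trans (cong (c *_) (trans (*-identityˡ (σ 1#)) σ-1)) (*-identityʳ c)))
        (sym (trans (cong (c *_) (zeroˡ (σ 1#))) (zeroʳ c)))
    cases (yes refl) (yes refl) (yes refl) = ∞ , ∞ , a , (λ { refl → A≢0 refl }) , quad≡
        (sym (trans (cong (a *_) (trans (*-identityˡ (σ 1#)) σ-1)) (*-identityʳ a)))
        (sym (trans (cong (a *_) (zeroˡ (σ 1#))) (zeroʳ a)))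
        (sym (trans (cong (a *_) (trans (*-identityˡ (σ 0#)) σ-0)) (zeroʳ a)))
        (sym (trans (cong (a *_) (zeroˡ (σ 0#))) (zeroʳ a)))

  -- The additive maps t ↦ b t + c σ(t)

  L : Carrier → Carrier → Carrier → Carrier
  L b c t = b * t + c * σ t

  L-+ : ∀ b c t u → L b c (t + u) ≡ L b c t + L b c u
  L-+ b c t u = trans (cong (λ s → b * (t + u) + c * s) (σ-+ t u))
    (solve 6 (λ b c t u s r → b :* (t :+ u) :+ c :* (s :+ r) := (b :* t :+ c :* s) :+ (b :* u :+ c :* r)) refl b c t u (σ t) (σ u))

  -- An additive map without nonzero roots is injective, hence onto since the field is finite.
  L-root-or-surjective : ∀ b c → (∃[ v ] v ≢ 0# × L b c v ≡ 0#) ⊎ (∀ y → ∃[ t ] L b c t ≡ y)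
  L-root-or-surjective b c = search (any? (λ v → ¬? (v ≟ 0#) ×-dec L b c v ≟ 0#) elements)
    where
    search : Dec (Any (λ v → v ≢ 0# × L b c v ≡ 0#) elements) → _
    search (yes ∃v) = inj₁ (let v , _ , v≢0 , root = find ∃v in v , v≢0 , root)
    search (no ∄v) = inj₂ (injective⇒surjective (L b c) L-injective)
      where
      L-injective : ∀ {x y} → L b c x ≡ L b c y → x ≡ y
      L-injective {x} {y} eq with x + y ≟ 0#
      ... | yes x+y≡0 = +≡0⇒≡ x+y≡0
      ... | no  x+y≢0 = contradiction (lose (∈-elements (x + y)) (x+y≢0 , trans (L-+ b c x y) (≡⇒+≡0 eq))) ∄v

  -- The value at 1 is b + c, so b = c; the value at ρ is then b (ρ + σ(ρ)), and ρ is not fixed by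
  -- σ. For q = 2 there is no such ρ, and t + σ(t) vanishes identically.
  L-vanishes : ∀ {ρ} → ρ ≢ 0# → ρ ≢ 1# → ∀ b c → (∀ t → L b c t ≡ 0#) → b ≡ 0# × c ≡ 0#
  L-vanishes {ρ} ρ≢0 ρ≢1 b c vanishes = b≡0 , trans (sym b≡c) b≡0
    where
    b≡c : b ≡ c
    b≡c = +≡0⇒≡ (begin
      b + c ≡⟨ solve 2 (λ b c → b :+ c := b :* ⟨1⟩ :+ c :* ⟨1⟩) refl b c ⟩
      b * 1# + c * 1#   ≡⟨ cong (λ s → b * 1# + c * s) σ-1 ⟨
      L b c 1# ≡⟨ vanishes 1# ⟩
      0# ∎)
    b≡0 : b ≡ 0#
    b≡0 = [ id , (λ ρ+σρ≡0 → contradiction (σ-fixed (sym (+≡0⇒≡ ρ+σρ≡0))) [ ρ≢0 , ρ≢1 ]′) ]′ (*-≡0 (begin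
      b * (ρ + σ ρ)     ≡⟨ solve 3 (λ b t s → b :* (t :+ s) := b :* t :+ b :* s) refl b ρ (σ ρ) ⟩
      L b b ρ ≡⟨ cong (λ c → L b c ρ) b≡c ⟩
      L b c ρ ≡⟨ vanishes ρ ⟩
      0# ∎))

  -- The maps k, k s, k σ(s) of t are affine combinations of t and σ(t), so
  -- σ(α + A) L₃ = (α + A) σ(L₂) with A, L₂ and L₃ additive.  Comparing this
  -- identity at t, v and t + v, for v ≠ 0 in the kernel of A, shows that A/α is
  -- fixed by σ, hence takes the values 0 and 1 only; 1 would make k vanish.
  affine-part-vanishes : ∀ {ρ} → ρ ≢ 0# → ρ ≢ 1# → ∀ α b₁ c₁ b₂ c₂ b₃ c₃ →
    (∀ t → ∃[ k ] ∃[ s ] k ≢ 0# × (t ≢ 0# → s ≢ 0#) ×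
           α + L b₁ c₁ t ≡ k × L b₂ c₂ t ≡ k * s × L b₃ c₃ t ≡ k * σ s) →
    b₁ ≡ 0# × c₁ ≡ 0#
  affine-part-vanishes ρ≢0 ρ≢1 α b₁ c₁ b₂ c₂ b₃ c₃ values =
    L-vanishes ρ≢0 ρ≢1 b₁ c₁ ([ with-kernel , without-kernel ]′ (L-root-or-surjective b₁ c₁))
    where
    A = L b₁ c₁
    L₂ = L b₂ c₂
    L₃ = L b₃ c₃

    α+A≢0 : ∀ t → α + A t ≢ 0#
    α+A≢0 t eq = let k , s , k≢0 , _ , eq₁ , _ = values t in k≢0 (trans (sym eq₁) eq)

    -- If `A` were onto it would take the value α, and there k = α + A(t) would be 0.
    without-kernel : (∀ y → ∃[ t ] A t ≡ y) → ∀ t → A t ≡ 0#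
    without-kernel surjective _ = let t , At≡α = surjective α in
      contradiction (≡⇒+≡0 (sym At≡α)) (α+A≢0 t)

    relation : ∀ t → (σ α + σ (A t)) * L₃ t ≡ (α + A t) * σ (L₂ t)
    relation t = let k , s , _ , _ , eq₁ , eq₂ , eq₃ = values t in begin
      (σ α + σ (A t)) * L₃ t   ≡⟨ cong (_* L₃ t) (σ-+ α (A t)) ⟨
      σ (α + A t) * L₃ t       ≡⟨ cong₂ (λ x y → σ x * y) eq₁ eq₃ ⟩
      σ k * (k * σ s) ≡⟨ solve 3 (λ k l s → l :* (k :* s) := k :* (l :* s)) refl k (σ k) (σ s) ⟩
      k * (σ k * σ s) ≡⟨ cong (k *_) (σ-* k s) ⟨
      k * σ (k * s) ≡⟨ cong₂ (λ x y → x * σ y) eq₁ eq₂ ⟨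
      (α + A t) * σ (L₂ t)     ∎

    α≢0 : α ≢ 0#
    α≢0 α≡0 = α+A≢0 0# (begin
      α + (b₁ * 0# + c₁ * σ 0#)  ≡⟨ cong₂ (λ a s → a + (b₁ * 0# + c₁ * s)) α≡0 σ-0 ⟩
      0# + (b₁ * 0# + c₁ * 0#)   ≡⟨ solve 2 (λ b c → ⟨0⟩ :+ (b :* ⟨0⟩ :+ c :* ⟨0⟩) := ⟨0⟩) refl b₁ c₁ ⟩
      0# ∎)

    with-kernel : ∃[ v ] v ≢ 0# × A v ≡ 0# → ∀ t → A t ≡ 0#
    with-kernel (v , v≢0 , Av≡0) t with A t ≟ 0#
    ... | yes At≡0 = At≡0
    ... | no  At≢0 = contradiction (≡⇒+≡0 (σ-proportional α≢0 At≢0 (*-cancelˡ L₃v≢0 (begin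
        L₃ v * (α * σ (A t))       ≡⟨ solve 3 (λ l a s → l :* (a :* s) := a :* (s :* l)) refl (L₃ v) α (σ (A t)) ⟩
        α * (σ (A t) * L₃ v)       ≡⟨ cong (α *_) polar ⟩
        α * (A t * σ (L₂ v))       ≡⟨ solve 3 (λ a x l → a :* (x :* l) := x :* (a :* l)) refl α (A t) (σ (L₂ v)) ⟩
        A t * (α * σ (L₂ v))       ≡⟨ cong (A t *_) at-v ⟨
        A t * (σ α * L₃ v) ≡⟨ solve 3 (λ a x l → x :* (a :* l) := l :* (a :* x)) refl (σ α) (A t) (L₃ v) ⟩
        L₃ v * (σ α * A t) ∎)))) (α+A≢0 t)
      where
      L₃v≢0 : L₃ v ≢ 0#
      L₃v≢0 L₃v≡0 = let k , s , k≢0 , s≢0 , _ , _ , eq₃ = values v in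
        *-≢0 k≢0 (σ-≢0 (s≢0 v≢0)) (trans (sym eq₃) L₃v≡0)
      at-v : σ α * L₃ v ≡ α * σ (L₂ v)
      at-v = begin
        σ α * L₃ v ≡⟨ cong (_* L₃ v) (+-identityʳ (σ α)) ⟨
        (σ α + 0#) * L₃ v        ≡⟨ cong (λ s → (σ α + s) * L₃ v) (trans (cong σ Av≡0) σ-0) ⟨
        (σ α + σ (A v)) * L₃ v   ≡⟨ relation v ⟩
        (α + A v) * σ (L₂ v)     ≡⟨ cong (λ a → (α + a) * σ (L₂ v)) Av≡0 ⟩
        (α + 0#) * σ (L₂ v)      ≡⟨ cong (_* σ (L₂ v)) (+-identityʳ α) ⟩
        α * σ (L₂ v) ∎
      at-t+v : (σ α + σ (A t)) * (L₃ t + L₃ v) ≡ (α + A t) * (σ (L₂ t) + σ (L₂ v))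
      at-t+v = begin
        (σ α + σ (A t)) * (L₃ t + L₃ v) ≡⟨ cong₂ (λ x y → (σ α + σ x) * y) A[t+v] (L-+ b₃ c₃ t v) ⟨
        (σ α + σ (A (t + v))) * L₃ (t + v)      ≡⟨ relation (t + v) ⟩
        (α + A (t + v)) * σ (L₂ (t + v))        ≡⟨ cong₂ (λ x y → (α + x) * y) A[t+v] (trans (cong σ (L-+ b₂ c₂ t v)) (σ-+ (L₂ t) (L₂ v))) ⟩
        (α + A t) * (σ (L₂ t) + σ (L₂ v))       ∎
        where
        A[t+v] : A (t + v) ≡ A t
        A[t+v] = trans (L-+ b₁ c₁ t v) (trans (cong (A t +_) Av≡0) (+-identityʳ (A t)))
      polar : σ (A t) * L₃ v ≡ A t * σ (L₂ v)
      polar = +≡0⇒≡ (begin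
        σ (A t) * L₃ v + A t * σ (L₂ v)
          ≡⟨ solve 8 (λ α x t v α′ x′ t′ v′ → x :* v :+ x′ :* v′ :=
               ((α :+ x) :* (t :+ v) :+ (α′ :+ x′) :* (t′ :+ v′)) :+
               ((α :+ x) :* t :+ (α′ :+ x′) :* t′) :+ (α :* v :+ α′ :* v′))
             refl (σ α) (σ (A t)) (L₃ t) (L₃ v) α (A t) (σ (L₂ t)) (σ (L₂ v)) ⟩
        ((σ α + σ (A t)) * (L₃ t + L₃ v) + (α + A t) * (σ (L₂ t) + σ (L₂ v))) +
        ((σ α + σ (A t)) * L₃ t + (α + A t) * σ (L₂ t)) + (σ α * L₃ v + α * σ (L₂ v))
          ≡⟨ cong₂ _+_ (cong₂ _+_ (≡⇒+≡0 at-t+v) (≡⇒+≡0 (relation t))) (≡⇒+≡0 at-v) ⟩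
        0# + 0# + 0#
          ≡⟨ trans (+-identityʳ _) (+-identityʳ 0#) ⟩
        0# ∎)

  -- Points as tensors, dual to forms

  lin-transform : ∀ A g g′ X → lin A (transform g g′ X) ≡ lin (pull g g′ A) X
  lin-transform (quad a b c d) (quad α β γ δ) (quad α′ β′ γ′ δ′) (quad x y z w) =
    solve 16 (λ a b c d α β γ δ α′ β′ γ′ δ′ x y z w →
      S.lin (quad a b c d) (S.transform (quad α β γ δ) (quad α′ β′ γ′ δ′) (quad x y z w)) :=
      S.lin (S.pull (quad α β γ δ) (quad α′ β′ γ′ δ′) (quad a b c d)) (quad x y z w))
      refl a b c d α β γ δ α′ β′ γ′ δ′ x y z w

  lin-scaleʳ : ∀ A k X → lin A (scale k X) ≡ k * lin A X
  lin-scaleʳ (quad a b c d) k (quad x y z w) = solve 9 (λ a b c d k x y z w →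
    S.lin (quad a b c d) (S.scale k (quad x y z w)) := k :* S.lin (quad a b c d) (quad x y z w)) refl a b c d k x y z w

  lin-comm : ∀ A X → lin A X ≡ lin X A
  lin-comm (quad a b c d) (quad x y z w) = solve 8 (λ a b c d x y z w →
    S.lin (quad a b c d) (quad x y z w) := S.lin (quad x y z w) (quad a b c d)) refl a b c d x y z w

  lin-scaleˡ : ∀ k A X → lin (scale k A) X ≡ k * lin A X
  lin-scaleˡ k A X = trans (lin-comm (scale k A) X) (trans (lin-scaleʳ X k A) (cong (k *_) (lin-comm X A)))

  transform-outer : ∀ g g′ v v′ → transform g g′ (outer v v′) ≡ outer (apply g v) (apply g′ v′)
  transform-outer (quad a b c d) (quad a′ b′ c′ d′) (x , y) (x′ , y′) = quad≡
    (entry a b a′ b′) (entry c d a′ b′) (entry a b c′ d′) (entry c d c′ d′)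
    where
    entry : ∀ a b a′ b′ → lin (outer (a , b) (a′ , b′)) (outer (x , y) (x′ , y′)) ≡ (a * x + b * y) * (a′ * x′ + b′ * y′)
    entry a b a′ b′ = solve 8 (λ a b a′ b′ x y x′ y′ →
      S.lin (S.outer (a , b) (a′ , b′)) (S.outer (x , y) (x′ , y′)) := (a :* x :+ b :* y) :* (a′ :* x′ :+ b′ :* y′))
      refl a b a′ b′ x y x′ y′

  outer-• : ∀ k l u w → outer (k • u) (l • w) ≡ scale (k * l) (outer u w)
  outer-• k l (x , y) (x′ , y′) = quad≡ (entry x x′) (entry y x′) (entry x y′) (entry y y′)
    where
    entry : ∀ x y → k * x * (l * y) ≡ k * l * (x * y)
    entry = solve 4 (λ k l x y → k :* x :* (l :* y) := k :* l :* (x :* y)) refl k l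

  -- The tensor v ⊗ σ(v). By computation `lin A (pt x)` is `form A (vec x)`, so zeros of a form are
  -- arc points on a plane.
  pt : ℙ¹ → Quad Carrier
  pt x = outer (vec x) (σ² (vec x))

  -- Reversing the coefficients is the symplectic polarity.
  reverse : Quad Carrier → Quad Carrier
  reverse (quad a b c d) = quad d c b a

  lin-reverse : ∀ A X → lin (reverse A) X ≡ lin (reverse X) A
  lin-reverse (quad a b c d) (quad x y z w) = solve 8 (λ a b c d x y z w →
    S.lin (quad d c b a) (quad x y z w) := S.lin (quad w z y x) (quad a b c d)) refl a b c d x y z w

  -- The reversed coordinates of `pt x` are those of `plane x x` by computation, so
  -- `plane-injective` applies.
  pt-injective : ∀ {x y} → pt x ∼ pt y → x ≡ y
  pt-injective {x} {y} (k , k≢0 , eq) = proj₁ (plane-injective {x} {x} {y} {y} (k , k≢0 , cong reverse eq))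

  transform-pt : ∀ {g} (det≡1 : det g ≡ 1#) x → transform g (σ⁴ g) (pt x) ∼ pt (Möbius.move {g} det≡1 x)
  transform-pt {g} det≡1 x = factor x * σ (factor x) , *-≢0 (factor≢0 x) (σ-≢0 (factor≢0 x)) , (begin
    transform g (σ⁴ g) (outer (vec x) (σ² (vec x))) ≡⟨ transform-outer g (σ⁴ g) (vec x) (σ² (vec x)) ⟩
    outer (apply g (vec x)) (apply (σ⁴ g) (σ² (vec x)))       ≡⟨ cong (outer (apply g (vec x))) (σ²-apply g (vec x)) ⟨
    outer (apply g (vec x)) (σ² (apply g (vec x))) ≡⟨ cong (λ v → outer v (σ² v)) (apply-vec x) ⟩
    outer (factor x • vec (move x)) (σ² (factor x • vec (move x)))
      ≡⟨ cong (outer (factor x • vec (move x))) (σ²-• (factor x) (vec (move x))) ⟩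
    outer (factor x • vec (move x)) (σ (factor x) • σ² (vec (move x)))
      ≡⟨ outer-• (factor x) (σ (factor x)) (vec (move x)) (σ² (vec (move x))) ⟩
    scale (factor x * σ (factor x)) (pt (move x)) ∎)
    where open Möbius {g} det≡1

  -- Planes, points and projectivities of PG(3,q)

  open PG3 F hiding (form) renaming (orbit to planeOrbit)
  open Arc h
  open Sum semiring using (sum; sum-cong-≗; ∑-comm; *-distribˡ-sum; *-distribʳ-sum)

  -- Pointwise equal vectors become equal quads, so identities between coordinate functions can be
  -- used as equations without function extensionality.
  ⟦_⟧ : Vector Carrier 4 → Quad Carrier
  ⟦ x ⟧ = quad (x 0F) (x 1F) (x 2F) (x 3F)

  vector : Quad Carrier → Vector Carrier 4
  vector (quad a b c d) 0F = a
  vector (quad a b c d) 1F = b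
  vector (quad a b c d) 2F = c
  vector (quad a b c d) 3F = d

  vector-⟦⟧ : ∀ x i → vector ⟦ x ⟧ i ≡ x i
  vector-⟦⟧ x 0F = refl
  vector-⟦⟧ x 1F = refl
  vector-⟦⟧ x 2F = refl
  vector-⟦⟧ x 3F = refl

  vector-scale : ∀ k A i → vector (scale k A) i ≡ k * vector A i
  vector-scale k A 0F = refl
  vector-scale k A 1F = refl
  vector-scale k A 2F = refl
  vector-scale k A 3F = refl

  ⟦⟧-cong : ∀ {x y} → (∀ i → x i ≡ y i) → ⟦ x ⟧ ≡ ⟦ y ⟧
  ⟦⟧-cong eq = quad≡ (eq 0F) (eq 1F) (eq 2F) (eq 3F)

  ∝⇒∼ : ∀ {x y} → x ∝ y → ⟦ x ⟧ ∼ ⟦ y ⟧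
  ∝⇒∼ (k , k≢0 , eq) = k , k≢0 , ⟦⟧-cong eq

  ∼⇒∝ : ∀ {x y} → ⟦ x ⟧ ∼ ⟦ y ⟧ → x ∝ y
  ∼⇒∝ {x} {y} (k , k≢0 , eq) = k , k≢0 , λ i → begin
    x i ≡⟨ vector-⟦⟧ x i ⟨
    vector ⟦ x ⟧ i ≡⟨ cong (λ A → vector A i) eq ⟩
    vector (scale k ⟦ y ⟧) i   ≡⟨ vector-scale k ⟦ y ⟧ i ⟩
    k * vector ⟦ y ⟧ i ≡⟨ cong (k *_) (vector-⟦⟧ y i) ⟩
    k * y i ∎

  ∙≡lin : ∀ x y → x ∙ y ≡ lin ⟦ x ⟧ ⟦ y ⟧
  ∙≡lin x y = solve 8 (λ a b c d x y z w →
    a :* x :+ (b :* y :+ (c :* z :+ (d :* w :+ ⟨0⟩))) := S.lin (quad a b c d) (quad x y z w))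
    refl (x 0F) (x 1F) (x 2F) (x 3F) (y 0F) (y 1F) (y 2F) (y 3F)

  ≢0⇒index : ∀ A → A ≢ 0Q → ∃[ i ] vector A i ≢ 0#
  ≢0⇒index (quad a b c d) A≢0 with a ≟ 0# | b ≟ 0# | c ≟ 0# | d ≟ 0#
  ... | no a≢0  | _       | _       | _       = 0F , a≢0
  ... | yes _   | no b≢0  | _       | _       = 1F , b≢0
  ... | yes _   | yes _   | no c≢0  | _       = 2F , c≢0
  ... | yes _   | yes _   | yes _   | no d≢0  = 3F , d≢0
  ... | yes a≡0 | yes b≡0 | yes c≡0 | yes d≡0 = contradiction (quad≡ a≡0 b≡0 c≡0 d≡0) A≢0

  index⇒≢0 : ∀ {x} → ∃[ i ] x i ≢ 0# → ⟦ x ⟧ ≢ 0Q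
  index⇒≢0 {x} (i , xᵢ≢0) x≡0 = xᵢ≢0 (trans (sym (vector-⟦⟧ x i)) (trans (cong (λ A → vector A i) x≡0) (0Q≡0 i)))
    where
    0Q≡0 : ∀ i → vector 0Q i ≡ 0#
    0Q≡0 0F = refl
    0Q≡0 1F = refl
    0Q≡0 2F = refl
    0Q≡0 3F = refl

  toPoint : ∀ A → A ≢ 0Q → Point
  toPoint A A≢0 = mkPoint (vector A) (≢0⇒index A A≢0)

  toPlane : ∀ A → A ≢ 0Q → Plane
  toPlane A A≢0 = mkPlane (vector A) (≢0⇒index A A≢0)

  ⟪_⟫ : Plane → Quad Carrier
  ⟪ π ⟫ = ⟦ coeffs π ⟧

  ⟪⟫≢0 : ∀ π → ⟪ π ⟫ ≢ 0Q
  ⟪⟫≢0 π = index⇒≢0 (Plane.nonzero π)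

  coords≢0 : ∀ P → ⟦ coords P ⟧ ≢ 0Q
  coords≢0 P = index⇒≢0 (Point.nonzero P)

  lin-0Q : ∀ A → lin A 0Q ≡ 0#
  lin-0Q (quad a b c d) = solve 4 (λ a b c d → S.lin (quad a b c d) (quad ⟨0⟩ ⟨0⟩ ⟨0⟩ ⟨0⟩) := ⟨0⟩) refl a b c d

  -- A plane is determined by its points: testing the points A_j e_i + A_i e_j
  -- of A against B shows that the 2×2 minors of (A , B) vanish.
  kernel⊆⇒∼ : ∀ A B → A ≢ 0Q → B ≢ 0Q → (∀ X → X ≢ 0Q → lin A X ≡ 0# → lin B X ≡ 0#) → B ∼ A
  kernel⊆⇒∼ A@(quad a b c d) B@(quad a′ b′ c′ d′) A≢0 B≢0 kernel = pivot (a ≟ 0#) (b ≟ 0#) (c ≟ 0#) (d ≟ 0#)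
    where
    kernel′ : ∀ X → lin A X ≡ 0# → lin B X ≡ 0#
    kernel′ X A·X≡0 = by (X ≟Q 0Q)
      where
      by : Dec (X ≡ 0Q) → lin B X ≡ 0#
      by (yes refl) = lin-0Q B
      by (no X≢0)   = kernel X X≢0 A·X≡0

    ab : a′ * b ≡ b′ * a
    ab = +≡0⇒≡ (trans (solve 6 (λ x y a b c d → x :* b :+ y :* a := x :* b :+ y :* a :+ c :* ⟨0⟩ :+ d :* ⟨0⟩) refl a′ b′ a b c′ d′)
           (kernel′ (quad b a 0# 0#) (solve 4 (λ a b c d → S.lin (quad a b c d) (quad b a ⟨0⟩ ⟨0⟩) := ⟨0⟩) refl a b c d)))
    ac : a′ * c ≡ c′ * a
    ac = +≡0⇒≡ (trans (solve 6 (λ x y a b c d → x :* b :+ y :* a := x :* b :+ c :* ⟨0⟩ :+ y :* a :+ d :* ⟨0⟩) refl a′ c′ a c b′ d′)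
           (kernel′ (quad c 0# a 0#) (solve 4 (λ a b c d → S.lin (quad a b c d) (quad c ⟨0⟩ a ⟨0⟩) := ⟨0⟩) refl a b c d)))
    ad : a′ * d ≡ d′ * a
    ad = +≡0⇒≡ (trans (solve 6 (λ x y a b c d → x :* b :+ y :* a := x :* b :+ c :* ⟨0⟩ :+ d :* ⟨0⟩ :+ y :* a) refl a′ d′ a d b′ c′)
           (kernel′ (quad d 0# 0# a) (solve 4 (λ a b c d → S.lin (quad a b c d) (quad d ⟨0⟩ ⟨0⟩ a) := ⟨0⟩) refl a b c d)))
    bc : b′ * c ≡ c′ * b
    bc = +≡0⇒≡ (trans (solve 6 (λ x y a b c d → x :* b :+ y :* a := c :* ⟨0⟩ :+ x :* b :+ y :* a :+ d :* ⟨0⟩) refl b′ c′ b c a′ d′)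
           (kernel′ (quad 0# c b 0#) (solve 4 (λ a b c d → S.lin (quad a b c d) (quad ⟨0⟩ c b ⟨0⟩) := ⟨0⟩) refl a b c d)))
    bd : b′ * d ≡ d′ * b
    bd = +≡0⇒≡ (trans (solve 6 (λ x y a b c d → x :* b :+ y :* a := c :* ⟨0⟩ :+ x :* b :+ d :* ⟨0⟩ :+ y :* a) refl b′ d′ b d a′ c′)
           (kernel′ (quad 0# d 0# b) (solve 4 (λ a b c d → S.lin (quad a b c d) (quad ⟨0⟩ d ⟨0⟩ b) := ⟨0⟩) refl a b c d)))
    cd : c′ * d ≡ d′ * c
    cd = +≡0⇒≡ (trans (solve 6 (λ x y a b c d → x :* b :+ y :* a := c :* ⟨0⟩ :+ d :* ⟨0⟩ :+ x :* b :+ y :* a) refl c′ d′ c d a′ b′)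
           (kernel′ (quad 0# 0# d c) (solve 4 (λ a b c d → S.lin (quad a b c d) (quad ⟨0⟩ ⟨0⟩ d c) := ⟨0⟩) refl a b c d)))

    from-pivot : ∀ {x x′} → x ≢ 0# → (∀ {y y′} → x′ * y ≡ y′ * x → y′ ≡ x′ * x ⁻¹ * y)
    from-pivot {x} {x′} x≢0 {y} {y′} eq = begin
      y′ ≡⟨ *-identityʳ y′ ⟨
      y′ * 1# ≡⟨ cong (y′ *_) (*-inverseʳ x≢0) ⟨
      y′ * (x * x ⁻¹)    ≡⟨ *-assoc y′ x (x ⁻¹) ⟨
      y′ * x * x ⁻¹      ≡⟨ cong (_* x ⁻¹) eq ⟨
      x′ * y * x ⁻¹      ≡⟨ solve 3 (λ x y i → x :* y :* i := x :* i :* y) refl x′ y (x ⁻¹) ⟩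
      x′ * x ⁻¹ * y      ∎

    proportional : ∀ k → B ≡ scale k A → B ∼ A
    proportional k eq = k , k≢0 , eq
      where
      k≢0 : k ≢ 0#
      k≢0 refl = B≢0 (trans eq (quad≡ (zeroˡ a) (zeroˡ b) (zeroˡ c) (zeroˡ d)))

    pivot : Dec (a ≡ 0#) → Dec (b ≡ 0#) → Dec (c ≡ 0#) → Dec (d ≡ 0#) → B ∼ A
    pivot (no a≢0) _ _ _ = proportional (a′ * a ⁻¹)
      (quad≡ (from-pivot a≢0 refl) (from-pivot a≢0 ab) (from-pivot a≢0 ac) (from-pivot a≢0 ad))
    pivot (yes _) (no b≢0) _ _ = proportional (b′ * b ⁻¹)
      (quad≡ (from-pivot b≢0 (sym ab)) (from-pivot b≢0 refl) (from-pivot b≢0 bc) (from-pivot b≢0 bd))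
    pivot (yes _) (yes _) (no c≢0) _ = proportional (c′ * c ⁻¹)
      (quad≡ (from-pivot c≢0 (sym ac)) (from-pivot c≢0 (sym bc)) (from-pivot c≢0 refl) (from-pivot c≢0 cd))
    pivot (yes _) (yes _) (yes _) (no d≢0) = proportional (d′ * d ⁻¹)
      (quad≡ (from-pivot d≢0 (sym ad)) (from-pivot d≢0 (sym bd)) (from-pivot d≢0 (sym cd)) (from-pivot d≢0 refl))
    pivot (yes a≡0) (yes b≡0) (yes c≡0) (yes d≡0) = contradiction (quad≡ a≡0 b≡0 c≡0 d≡0) A≢0

  points⇒lin : ∀ π P → points π P → lin ⟪ π ⟫ ⟦ coords P ⟧ ≡ 0#
  points⇒lin π P ∈ = trans (sym (∙≡lin (coeffs π) (coords P))) ∈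

  lin⇒points : ∀ π P → lin ⟪ π ⟫ ⟦ coords P ⟧ ≡ 0# → points π P
  lin⇒points π P eq = trans (∙≡lin (coeffs π) (coords P)) eq

  ≈ₗ⇒∼ : ∀ {π π′} → π ≈ₗ π′ → ⟪ π ⟫ ∼ ⟪ π′ ⟫
  ≈ₗ⇒∼ {π} {π′} (_ , ⊇) = kernel⊆⇒∼ ⟪ π′ ⟫ ⟪ π ⟫ (⟪⟫≢0 π′) (⟪⟫≢0 π)
    λ X X≢0 eq → points⇒lin π (toPoint X X≢0) (⊇ {toPoint X X≢0} (lin⇒points π′ (toPoint X X≢0) eq))

  ∼⇒≈ₗ : ∀ {π π′} → ⟪ π ⟫ ∼ ⟪ π′ ⟫ → π ≈ₗ π′
  ∼⇒≈ₗ {π} {π′} eq = (λ {P} → included π π′ (∼-sym eq) P) , λ {P} → included π′ π eq P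
    where
    included : ∀ π π′ → ⟪ π′ ⟫ ∼ ⟪ π ⟫ → ∀ P → points π P → points π′ P
    included π π′ (k , _ , eq) P P∈π = lin⇒points π′ P (begin
      lin ⟪ π′ ⟫ ⟦ coords P ⟧ ≡⟨ cong (λ A → lin A ⟦ coords P ⟧) eq ⟩
      lin (scale k ⟪ π ⟫) ⟦ coords P ⟧   ≡⟨ lin-scaleˡ k ⟪ π ⟫ ⟦ coords P ⟧ ⟩
      k * lin ⟪ π ⟫ ⟦ coords P ⟧ ≡⟨ cong (k *_) (points⇒lin π P P∈π) ⟩
      k * 0# ≡⟨ zeroʳ k ⟩
      0# ∎)

  lin-∼ʳ : ∀ A {X Y} → X ∼ Y → lin A X ≡ 0# → lin A Y ≡ 0#
  lin-∼ʳ A {Y = Y} (k , k≢0 , refl) eq = *-cancelˡ k≢0 (trans (sym (lin-scaleʳ A k Y)) (trans eq (sym (zeroʳ k))))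

  lin-∼ˡ : ∀ {A B} X → A ∼ B → lin A X ≡ 0# → lin B X ≡ 0#
  lin-∼ˡ {A} {B} X A∼B eq = trans (lin-comm B X) (lin-∼ʳ X A∼B (trans (lin-comm X A) eq))

  ·-·≡⊡-· : ∀ M N x i → (M · (N · x)) i ≡ ((M ⊡ N) · x) i
  ·-·≡⊡-· M N x i = begin
    sum (λ k → M i k * sum (λ j → N k j * x j))
      ≡⟨ sum-cong-≗ (λ k → *-distribˡ-sum (M i k) (λ j → N k j * x j)) ⟩
    sum (λ k → sum (λ j → M i k * (N k j * x j)))
      ≡⟨ ∑-comm (λ k j → M i k * (N k j * x j)) ⟩
    sum (λ j → sum (λ k → M i k * (N k j * x j)))
      ≡⟨ sum-cong-≗ (λ j → sum-cong-≗ λ k → sym (*-assoc (M i k) (N k j) (x j))) ⟩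
    sum (λ j → sum (λ k → M i k * N k j * x j))
      ≡⟨ sum-cong-≗ (λ j → sym (*-distribʳ-sum (x j) (λ k → M i k * N k j))) ⟩
    sum (λ j → sum (λ k → M i k * N k j) * x j) ∎

  I-· : ∀ x i → (I · x) i ≡ x i
  I-· x 0F = solve 4 (λ a b c d → ⟨1⟩ :* a :+ (⟨0⟩ :* b :+ (⟨0⟩ :* c :+ (⟨0⟩ :* d :+ ⟨0⟩))) := a) refl (x 0F) (x 1F) (x 2F) (x 3F)
  I-· x 1F = solve 4 (λ a b c d → ⟨0⟩ :* a :+ (⟨1⟩ :* b :+ (⟨0⟩ :* c :+ (⟨0⟩ :* d :+ ⟨0⟩))) := b) refl (x 0F) (x 1F) (x 2F) (x 3F)
  I-· x 2F = solve 4 (λ a b c d → ⟨0⟩ :* a :+ (⟨0⟩ :* b :+ (⟨1⟩ :* c :+ (⟨0⟩ :* d :+ ⟨0⟩))) := c) refl (x 0F) (x 1F) (x 2F) (x 3F)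
  I-· x 3F = solve 4 (λ a b c d → ⟨0⟩ :* a :+ (⟨0⟩ :* b :+ (⟨0⟩ :* c :+ (⟨1⟩ :* d :+ ⟨0⟩))) := d) refl (x 0F) (x 1F) (x 2F) (x 3F)

  infixr 7 _⋆_
  _⋆_ : Matrix → Quad Carrier → Quad Carrier
  N ⋆ X = ⟦ N · vector X ⟧

  ·-cong : ∀ N {x y} → (∀ i → x i ≡ y i) → ∀ i → (N · x) i ≡ (N · y) i
  ·-cong N eq i = sum-cong-≗ (λ j → cong (N i j *_) (eq j))

  ⋆-⟦⟧ : ∀ N x → N ⋆ ⟦ x ⟧ ≡ ⟦ N · x ⟧
  ⋆-⟦⟧ N x = ⟦⟧-cong (·-cong N (vector-⟦⟧ x))

  ⋆-scale : ∀ N k X → N ⋆ scale k X ≡ scale k (N ⋆ X)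
  ⋆-scale N k X = quad≡ (row 0F) (row 1F) (row 2F) (row 3F)
    where
    row : ∀ i → (N · vector (scale k X)) i ≡ k * (N · vector X) i
    row i = trans (∙≡lin (N i) (vector (scale k X)))
      (trans (lin-scaleʳ ⟦ N i ⟧ k X) (cong (k *_) (sym (∙≡lin (N i) (vector X)))))

  ⋆-∼ : ∀ N {X Y} → X ∼ Y → N ⋆ X ∼ N ⋆ Y
  ⋆-∼ N {Y = Y} (k , k≢0 , refl) = k , k≢0 , ⋆-scale N k Y

  left-inverse : ∀ {M N : Matrix} → (∀ i j → (M ⊡ N) i j ≡ I i j) → ∀ X → M ⋆ N ⋆ X ≡ X
  left-inverse {M} {N} inverseˡ X = trans (⋆-⟦⟧ M (N · vector X)) (trans (⟦⟧-cong entry) refl)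
    where
    entry : ∀ i → (M · (N · vector X)) i ≡ vector X i
    entry i = trans (·-·≡⊡-· M N (vector X) i)
      (trans (sum-cong-≗ (λ j → cong (_* vector X j) (inverseˡ i j))) (I-· (vector X) i))

  transpose : Matrix → Quad Carrier → Quad Carrier
  transpose N A = ⟦ (λ j → vector A ∙ λ k → N k j) ⟧

  lin-⋆ : ∀ A N X → lin A (N ⋆ X) ≡ lin (transpose N A) X
  lin-⋆ A N X = trans (sym (∙≡lin (vector A) (N · vector X)))
    -- `A` is read as a matrix all of whose rows are `vector A`, and associativity is taken in row
    -- 0.
    (trans (·-·≡⊡-· (λ _ → vector A) N (vector X) 0F) (∙≡lin (λ j → vector A ∙ λ k → N k j) (vector X)))

  Pt : ℙ¹ → Point
  Pt ∞        = U₄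
  Pt (just t) = P[ t ]

  coords-Pt : ∀ x → ⟦ coords (Pt x) ⟧ ≡ pt x
  coords-Pt ∞ = sym (quad≡ (zeroˡ (σ 0#)) (trans (*-identityˡ (σ 0#)) σ-0) (zeroˡ (σ 1#)) (trans (*-identityˡ (σ 1#)) σ-1))
  coords-Pt (just t) = sym (quad≡
    (trans (*-identityˡ (σ 1#)) σ-1)
    (trans (cong (t *_) σ-1) (*-identityʳ t))
    (trans (*-identityˡ (σ t)) (σ-def t))
    (begin
      t * σ t ≡⟨ *-comm t (σ t) ⟩
      σ t * t ≡⟨ cong₂ _*_ (σ-def t) (sym (*-identityʳ t)) ⟩
      φ h t * t ^ 1 ≡⟨ Exp.^-homo-* semiring t (2 ℕ.^ h) 1 ⟨
      t ^ (2 ℕ.^ h ℕ.+ 1) ∎))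

  abstract
    𝒜⇒pt : ∀ {P} → 𝒜 P → ∃[ x ] ⟦ coords P ⟧ ∼ pt x
    𝒜⇒pt (inj₁ (t , P≈)) = just t , ∼-trans (∝⇒∼ P≈) (∼-reflexive (coords-Pt (just t)))
    𝒜⇒pt (inj₂ P≈)       = ∞ , ∼-trans (∝⇒∼ P≈) (∼-reflexive (coords-Pt ∞))

    ∼Pt : ∀ {P} x → ⟦ coords P ⟧ ∼ pt x → P ≈ₚ Pt x
    ∼Pt x P∼ = ∼⇒∝ (∼-trans P∼ (∼-reflexive (sym (coords-Pt x))))

    pt⇒𝒜 : ∀ {P} x → ⟦ coords P ⟧ ∼ pt x → 𝒜 P
    pt⇒𝒜 {P} ∞        P∼ = inj₂ (∼Pt {P} ∞ P∼)
    pt⇒𝒜 {P} (just t) P∼ = inj₁ (t , ∼Pt {P} (just t) P∼)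

    Pt∈𝒜 : ∀ x → 𝒜 (Pt x)
    Pt∈𝒜 x = pt⇒𝒜 {Pt x} x (∼-reflexive (coords-Pt x))

  -- For `quad a b c d` these are the rows of the matrix M_{a,b,c,d}.
  Mat : Quad Carrier → Matrix
  Mat g 0F = vector (outer (row₁ g) (row₁ (σ⁴ g)))
  Mat g 1F = vector (outer (row₂ g) (row₁ (σ⁴ g)))
  Mat g 2F = vector (outer (row₁ g) (row₂ (σ⁴ g)))
  Mat g 3F = vector (outer (row₂ g) (row₂ (σ⁴ g)))

  Mat-⋆ : ∀ g X → Mat g ⋆ X ≡ transform g (σ⁴ g) X
  Mat-⋆ g X = quad≡ (∙≡lin (Mat g 0F) (vector X)) (∙≡lin (Mat g 1F) (vector X))
                    (∙≡lin (Mat g 2F) (vector X)) (∙≡lin (Mat g 3F) (vector X))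

  dot : Carrier × Carrier → Carrier × Carrier → Carrier
  dot (a , b) (x , y) = a * x + b * y

  -- The mixed product rule for tensors: (r ⊗ r′) · (s ⊗ s′) = (r · s)(r′ · s′).
  outer-∙-outer : ∀ r r′ s s′ {k l m} → dot r s ≡ k → dot r′ s′ ≡ l → k * l ≡ m →
                  vector (outer r r′) ∙ vector (outer s s′) ≡ m
  outer-∙-outer (a , b) (a′ , b′) (x , y) (x′ , y′) refl refl eq = trans (solve 8 (λ a b a′ b′ x y x′ y′ →
    (a :* a′) :* (x :* x′) :+ ((b :* a′) :* (y :* x′) :+ ((a :* b′) :* (x :* y′) :+ ((b :* b′) :* (y :* y′) :+ ⟨0⟩))) :=
    (a :* x :+ b :* y) :* (a′ :* x′ :+ b′ :* y′)) refl a b a′ b′ x y x′ y′) eq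

  -- Mat g is the Kronecker product of g and σ(g).
  Mat-inverse : ∀ g → det g ≡ 1# → ∀ i j → (Mat (inv g) ⊡ Mat g) i j ≡ I i j
  Mat-inverse g det≡1 = λ where
      0F 0F → outer-∙-outer r₁ r₁′ s₁ s₁′ p₁₁ q₁₁ 1*1
      0F 1F → outer-∙-outer r₁ r₁′ s₂ s₁′ p₁₂ q₁₁ (zeroˡ 1#)
      0F 2F → outer-∙-outer r₁ r₁′ s₁ s₂′ p₁₁ q₁₂ (zeroʳ 1#)
      0F 3F → outer-∙-outer r₁ r₁′ s₂ s₂′ p₁₂ q₁₂ (zeroˡ 0#)
      1F 0F → outer-∙-outer r₂ r₁′ s₁ s₁′ p₂₁ q₁₁ (zeroˡ 1#)
      1F 1F → outer-∙-outer r₂ r₁′ s₂ s₁′ p₂₂ q₁₁ 1*1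
      1F 2F → outer-∙-outer r₂ r₁′ s₁ s₂′ p₂₁ q₁₂ (zeroˡ 0#)
      1F 3F → outer-∙-outer r₂ r₁′ s₂ s₂′ p₂₂ q₁₂ (zeroʳ 1#)
      2F 0F → outer-∙-outer r₁ r₂′ s₁ s₁′ p₁₁ q₂₁ (zeroʳ 1#)
      2F 1F → outer-∙-outer r₁ r₂′ s₂ s₁′ p₁₂ q₂₁ (zeroˡ 0#)
      2F 2F → outer-∙-outer r₁ r₂′ s₁ s₂′ p₁₁ q₂₂ 1*1
      2F 3F → outer-∙-outer r₁ r₂′ s₂ s₂′ p₁₂ q₂₂ (zeroˡ 1#)
      3F 0F → outer-∙-outer r₂ r₂′ s₁ s₁′ p₂₁ q₂₁ (zeroˡ 0#)
      3F 1F → outer-∙-outer r₂ r₂′ s₂ s₁′ p₂₂ q₂₁ (zeroʳ 1#)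
      3F 2F → outer-∙-outer r₂ r₂′ s₁ s₂′ p₂₁ q₂₂ (zeroˡ 1#)
      3F 3F → outer-∙-outer r₂ r₂′ s₂ s₂′ p₂₂ q₂₂ 1*1
    where
    r₁ = row₁ (inv g); r₂ = row₂ (inv g); s₁ = column₁ g; s₂ = column₂ g
    r₁′ = row₁ (inv (σ⁴ g)); r₂′ = row₂ (inv (σ⁴ g)); s₁′ = column₁ (σ⁴ g); s₂′ = column₂ (σ⁴ g)
    1*1 = *-identityˡ 1#
    product : mul (inv g) g ≡ one
    product = mul-invˡ det≡1
    product′ : mul (inv (σ⁴ g)) (σ⁴ g) ≡ one
    product′ = mul-invˡ (trans (det-σ⁴ g) (trans (cong σ det≡1) σ-1))
    p₁₁ = cong Quad.e₁ product; p₁₂ = cong Quad.e₂ product; p₂₁ = cong Quad.e₃ product; p₂₂ = cong Quad.e₄ product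
    q₁₁ = cong Quad.e₁ product′; q₁₂ = cong Quad.e₂ product′; q₂₁ = cong Quad.e₃ product′; q₂₂ = cong Quad.e₄ product′

  projectivity : ∀ g → det g ≡ 1# → Projectivity
  projectivity g det≡1 = record
    { matrix   = Mat g
    ; matrix⁻¹ = Mat (inv g)
    ; inverseˡ = Mat-inverse g det≡1
    ; inverseʳ = Mat-inverse (inv g) (trans (det-inv g) det≡1)
    }

  module Action (p : Projectivity) where

    private
      N N⁻¹ : Matrix
      N   = Projectivity.matrix p
      N⁻¹ = Projectivity.matrix⁻¹ p

    N⁻¹N : ∀ X → N⁻¹ ⋆ N ⋆ X ≡ X
    N⁻¹N = left-inverse {N⁻¹} {N} (Projectivity.inverseˡ p)

    NN⁻¹ : ∀ X → N ⋆ N⁻¹ ⋆ X ≡ X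
    NN⁻¹ = left-inverse {N} {N⁻¹} (Projectivity.inverseʳ p)

    ⋆-injective : ∀ {X Y} → N ⋆ X ∼ N ⋆ Y → X ∼ Y
    ⋆-injective {X} {Y} eq = subst₂ _∼_ (N⁻¹N X) (N⁻¹N Y) (⋆-∼ N⁻¹ eq)

    ⋆-0Q : ∀ M → M ⋆ 0Q ≡ 0Q
    ⋆-0Q M = quad≡ (row 0F) (row 1F) (row 2F) (row 3F)
      where
      row : ∀ i → (M · vector 0Q) i ≡ 0#
      row i = trans (∙≡lin (M i) (vector 0Q)) (lin-0Q ⟦ M i ⟧)

    ⋆≢0 : ∀ {X} → X ≢ 0Q → N ⋆ X ≢ 0Q
    ⋆≢0 {X} X≢0 NX≡0 = X≢0 (trans (sym (N⁻¹N X)) (trans (cong (N⁻¹ ⋆_) NX≡0) (⋆-0Q N⁻¹)))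

    ⋆⁻¹≢0 : ∀ {X} → X ≢ 0Q → N⁻¹ ⋆ X ≢ 0Q
    ⋆⁻¹≢0 {X} X≢0 NX≡0 = X≢0 (trans (sym (NN⁻¹ X)) (trans (cong (N ⋆_) NX≡0) (⋆-0Q N)))

    -- Equality of a plane with the image of another, restated for vectors. The zero vector is
    -- included, so that no proof of nonvanishing has to be carried along.
    Maps : Quad Carrier → Quad Carrier → Set c
    Maps A B = (∀ X → lin A X ≡ 0# → lin B (N ⋆ X) ≡ 0#) × (∀ X → lin B (N ⋆ X) ≡ 0# → lin A X ≡ 0#)

    image⇒Maps : ∀ {π π′} → image p (points π) ≐ points π′ → Maps ⟪ π ⟫ ⟪ π′ ⟫
    image⇒Maps {π} {π′} (⊆ , ⊇) = (λ X → forward X (X ≟Q 0Q)) , λ X → backward X (X ≟Q 0Q)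
      where
      forward : ∀ X → Dec (X ≡ 0Q) → lin ⟪ π ⟫ X ≡ 0# → lin ⟪ π′ ⟫ (N ⋆ X) ≡ 0#
      forward X (yes refl) _  = trans (cong (lin ⟪ π′ ⟫) (⋆-0Q N)) (lin-0Q ⟪ π′ ⟫)
      forward X (no X≢0)   eq = points⇒lin π′ Y (⊆ {Y} (toPoint X X≢0 , lin⇒points π (toPoint X X≢0) eq , ∼⇒∝ (∼-reflexive refl)))
        where
        Y = toPoint (N ⋆ X) (⋆≢0 X≢0)
      backward : ∀ X → Dec (X ≡ 0Q) → lin ⟪ π′ ⟫ (N ⋆ X) ≡ 0# → lin ⟪ π ⟫ X ≡ 0#
      backward X (yes refl) _  = lin-0Q ⟪ π ⟫
      backward X (no X≢0)   eq = preimage (⊇ {Y} (lin⇒points π′ Y eq))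
        where
        Y = toPoint (N ⋆ X) (⋆≢0 X≢0)
        preimage : image p (points π) Y → lin ⟪ π ⟫ X ≡ 0#
        preimage (P , P∈π , Y∝NP) = lin-∼ʳ ⟪ π ⟫ (∼-sym (⋆-injective
          (∼-trans (∝⇒∼ Y∝NP) (∼-reflexive (sym (⋆-⟦⟧ N (coords P))))))) (points⇒lin π P P∈π)

    Maps⇒image : ∀ {π π′} → Maps ⟪ π ⟫ ⟪ π′ ⟫ → image p (points π) ≐ points π′
    Maps⇒image {π} {π′} (to , from) = (λ {Q} → forward Q) , λ {Q} → backward Q
      where
      forward : ∀ Q → image p (points π) Q → points π′ Q
      forward Q (P , P∈π , Q∝NP) = lin⇒points π′ Q (lin-∼ʳ ⟪ π′ ⟫
        (∼-trans (∼-reflexive (⋆-⟦⟧ N (coords P))) (∼-sym (∝⇒∼ Q∝NP)))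
        (to ⟦ coords P ⟧ (points⇒lin π P P∈π)))
      backward : ∀ Q → points π′ Q → image p (points π) Q
      backward Q Q∈π′ = P ,
        lin⇒points π P (from X (subst (λ Y → lin ⟪ π′ ⟫ Y ≡ 0#) (sym (NN⁻¹ ⟦ coords Q ⟧)) (points⇒lin π′ Q Q∈π′))) ,
        ∼⇒∝ (∼-reflexive (sym (NN⁻¹ ⟦ coords Q ⟧)))
        where
        X = N⁻¹ ⋆ ⟦ coords Q ⟧
        P = toPoint X (⋆⁻¹≢0 (coords≢0 Q))

  projectivity∈G : ∀ g det≡1 → G (projectivity g det≡1)
  projectivity∈G g det≡1 = (λ {Q} → forward Q) , λ {Q} → backward Q
    where
    open Action (projectivity g det≡1)
    forward : ∀ Q → image (projectivity g det≡1) 𝒜 Q → 𝒜 Q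
    forward Q (P , P∈𝒜 , Q∝NP) = let x , P∼ = 𝒜⇒pt {P} P∈𝒜 in
      pt⇒𝒜 {Q} (Möbius.move {g} det≡1 x) (∼-trans (∝⇒∼ Q∝NP) (∼-trans (∼-reflexive (sym (⋆-⟦⟧ (Mat g) (coords P))))
        (∼-trans (⋆-∼ (Mat g) P∼) (∼-trans (∼-reflexive (Mat-⋆ g (pt x))) (transform-pt det≡1 x)))))
    backward : ∀ Q → 𝒜 Q → image (projectivity g det≡1) 𝒜 Q
    backward Q Q∈𝒜 = let x , Q∼ = 𝒜⇒pt {Q} Q∈𝒜 in
      toPoint (Mat (inv g) ⋆ ⟦ coords Q ⟧) (⋆⁻¹≢0 (coords≢0 Q)) ,
      pt⇒𝒜 {toPoint (Mat (inv g) ⋆ ⟦ coords Q ⟧) (⋆⁻¹≢0 (coords≢0 Q))} (Möbius.move {inv g} det-inv≡1 x)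
        (∼-trans (⋆-∼ (Mat (inv g)) Q∼) (∼-trans (∼-reflexive (Mat-⋆ (inv g) (pt x))) (transform-pt det-inv≡1 x))) ,
      ∼⇒∝ (∼-reflexive (sym (NN⁻¹ ⟦ coords Q ⟧)))
      where
      det-inv≡1 : det (inv g) ≡ 1#
      det-inv≡1 = trans (det-inv g) det≡1

  -- Points move by `g` but equations by substitution, so the plane that is carried onto `π′` is the
  -- one with form `act g ⟪ π′ ⟫`.
  act⇒image : ∀ {π π′} g (det≡1 : det g ≡ 1#) → ⟪ π ⟫ ∼ act g ⟪ π′ ⟫ →
              image (projectivity g det≡1) (points π) ≐ points π′
  act⇒image {π} {π′} g det≡1 π∼gπ′ = Maps⇒image {π} {π′}
    ((λ X eq → trans (pulled X) (lin-∼ˡ X π∼gπ′ eq)) ,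
     (λ X eq → lin-∼ˡ X (∼-sym π∼gπ′) (trans (sym (pulled X)) eq)))
    where
    open Action (projectivity g det≡1)
    pulled : ∀ X → lin ⟪ π′ ⟫ (Mat g ⋆ X) ≡ lin (act g ⟪ π′ ⟫) X
    pulled X = trans (cong (lin ⟪ π′ ⟫) (Mat-⋆ g X)) (lin-transform ⟪ π′ ⟫ g (σ⁴ g) X)

  lin-Mat : ∀ A g X → lin A (Mat g ⋆ X) ≡ lin (act g A) X
  lin-Mat A g X = trans (cong (lin A) (Mat-⋆ g X)) (lin-transform A g (σ⁴ g) X)

  transpose-scale : ∀ N k A → transpose N (scale k A) ≡ scale k (transpose N A)
  transpose-scale N k A = quad≡ (entry 0F) (entry 1F) (entry 2F) (entry 3F)
    where
    entry : ∀ j → vector (scale k A) ∙ (λ i → N i j) ≡ k * (vector A ∙ λ i → N i j)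
    entry j = trans (∙≡lin (vector (scale k A)) (λ i → N i j))
      (trans (lin-scaleˡ k A ⟦ (λ i → N i j) ⟧) (cong (k *_) (sym (∙≡lin (vector A) (λ i → N i j)))))

  transpose-∼ : ∀ N {A B} → A ∼ B → transpose N A ∼ transpose N B
  transpose-∼ N {B = B} (k , k≢0 , refl) = k , k≢0 , transpose-scale N k B

  reverse-∼ : ∀ {A B} → A ∼ B → reverse A ∼ reverse B
  reverse-∼ (k , k≢0 , refl) = k , k≢0 , refl

  pt≢0 : ∀ x → pt x ≢ 0Q
  pt≢0 x eq = coords≢0 (Pt x) (trans (coords-Pt x) eq)

  plane≢0 : ∀ u w → plane u w ≢ 0Q
  plane≢0 ∞        ∞        eq = 1≢0 (trans (sym σ-1) (trans (sym (*-identityˡ (σ 1#))) (cong Quad.e₁ eq)))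
  plane≢0 ∞        (just w) eq = 1≢0 (trans (sym σ-1) (trans (sym (*-identityˡ (σ 1#))) (cong Quad.e₃ eq)))
  plane≢0 (just u) ∞        eq = 1≢0 (trans (sym σ-1) (trans (sym (*-identityˡ (σ 1#))) (cong Quad.e₂ eq)))
  plane≢0 (just u) (just w) eq = 1≢0 (trans (sym σ-1) (trans (sym (*-identityˡ (σ 1#))) (cong Quad.e₄ eq)))

  1•-vec : ∀ x → 1# • vec x ≡ vec x
  1•-vec x = cong₂ _,_ (*-identityˡ _) (*-identityˡ _)

  move-unique : ∀ {g} (det≡1 : det g ≡ 1#) x y {k} → k ≢ 0# → apply g (vec x) ≡ k • vec y →
                Möbius.move {g} det≡1 x ≡ y
  move-unique {g} det≡1 x y k≢0 eq = •-injective {x = move x} {y} (factor≢0 x) k≢0 (trans (sym (apply-vec x)) eq)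
    where open Möbius {g} det≡1

  Mat-pt : ∀ {g} (det≡1 : det g ≡ 1#) x → Mat g ⋆ pt x ∼ pt (Möbius.move {g} det≡1 x)
  Mat-pt {g} det≡1 x = ∼-trans (∼-reflexive (Mat-⋆ g (pt x))) (transform-pt det≡1 x)

  move-inv : ∀ {g} (det≡1 : det g ≡ 1#) (det-inv≡1 : det (inv g) ≡ 1#) x →
             Möbius.move {inv g} det-inv≡1 (Möbius.move {g} det≡1 x) ≡ x
  move-inv {g} det≡1 det-inv≡1 x = pt-injective (∼-trans
    (∼-sym (Mat-pt det-inv≡1 (Möbius.move {g} det≡1 x)))
    (∼-trans (⋆-∼ (Mat (inv g)) (∼-sym (Mat-pt det≡1 x))) (∼-reflexive (N⁻¹N (pt x)))))
    where open Action (projectivity g det≡1)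

  E₁ E₂ E₃ : Quad Carrier
  E₁ = quad 1# 0# 0# 0#
  E₂ = quad 0# 1# 0# 0#
  E₃ = quad 0# 0# 1# 0#

  plane-∞∞ : plane ∞ ∞ ≡ E₁
  plane-∞∞ = quad≡ (trans (*-identityˡ (σ 1#)) σ-1) (zeroˡ (σ 1#)) (trans (*-identityˡ (σ 0#)) σ-0) (zeroˡ (σ 0#))

  -- Arbitrary projectivities that stabilise the arc

  module Stabiliser {ρ} (ρ≢0 : ρ ≢ 0#) (ρ≢1 : ρ ≢ 1#) (p : Projectivity) (p∈G : G p) where

    open Action p

    private
      N : Matrix
      N = Projectivity.matrix p

    abstract
      moved : ∀ x → ∃[ y ] N ⋆ pt x ∼ pt y
      moved x = 𝒜⇒pt {Q} (proj₁ p∈G {Q} (Pt x , Pt∈𝒜 x ,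
        ∼⇒∝ {coords Q} {N · coords (Pt x)} (∼-reflexive (trans (cong (N ⋆_) (sym (coords-Pt x))) (⋆-⟦⟧ N (coords (Pt x)))))))
        where
        Q : Point
        Q = toPoint (N ⋆ pt x) (⋆≢0 (pt≢0 x))

    -- The permutation of the line induced by `p`; it is not known to be a Möbius map.
    τ : ℙ¹ → ℙ¹
    τ x = proj₁ (moved x)

    τ-pt : ∀ x → N ⋆ pt x ∼ pt (τ x)
    τ-pt x = proj₂ (moved x)

    τ-injective : ∀ {x y} → τ x ≡ τ y → x ≡ y
    τ-injective {x} {y} eq = pt-injective (⋆-injective
      (∼-trans (τ-pt x) (∼-trans (∼-reflexive (cong pt eq)) (∼-sym (τ-pt y)))))

    τ-surjective : ∀ y → ∃[ x ] τ x ≡ y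
    τ-surjective y = from (proj₂ p∈G {Pt y} (Pt∈𝒜 y))
      where
      from : image p 𝒜 (Pt y) → ∃[ x ] τ x ≡ y
      from (P , P∈𝒜 , Pt∝NP) = let x , P∼ = 𝒜⇒pt {P} P∈𝒜 in
        x , pt-injective (∼-trans (∼-sym (τ-pt x)) (∼-trans (⋆-∼ N (∼-sym P∼))
          (∼-trans (∼-reflexive (⋆-⟦⟧ N (coords P))) (∼-trans (∼-sym (∝⇒∼ Pt∝NP)) (∼-reflexive (coords-Pt y))))))

    #zeros-Maps : ∀ {A B} → Maps A B → #zeros A ≡ #zeros B
    #zeros-Maps {A} {B} (to , from) = ℕ.≤-antisym
      (#zeros-mono A B τ τ-injective λ x vanishes → lin-∼ʳ B (τ-pt x) (to (pt x) vanishes))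
      (#zeros-mono B A τ⁻¹ (λ {x} {y} eq → trans (sym (τ-τ⁻¹ x)) (trans (cong τ eq) (τ-τ⁻¹ y))) λ y vanishes →
        from (pt (τ⁻¹ y)) (lin-∼ʳ B (∼-sym (τ-pt (τ⁻¹ y))) (subst (Zero B) (sym (τ-τ⁻¹ y)) vanishes)))
      where
      τ⁻¹ : ℙ¹ → ℙ¹
      τ⁻¹ y = proj₁ (τ-surjective y)
      τ-τ⁻¹ : ∀ y → τ (τ⁻¹ y) ≡ y
      τ-τ⁻¹ y = proj₂ (τ-surjective y)

    -- Conjugating by k₁ and k₂ reduces to a map fixing the points ∞ and 0 of the arc.
    module Osculation (u : ℙ¹) where

      private
        frame₁ = frame (other≢ u)
        frame₂ = frame {τ u} {τ (other u)} (other≢ u ∘ τ-injective)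
        k₁ = proj₁ frame₁
        k₂ = proj₁ frame₂
        det₁ : det k₁ ≡ 1#
        det₁ = proj₁ (proj₂ frame₁)
        det₂ : det k₂ ≡ 1#
        det₂ = proj₁ (proj₂ frame₂)
        det₂⁻¹ : det (inv k₂) ≡ 1#
        det₂⁻¹ = trans (det-inv k₂) det₂
        k₁∞ : apply k₁ (vec ∞) ≡ 1# • vec u
        k₁∞ = trans (proj₁ (proj₂ (proj₂ frame₁))) (sym (1•-vec u))
        k₂∞ : apply k₂ (vec ∞) ≡ 1# • vec (τ u)
        k₂∞ = trans (proj₁ (proj₂ (proj₂ frame₂))) (sym (1•-vec (τ u)))
        module M₁ = Möbius {k₁} det₁
        module M₂ = Möbius {k₂} det₂
        module M₂⁻¹ = Möbius {inv k₂} det₂⁻¹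

      τ′ : ℙ¹ → ℙ¹
      τ′ x = M₂⁻¹.move (τ (M₁.move x))

      τ′-injective : ∀ {x y} → τ′ x ≡ τ′ y → x ≡ y
      τ′-injective = M₁.move-injective ∘ τ-injective ∘ M₂⁻¹.move-injective

      τ′-∞ : τ′ ∞ ≡ ∞
      τ′-∞ = begin
        M₂⁻¹.move (τ (M₁.move ∞))   ≡⟨ cong (M₂⁻¹.move ∘ τ) (move-unique {k₁} det₁ ∞ u 1≢0 k₁∞) ⟩
        M₂⁻¹.move (τ u) ≡⟨ cong M₂⁻¹.move (move-unique {k₂} det₂ ∞ (τ u) 1≢0 k₂∞) ⟨
        M₂⁻¹.move (M₂.move ∞)       ≡⟨ move-inv {k₂} det₂ det₂⁻¹ ∞ ⟩
        ∞ ∎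

      τ′-0 : τ′ (just 0#) ≡ just 0#
      τ′-0 = let _ , l≢0 , eq₁ = proj₂ (proj₂ (proj₂ frame₁)); _ , m≢0 , eq₂ = proj₂ (proj₂ (proj₂ frame₂)) in begin
        M₂⁻¹.move (τ (M₁.move (just 0#)))   ≡⟨ cong (M₂⁻¹.move ∘ τ) (move-unique {k₁} det₁ (just 0#) (other u) l≢0 eq₁) ⟩
        M₂⁻¹.move (τ (other u)) ≡⟨ cong M₂⁻¹.move (move-unique {k₂} det₂ (just 0#) (τ (other u)) m≢0 eq₂) ⟨
        M₂⁻¹.move (M₂.move (just 0#))       ≡⟨ move-inv {k₂} det₂ det₂⁻¹ (just 0#) ⟩
        just 0# ∎

      abstract
        -- The pullback of planes along the composite of `Mat k₁`, `N` and `Mat (inv k₂)`, in this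
        -- order; on the arc this composite induces `τ′`.
        R : Quad Carrier → Quad Carrier
        R A = act k₁ (transpose N (act (inv k₂) A))

        R-def : ∀ A → R A ≡ act k₁ (transpose N (act (inv k₂) A))
        R-def _ = refl

        -- The scalar depends on `x` but not on `A`. This common scalar is the k of
        -- `affine-part-vanishes`, obtained by comparing three planes at the same point.
        R-pt : ∀ x → ∃[ k ] k ≢ 0# × (∀ A → lin (R A) (pt x) ≡ k * lin A (pt (τ′ x)))
        R-pt x = evaluate (∼-trans (⋆-∼ (Mat (inv k₂)) (∼-trans (⋆-∼ N (Mat-pt det₁ x)) (τ-pt (M₁.move x))))
                                   (Mat-pt det₂⁻¹ (τ (M₁.move x))))
          where
          evaluate : Mat (inv k₂) ⋆ N ⋆ Mat k₁ ⋆ pt x ∼ pt (τ′ x) →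
                     ∃[ k ] k ≢ 0# × (∀ A → lin (R A) (pt x) ≡ k * lin A (pt (τ′ x)))
          evaluate (k , k≢0 , eq) = k , k≢0 , λ A → begin
            lin (R A) (pt x) ≡⟨ lin-Mat (transpose N (act (inv k₂) A)) k₁ (pt x) ⟨
            lin (transpose N (act (inv k₂) A)) (Mat k₁ ⋆ pt x)      ≡⟨ lin-⋆ (act (inv k₂) A) N (Mat k₁ ⋆ pt x) ⟨
            lin (act (inv k₂) A) (N ⋆ Mat k₁ ⋆ pt x) ≡⟨ lin-Mat A (inv k₂) (N ⋆ Mat k₁ ⋆ pt x) ⟨
            lin A (Mat (inv k₂) ⋆ N ⋆ Mat k₁ ⋆ pt x) ≡⟨ cong (lin A) eq ⟩
            lin A (scale k (pt (τ′ x))) ≡⟨ lin-scaleʳ A k (pt (τ′ x)) ⟩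
            k * lin A (pt (τ′ x)) ∎

      R-e₄ : ∀ A → Quad.e₄ A ≡ 0# → Quad.e₄ (R A) ≡ 0#
      R-e₄ A e₄≡0 = let k , _ , eq = R-pt ∞ in begin
        Quad.e₄ (R A) ≡⟨ form-∞ (R A) ⟨
        lin (R A) (pt ∞)        ≡⟨ eq A ⟩
        k * lin A (pt (τ′ ∞))   ≡⟨ cong (λ x → k * lin A (pt x)) τ′-∞ ⟩
        k * lin A (pt ∞)        ≡⟨ cong (k *_) (trans (form-∞ A) e₄≡0) ⟩
        k * 0# ≡⟨ zeroʳ k ⟩
        0# ∎

      R-e₁ : ∃[ k ] k ≢ 0# × (∀ A → Quad.e₁ (R A) ≡ k * Quad.e₁ A)
      R-e₁ = let k , k≢0 , eq = R-pt (just 0#) in k , k≢0 , λ A → begin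
        Quad.e₁ (R A) ≡⟨ form-zero (R A) ⟨
        lin (R A) (pt (just 0#))      ≡⟨ eq A ⟩
        k * lin A (pt (τ′ (just 0#))) ≡⟨ cong (λ x → k * lin A (pt x)) τ′-0 ⟩
        k * lin A (pt (just 0#))      ≡⟨ cong (k *_) (form-zero A) ⟩
        k * Quad.e₁ A ∎

      τ′-just : ∀ t → ∃[ s ] τ′ (just t) ≡ just s
      τ′-just t = by-cases (τ′ (just t)) refl
        where
        by-cases : ∀ x → τ′ (just t) ≡ x → ∃[ s ] τ′ (just t) ≡ just s
        by-cases ∞        eq = contradiction (τ′-injective {just t} {∞} (trans eq (sym τ′-∞))) λ ()
        by-cases (just s) eq = s , eq

      form-affine : ∀ A t → Quad.e₄ A ≡ 0# → form A (vec (just t)) ≡ Quad.e₁ A + L (Quad.e₂ A) (Quad.e₃ A) t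
      form-affine (quad a b c d) t refl = trans (form-just a b c 0# t)
        (solve 5 (λ a b c t s → a :+ b :* t :+ c :* s :+ ⟨0⟩ :* (t :* s) := a :+ (b :* t :+ c :* s)) refl a b c t (σ t))

      form-linear : ∀ A t → Quad.e₁ A ≡ 0# → Quad.e₄ A ≡ 0# → form A (vec (just t)) ≡ L (Quad.e₂ A) (Quad.e₃ A) t
      form-linear A t e₁≡0 e₄≡0 = trans (form-affine A t e₄≡0) (trans (cong (_+ L (Quad.e₂ A) (Quad.e₃ A) t) e₁≡0) (+-identityˡ _))

      -- `E₁` is the osculating plane at ∞. At `just s` the forms `E₁`, `E₂`, `E₃` have the values
      -- 1, s and σ(s), so their pullbacks at t have the values k, k s and k σ(s). Since ∞ is fixed,
      -- none has a term t σ(t); since 0 is fixed, the last two have no constant term.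
      R-E₁ : R E₁ ∼ E₁
      R-E₁ = quad-∼ (affine-part-vanishes ρ≢0 ρ≢1 (Quad.e₁ (R E₁))
          (Quad.e₂ (R E₁)) (Quad.e₃ (R E₁)) (Quad.e₂ (R E₂)) (Quad.e₃ (R E₂)) (Quad.e₂ (R E₃)) (Quad.e₃ (R E₃)) values)
        where
        e₁≡0 : ∀ A → Quad.e₁ A ≡ 0# → Quad.e₁ (R A) ≡ 0#
        e₁≡0 A eq = let k , _ , R-e₁≡ = R-e₁ in trans (R-e₁≡ A) (trans (cong (k *_) eq) (zeroʳ k))

        values : ∀ t → ∃[ k ] ∃[ s ] k ≢ 0# × (t ≢ 0# → s ≢ 0#) ×
                 Quad.e₁ (R E₁) + L (Quad.e₂ (R E₁)) (Quad.e₃ (R E₁)) t ≡ k ×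
                 L (Quad.e₂ (R E₂)) (Quad.e₃ (R E₂)) t ≡ k * s × L (Quad.e₂ (R E₃)) (Quad.e₃ (R E₃)) t ≡ k * σ s
        values t = let k , k≢0 , eq = R-pt (just t); s , τ′≡s = τ′-just t in
          k , s , k≢0 ,
          -- `τ′` is injective and fixes 0, so s = 0 would force t = 0.
          (λ t≢0 s≡0 → t≢0 (just-injective (τ′-injective {just t} {just 0#} (trans τ′≡s (trans (cong just s≡0) (sym τ′-0)))))) ,
          trans (sym (form-affine (R E₁) t (R-e₄ E₁ refl))) (trans (eq E₁) (trans (cong (λ x → k * lin E₁ (pt x)) τ′≡s)
            (trans (cong (k *_) (trans (form-just 1# 0# 0# 0# s)
              (solve 2 (λ s r → ⟨1⟩ :+ ⟨0⟩ :* s :+ ⟨0⟩ :* r :+ ⟨0⟩ :* (s :* r) := ⟨1⟩) refl s (σ s)))) (*-identityʳ k)))) ,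
          trans (sym (form-linear (R E₂) t (e₁≡0 E₂ refl) (R-e₄ E₂ refl))) (trans (eq E₂) (trans (cong (λ x → k * lin E₂ (pt x)) τ′≡s)
            (cong (k *_) (trans (form-just 0# 1# 0# 0# s)
              (solve 2 (λ s r → ⟨0⟩ :+ ⟨1⟩ :* s :+ ⟨0⟩ :* r :+ ⟨0⟩ :* (s :* r) := s) refl s (σ s)))))) ,
          trans (sym (form-linear (R E₃) t (e₁≡0 E₃ refl) (R-e₄ E₃ refl))) (trans (eq E₃) (trans (cong (λ x → k * lin E₃ (pt x)) τ′≡s)
            (cong (k *_) (trans (form-just 0# 0# 1# 0# s)
              (solve 2 (λ s r → ⟨0⟩ :+ ⟨0⟩ :* s :+ ⟨1⟩ :* r :+ ⟨0⟩ :* (s :* r) := r) refl s (σ s))))))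

        quad-∼ : Quad.e₂ (R E₁) ≡ 0# × Quad.e₃ (R E₁) ≡ 0# → R E₁ ∼ E₁
        quad-∼ (e₂≡0 , e₃≡0) = let k , k≢0 , R-e₁≡ = R-e₁ in
          k , k≢0 , quad≡ (R-e₁≡ E₁) (trans e₂≡0 (sym (zeroʳ k))) (trans e₃≡0 (sym (zeroʳ k))) (trans (R-e₄ E₁ refl) (sym (zeroʳ k)))

      -- `R-E₁` with the conjugation undone: `k₁` and `k₂` carry ∞ to `u` and `τ u`, so `E₁` stands
      -- for the osculating planes at these points.
      osculating-pulled : transpose N (plane (τ u) (τ u)) ∼ plane u u
      osculating-pulled = ∼-trans (transpose-∼ N (∼-sym (osculating-at k₂ {τ u} det₂ k₂∞)))
        (∼-trans (∼-reflexive (sym (act-invʳ {k₁} (transpose N (act (inv k₂) E₁)) det₁)))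
          (∼-trans (act-∼ (inv k₁) (∼-trans (∼-reflexive (sym (R-def E₁))) R-E₁)) (osculating-at k₁ {u} det₁ k₁∞)))
        where
        osculating-at : ∀ k {x} → det k ≡ 1# → apply k (vec ∞) ≡ 1# • vec x → act (inv k) E₁ ∼ plane x x
        osculating-at k {x} det≡1 k∞ = ∼-trans
          (act-∼ (inv k) (∼-trans (∼-reflexive (sym plane-∞∞)) (act-plane {k} {∞} {∞} {x} {x} det≡1 1≢0 1≢0 k∞ k∞)))
          (∼-reflexive (act-invʳ {k} (plane x x) det≡1))

    open Osculation public using (osculating-pulled)

    osculating-Maps : ∀ {A B} → B ≢ 0Q → Maps A B → ∀ u → A ∼ plane u u → B ∼ plane (τ u) (τ u)
    osculating-Maps {A} {B} B≢0 (to , _) u A∼ = kernel⊆⇒∼ (plane (τ u) (τ u)) B (plane≢0 (τ u) (τ u)) B≢0 λ X _ eq →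
      let Y = N⁻¹ ⋆ X in
      subst (λ X → lin B X ≡ 0#) (NN⁻¹ X) (to Y (lin-∼ˡ Y (∼-sym A∼) (lin-∼ˡ Y (osculating-pulled u)
        (trans (sym (lin-⋆ (plane (τ u) (τ u)) N Y)) (trans (cong (lin (plane (τ u) (τ u))) (NN⁻¹ X)) eq)))))
      where
      N⁻¹ = Projectivity.matrix⁻¹ p

    osculating-Maps⁻ : ∀ {A B} → A ≢ 0Q → Maps A B → ∀ u → B ∼ plane (τ u) (τ u) → A ∼ plane u u
    osculating-Maps⁻ {A} {B} A≢0 (_ , from) u B∼ = kernel⊆⇒∼ (plane u u) A (plane≢0 u u) A≢0 λ X _ eq →
      from X (lin-∼ˡ (N ⋆ X) (∼-sym B∼) (trans (lin-⋆ (plane (τ u) (τ u)) N X)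
        (lin-∼ˡ X (∼-sym (osculating-pulled u)) eq)))

  -- The polarity and the classification of planes

  polar-Pt : ∀ u → ⟪ Pt u ˢ ⟫ ≡ plane u u
  polar-Pt u = cong reverse (coords-Pt u)

  osculating⁻ : ∀ π → Osculating π → ∃[ u ] ⟪ π ⟫ ∼ plane u u
  osculating⁻ π (P , P∈𝒜 , π≈) = let u , P∼ = 𝒜⇒pt {P} P∈𝒜 in
    u , ∼-trans (≈ₗ⇒∼ {π} {P ˢ} π≈) (reverse-∼ P∼)

  ≈ₗ-polar : ∀ π u → ⟪ π ⟫ ∼ plane u u → π ≈ₗ Pt u ˢ
  ≈ₗ-polar π u π∼ = ∼⇒≈ₗ {π} {Pt u ˢ} (∼-trans π∼ (∼-reflexive (sym (polar-Pt u))))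

  polar-injective : ∀ {u v} → Pt u ˢ ≈ₗ Pt v ˢ → u ≡ v
  polar-injective {u} {v} eq = proj₁ (plane-injective {u} {u} {v} {v}
    (subst₂ _∼_ (polar-Pt u) (polar-Pt v) (≈ₗ⇒∼ {Pt u ˢ} {Pt v ˢ} eq)))

  osculating⁺ : ∀ π u → ⟪ π ⟫ ∼ plane u u → Osculating π
  osculating⁺ π u π∼ = Pt u , Pt∈𝒜 u , ≈ₗ-polar π u π∼

  -- By reciprocity P lies on the polar of an arc point exactly when that point lies on the polar of
  -- P, whose form is the reversed coordinate vector.
  osculating-through : ∀ P → HasCardinality planeSetoid (λ π → Osculating π × points π P) (#zeros (reverse ⟦ coords P ⟧))
  osculating-through P = hasCardinality planeSetoid (λ π → Osculating π × points π P) (λ u → Pt u ˢ) (zeros-unique A)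
    (λ {u} u∈ → osculating⁺ (Pt u ˢ) u (∼-reflexive (polar-Pt u)) , lin⇒points (Pt u ˢ) P (begin
      lin ⟪ Pt u ˢ ⟫ ⟦ coords P ⟧ ≡⟨ cong (λ B → lin B ⟦ coords P ⟧) (polar-Pt u) ⟩
      lin (reverse (pt u)) ⟦ coords P ⟧   ≡⟨ lin-reverse (pt u) ⟦ coords P ⟧ ⟩
      lin A (pt u) ≡⟨ ∈-zeros⁻ A u∈ ⟩
      0# ∎))
    (λ _ _ → polar-injective)
    (λ {π} (osc , P∈π) → let u , π∼ = osculating⁻ π osc in
      u , ∈-zeros A (trans (lin-reverse ⟦ coords P ⟧ (pt u)) (lin-∼ˡ ⟦ coords P ⟧ π∼ (points⇒lin π P P∈π))) ,
      ≈ₗ-polar π u π∼)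
    where
    A = reverse ⟦ coords P ⟧

  meets : ∀ π → Meets𝒜In (#zeros ⟪ π ⟫) π
  meets π = hasCardinality pointSetoid (points π ∩ 𝒜) Pt (zeros-unique ⟪ π ⟫)
    (λ {u} u∈ → lin⇒points π (Pt u) (trans (cong (lin ⟪ π ⟫) (coords-Pt u)) (∈-zeros⁻ ⟪ π ⟫ u∈)) , Pt∈𝒜 u)
    (λ {u} {v} _ _ eq → pt-injective (subst₂ _∼_ (coords-Pt u) (coords-Pt v) (∝⇒∼ eq)))
    (λ {P} (P∈π , P∈𝒜) → let u , P∼ = 𝒜⇒pt {P} P∈𝒜 in
      u , ∈-zeros ⟪ π ⟫ (lin-∼ʳ ⟪ π ⟫ P∼ (points⇒lin π P P∈π)) , ∼Pt {P} u P∼)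

  meets⁻ : ∀ {i} π → Meets𝒜In i π → #zeros ⟪ π ⟫ ≡ i
  meets⁻ π = hasCardinality-unique pointSetoid (points π ∩ 𝒜) (meets π)

  meets⁺ : ∀ {i} π → #zeros ⟪ π ⟫ ≡ i → Meets𝒜In i π
  meets⁺ π refl = meets π

  -- The polarity turns osculating planes through P into arc points on its polar, and P is on the
  -- arc exactly when its polar is osculating. Together with `𝒪ˢ⁺` this makes each class a condition
  -- on the plane alone.
  𝒪ˢ⁻ : ∀ {i} π → 𝒪ˢ i π → ¬ Osculating π × #zeros ⟪ π ⟫ ≡ i
  𝒪ˢ⁻ π (P , (P∉𝒜 , card) , π≈) =
    (λ osc → let u , π∼ = osculating⁻ π osc in P∉𝒜 (pt⇒𝒜 {P} u (reverse-∼ (∼-trans (∼-sym π∼P) π∼)))) ,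
    trans (#zeros-∼ π∼P) (hasCardinality-unique planeSetoid (λ π → Osculating π × points π P) (osculating-through P) card)
    where
    π∼P : ⟪ π ⟫ ∼ reverse ⟦ coords P ⟧
    π∼P = ≈ₗ⇒∼ {π} {P ˢ} π≈

  𝒪ˢ⁺ : ∀ {i} π → ¬ Osculating π → #zeros ⟪ π ⟫ ≡ i → 𝒪ˢ i π
  𝒪ˢ⁺ π ¬osc refl = P , (P∉𝒜 , osculating-through P) , ∼⇒≈ₗ {π} {P ˢ} (∼-reflexive refl)
    where
    P : Point
    P = toPoint (reverse ⟪ π ⟫) (⟪⟫≢0 π ∘ cong reverse)
    P∉𝒜 : ¬ 𝒜 P
    P∉𝒜 P∈𝒜 = let u , P∼ = 𝒜⇒pt {P} P∈𝒜 in ¬osc (osculating⁺ π u (reverse-∼ P∼))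

  shape : ∀ π → (∃[ B ] det B ≡ 1# × ⟪ π ⟫ ∼ B) ⊎ (∃[ u ] ∃[ w ] ⟪ π ⟫ ∼ plane u w)
  shape π = split (det ⟪ π ⟫ ≟ 0#)
    where
    split : Dec (det ⟪ π ⟫ ≡ 0#) → (∃[ B ] det B ≡ 1# × ⟪ π ⟫ ∼ B) ⊎ (∃[ u ] ∃[ w ] ⟪ π ⟫ ∼ plane u w)
    split (yes det≡0) = inj₂ (degenerate ⟪ π ⟫ (⟪⟫≢0 π) det≡0)
    split (no det≢0)  = inj₁ (nondegenerate ⟪ π ⟫ det≢0)

  det≡1⇒≁plane : ∀ {B u w} → det B ≡ 1# → ¬ (B ∼ plane u w)
  det≡1⇒≁plane {B} {u} {w} det≡1 (k , _ , eq) = 1≢0 (begin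
    1# ≡⟨ det≡1 ⟨
    det B ≡⟨ cong det eq ⟩
    det (scale k (plane u w))   ≡⟨ det-scale k (plane u w) ⟩
    k * k * det (plane u w)     ≡⟨ cong (k * k *_) (det-join (vec u) (σ² (vec w))) ⟩
    k * k * 0# ≡⟨ zeroʳ (k * k) ⟩
    0# ∎)

  det≡1⇒≢0 : ∀ {B} → det B ≡ 1# → B ≢ 0Q
  det≡1⇒≢0 det≡1 refl = 1≢0 (trans (sym det≡1) (solve 0 (⟨0⟩ :* ⟨0⟩ :+ ⟨0⟩ :* ⟨0⟩ := ⟨0⟩) refl))

  infix 4 _≟ℙ_
  _≟ℙ_ : DecidableEquality ℙ¹
  _≟ℙ_ = ≡-dec _≟_

  data Class (π : Plane) : Set c where
    osculating : ∀ u → ⟪ π ⟫ ∼ plane u u → #zeros ⟪ π ⟫ ≡ 1 → Class π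
    secant     : ∀ {u w} → u ≢ w → ⟪ π ⟫ ∼ plane u w → ¬ Osculating π → #zeros ⟪ π ⟫ ≡ 2 → Class π
    regular    : ∀ {B} → det B ≡ 1# → ⟪ π ⟫ ∼ B → ¬ Osculating π →
                 #zeros B ≡ 0 ⊎ #zeros B ≡ 1 ⊎ #zeros B ≡ 3 → #zeros ⟪ π ⟫ ≡ #zeros B → Class π

  classify : ∀ π → Class π
  classify π = [ by-determinant , by-pair ]′ (shape π)
    where
    by-determinant : ∃[ B ] det B ≡ 1# × ⟪ π ⟫ ∼ B → Class π
    by-determinant (B , det≡1 , π∼) = regular det≡1 π∼
      (λ osc → let u , π∼u = osculating⁻ π osc in det≡1⇒≁plane {B} {u} {u} det≡1 (∼-trans (∼-sym π∼) π∼u))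
      (#zeros-cases B det≡1) (#zeros-∼ π∼)
    by-pair : ∃[ u ] ∃[ w ] ⟪ π ⟫ ∼ plane u w → Class π
    by-pair (u , w , π∼) with u ≟ℙ w
    ... | yes refl = osculating u π∼ (trans (#zeros-∼ π∼) (#zeros-osculating u))
    ... | no u≢w   = secant u≢w π∼
      (λ osc → let v , π∼v = osculating⁻ π osc
                   u≡v , w≡v = plane-injective {u} {w} {v} {v} (∼-trans (∼-sym π∼) π∼v) in u≢w (trans u≡v (sym w≡v)))
      (trans (#zeros-∼ π∼) (#zeros-plane u≢w))

  #zeros≢1⇒¬osculating : ∀ {i} π → i ≢ 1 → #zeros ⟪ π ⟫ ≡ i → ¬ Osculating π
  #zeros≢1⇒¬osculating π i≢1 #≡i osc = let u , π∼ = osculating⁻ π osc in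
    i≢1 (trans (sym #≡i) (trans (#zeros-∼ π∼) (#zeros-osculating u)))

  regular≢2 : ∀ {m} → m ≡ 0 ⊎ m ≡ 1 ⊎ m ≡ 3 → m ≢ 2
  regular≢2 (inj₁ refl)        ()
  regular≢2 (inj₂ (inj₁ refl)) ()
  regular≢2 (inj₂ (inj₂ refl)) ()

  secant⁻ : ∀ π → 𝒪ˢ 2 π → ∃[ u ] ∃[ w ] u ≢ w × ⟪ π ⟫ ∼ plane u w
  secant⁻ π π∈ = by-class (𝒪ˢ⁻ π π∈) (classify π)
    where
    by-class : ¬ Osculating π × #zeros ⟪ π ⟫ ≡ 2 → Class π → ∃[ u ] ∃[ w ] u ≢ w × ⟪ π ⟫ ∼ plane u w
    by-class (¬osc , _) (osculating u π∼ _)          = contradiction (osculating⁺ π u π∼) ¬osc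
    by-class _          (secant {u} {w} u≢w π∼ _ _)  = u , w , u≢w , π∼
    by-class (_ , #≡2)  (regular _ _ _ cases #≡)     = contradiction (trans (sym #≡) #≡2) (regular≢2 cases)

  regular⁻ : ∀ {i} → i ≢ 2 → ∀ π → 𝒪ˢ i π → ∃[ B ] det B ≡ 1# × ⟪ π ⟫ ∼ B × #zeros B ≡ i
  regular⁻ {i} i≢2 π π∈ = by-class (𝒪ˢ⁻ π π∈) (classify π)
    where
    by-class : ¬ Osculating π × #zeros ⟪ π ⟫ ≡ i → Class π → ∃[ B ] det B ≡ 1# × ⟪ π ⟫ ∼ B × #zeros B ≡ i
    by-class (¬osc , _) (osculating u π∼ _)              = contradiction (osculating⁺ π u π∼) ¬osc
    by-class (_ , #≡i)  (secant _ _ _ #≡2)               = contradiction (trans (sym #≡i) #≡2) i≢2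
    by-class (_ , #≡i)  (regular {B} det≡1 π∼B _ _ #≡)   = B , det≡1 , π∼B , trans (sym #≡) #≡i

  𝒪ˢ≐Meets : ∀ {i} → i ≢ 1 → 𝒪ˢ i ≐ Meets𝒜In i
  𝒪ˢ≐Meets i≢1 = (λ {π} π∈ → meets⁺ π (proj₂ (𝒪ˢ⁻ π π∈))) ,
    λ {π} m → 𝒪ˢ⁺ π (#zeros≢1⇒¬osculating π i≢1 (meets⁻ π m)) (meets⁻ π m)

  𝒪ˢ1≐ : 𝒪ˢ 1 ≐ ∁ Osculating ∩ Meets𝒜In 1
  𝒪ˢ1≐ = (λ {π} π∈ → proj₁ (𝒪ˢ⁻ π π∈) , meets⁺ π (proj₂ (𝒪ˢ⁻ π π∈))) ,
    λ {π} (¬osc , m) → 𝒪ˢ⁺ π ¬osc (meets⁻ π m)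

  -- The sizes of the five classes

  osculating-count : HasCardinality planeSetoid Osculating (q ℕ.+ 1)
  osculating-count = subst (HasCardinality planeSetoid Osculating) (trans length-line (ℕ.+-comm 1 q))
    (hasCardinality planeSetoid Osculating (λ u → Pt u ˢ) line-unique
      (λ {u} _ → osculating⁺ (Pt u ˢ) u (∼-reflexive (polar-Pt u)))
      (λ _ _ → polar-injective)
      (λ {π} osc → let u , π∼ = osculating⁻ π osc in
        u , ∈-line u , ≈ₗ-polar π u π∼))

  -- 0Q, which represents no plane, is sent to an arbitrary one.
  abstract
    planeOf : Quad Carrier → Plane
    planeOf A with A ≟Q 0Q
    ... | yes _  = Pt ∞ ˢ
    ... | no A≢0 = toPlane A A≢0

    ⟪planeOf⟫ : ∀ {A} → A ≢ 0Q → ⟪ planeOf A ⟫ ≡ A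
    ⟪planeOf⟫ {A} A≢0 with A ≟Q 0Q
    ... | yes A≡0 = contradiction A≡0 A≢0
    ... | no _    = refl

  -- Each regular plane has exactly one form of determinant 1, by `nondegenerate` and
  -- `nondegenerate-unique`, so counting planes amounts to counting forms.
  fibre-count : ∀ {i} → i ≢ 2 → HasCardinality planeSetoid (𝒪ˢ i) (length (fibreOf i))
  fibre-count {i} i≢2 = hasCardinality planeSetoid (𝒪ˢ i) planeOf (Unique.filter⁺ (λ A → #zeros A ℕ.≟ i) special-unique)
    (λ {A} A∈ → sound A (member⁻ A∈))
    (λ {A} {B} A∈ B∈ eq → nondegenerate-unique (proj₁ (member⁻ A∈)) (proj₁ (member⁻ B∈))
      (subst₂ _∼_ (⟪planeOf⟫ (det≡1⇒≢0 (proj₁ (member⁻ A∈)))) (⟪planeOf⟫ (det≡1⇒≢0 (proj₁ (member⁻ B∈))))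
        (≈ₗ⇒∼ {planeOf A} {planeOf B} eq)))
    (λ {π} π∈ → let B , det≡1 , π∼B , #≡i = regular⁻ i≢2 π π∈ in
      B , ∈-filter⁺ (λ A → #zeros A ℕ.≟ i) (∈-special B det≡1) #≡i ,
      ∼⇒≈ₗ {π} {planeOf B} (∼-trans π∼B (∼-reflexive (sym (⟪planeOf⟫ (det≡1⇒≢0 det≡1))))))
    where
    member⁻ : ∀ {A} → A ∈ fibreOf i → det A ≡ 1# × #zeros A ≡ i
    member⁻ A∈ = let A∈special , #≡i = ∈-filter⁻ (λ A → #zeros A ℕ.≟ i) {xs = special} A∈ in ∈-special⁻ A∈special , #≡i
    sound : ∀ A → det A ≡ 1# × #zeros A ≡ i → 𝒪ˢ i (planeOf A)
    sound A (det≡1 , #≡i) = 𝒪ˢ⁺ (planeOf A)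
      (λ osc → let u , ∼u = osculating⁻ (planeOf A) osc in
        det≡1⇒≁plane {A} {u} {u} det≡1 (subst (_∼ plane u u) (⟪planeOf⟫ (det≡1⇒≢0 det≡1)) ∼u))
      (trans (cong #zeros (⟪planeOf⟫ (det≡1⇒≢0 det≡1))) #≡i)

  distinct? : Decidable (λ ((u , w) : ℙ¹ × ℙ¹) → u ≢ w)
  distinct? (u , w) = ¬? (u ≟ℙ w)

  pairs : List (ℙ¹ × ℙ¹)
  pairs = filter distinct? (cartesianProduct line line)

  pairs-unique : Unique pairs
  pairs-unique = Unique.filter⁺ distinct? (Unique.cartesianProduct⁺ line-unique line-unique)

  ∈-pairs : ∀ {u w} → u ≢ w → (u , w) ∈ pairs
  ∈-pairs {u} {w} u≢w = ∈-filter⁺ distinct? (∈-cartesianProduct⁺ (∈-line u) (∈-line w)) u≢w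

  ∈-pairs⁻ : ∀ {u w} → (u , w) ∈ pairs → u ≢ w
  ∈-pairs⁻ ∈ = proj₂ (∈-filter⁻ distinct? {xs = cartesianProduct line line} ∈)

  -- The pairs together with the diagonal fill the square of the line, of size (q + 1)²; cancelling
  -- the q + 1 diagonal pairs avoids subtraction.
  length-pairs : length pairs ≡ q ℕ.^ 2 ℕ.+ q
  length-pairs = ℕ.+-cancelʳ-≡ (suc q) (length pairs) (q ℕ.^ 2 ℕ.+ q) (begin
    length pairs ℕ.+ suc q ≡⟨ cong (length pairs ℕ.+_) (trans (length-map diagonal line) length-line) ⟨
    length pairs ℕ.+ length (map diagonal line)    ≡⟨ length-++ pairs ⟨
    length (pairs ++ map diagonal line) ≡⟨ unique-⊆⊇⇒length≡
        (Unique.++⁺ pairs-unique (Unique.map⁺ (cong proj₁) line-unique) disjoint)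
        (Unique.cartesianProduct⁺ line-unique line-unique)
        (λ { {u , w} _ → ∈-cartesianProduct⁺ (∈-line u) (∈-line w) }) (λ { {u , w} _ → covered u w }) ⟩
    length (cartesianProduct line line) ≡⟨ length-cartesianProductWith _,_ line line ⟩
    length line ℕ.* length line ≡⟨ cong₂ ℕ._*_ length-line length-line ⟩
    suc q ℕ.* suc q ≡⟨ square q ⟩
    q ℕ.^ 2 ℕ.+ q ℕ.+ suc q ∎)
    where
    diagonal : ℙ¹ → ℙ¹ × ℙ¹
    diagonal u = u , u
    disjoint : ∀ {x} → ¬ (x ∈ pairs × x ∈ map diagonal line)
    disjoint {u , w} (∈pairs , ∈diagonal) = let v , _ , eq = ∈-map⁻ diagonal ∈diagonal in
      ∈-pairs⁻ ∈pairs (trans (cong proj₁ eq) (sym (cong proj₂ eq)))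
    covered : ∀ u w → (u , w) ∈ pairs ++ map diagonal line
    covered u w with u ≟ℙ w
    ... | yes refl = ∈-++⁺ʳ pairs (∈-map⁺ diagonal (∈-line u))
    ... | no u≢w   = ∈-++⁺ˡ (∈-pairs u≢w)
    square : ∀ q → suc q ℕ.* suc q ≡ q ℕ.^ 2 ℕ.+ q ℕ.+ suc q
    square = let open ℕSolver.+-*-Solver using () renaming (solve to solveℕ; _:=_ to _≔_; _:+_ to _⊕_; _:*_ to _⊗_; con to lit) in
      solveℕ 1 (λ q → (lit 1 ⊕ q) ⊗ (lit 1 ⊕ q) ≔ q ⊗ (q ⊗ lit 1) ⊕ q ⊕ (lit 1 ⊕ q)) refl

  pairPlane : ℙ¹ → ℙ¹ → Plane
  pairPlane u w = toPlane (plane u w) (plane≢0 u w)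

  secant-count : HasCardinality planeSetoid (𝒪ˢ 2) (q ℕ.^ 2 ℕ.+ q)
  secant-count = subst (HasCardinality planeSetoid (𝒪ˢ 2)) length-pairs
    (hasCardinality planeSetoid (𝒪ˢ 2) (λ (u , w) → pairPlane u w) pairs-unique
      (λ { {u , w} ∈ → sound u w (∈-pairs⁻ ∈) })
      (λ { {u , w} {u′ , w′} _ _ → injective u w u′ w′ })
      (λ {π} π∈ → let u , w , u≢w , π∼ = secant⁻ π π∈ in
        (u , w) , ∈-pairs u≢w , ∼⇒≈ₗ {π} {pairPlane u w} π∼))
    where
    sound : ∀ u w → u ≢ w → 𝒪ˢ 2 (pairPlane u w)
    sound u w u≢w = 𝒪ˢ⁺ π (#zeros≢1⇒¬osculating π (λ ()) (#zeros-plane u≢w)) (#zeros-plane u≢w)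
      where
      π = pairPlane u w
    injective : ∀ u w u′ w′ → pairPlane u w ≈ₗ pairPlane u′ w′ → (u , w) ≡ (u′ , w′)
    injective u w u′ w′ eq = cong₂ _,_ (proj₁ both) (proj₂ both)
      where
      both : u ≡ u′ × w ≡ w′
      both = plane-injective {u} {w} {u′} {w′}
        (≈ₗ⇒∼ {pairPlane u w} {pairPlane u′ w′} eq)
  length-special≡ : length special ≡ q ℕ.^ 3 ℕ.∸ q
  length-special≡ = trans length-special (special-size (length nonzeros) q length-nonzeros)

  fibre-size : ∀ {i} k → suc k ℕ.* length (fibreOf i) ≡ length special → length (fibreOf i) ≡ (q ℕ.^ 3 ℕ.∸ q) ℕ./ suc k
  fibre-size {i} k eq = begin
    length (fibreOf i) ≡⟨ m*n/n≡m (length (fibreOf i)) (suc k) ⟨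
    length (fibreOf i) ℕ.* suc k ℕ./ suc k   ≡⟨ cong (ℕ._/ suc k) (ℕ.*-comm (length (fibreOf i)) (suc k)) ⟩
    suc k ℕ.* length (fibreOf i) ℕ./ suc k   ≡⟨ cong (ℕ._/ suc k) (trans eq length-special≡) ⟩
    (q ℕ.^ 3 ℕ.∸ q) ℕ./ suc k ∎

  regular-count : ∀ {i} k → i ≢ 2 → suc k ℕ.* length (fibreOf i) ≡ length special →
                   HasCardinality planeSetoid (𝒪ˢ i) ((q ℕ.^ 3 ℕ.∸ q) ℕ./ suc k)
  regular-count {i} k i≢2 eq = subst (HasCardinality planeSetoid (𝒪ˢ i)) (fibre-size k eq) (fibre-count i≢2)

  -- The orbits of the full stabiliser

  classes : Vec.Vec (Pred Plane c) 5
  classes = Osculating Vec.∷ 𝒪ˢ 0 Vec.∷ 𝒪ˢ 1 Vec.∷ 𝒪ˢ 2 Vec.∷ 𝒪ˢ 3 Vec.∷ Vec.[]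

  classes-disjoint : ∀ π i j → Vec.lookup classes i π → Vec.lookup classes j π → i ≡ j
  classes-disjoint π i j π∈i π∈j = same i j (separate i π∈i) (separate j π∈j)
    where
    Separate : Fin 5 → Set c
    Separate Fin.zero    = Osculating π
    -- The position in the list is one more than the number of arc points, since the osculating
    -- planes come first.
    Separate (Fin.suc i) = ¬ Osculating π × #zeros ⟪ π ⟫ ≡ toℕ i
    separate : ∀ i → Vec.lookup classes i π → Separate i
    separate 0F π∈ = π∈
    separate 1F π∈ = 𝒪ˢ⁻ π π∈
    separate 2F π∈ = 𝒪ˢ⁻ π π∈
    separate 3F π∈ = 𝒪ˢ⁻ π π∈
    separate 4F π∈ = 𝒪ˢ⁻ π π∈
    same : ∀ i j → Separate i → Separate j → i ≡ j
    same Fin.zero    Fin.zero    _          _          = refl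
    same Fin.zero    (Fin.suc _) osc        (¬osc , _) = contradiction osc ¬osc
    same (Fin.suc _) Fin.zero    (¬osc , _) osc        = contradiction osc ¬osc
    same (Fin.suc _) (Fin.suc _) (_ , #≡i)  (_ , #≡j)  = cong Fin.suc (Fin.toℕ-injective (trans (sym #≡i) #≡j))

  classes-cover : ∀ π → ∃[ i ] Vec.lookup classes i π
  classes-cover π = locate (classify π)
    where
    locate : Class π → ∃[ i ] Vec.lookup classes i π
    locate (osculating u π∼ _)                            = 0F , osculating⁺ π u π∼
    locate (secant _ _ ¬osc #≡2)                          = 3F , 𝒪ˢ⁺ π ¬osc #≡2
    locate (regular _ _ ¬osc (inj₁ #≡0) #≡)               = 1F , 𝒪ˢ⁺ π ¬osc (trans #≡ #≡0)
    locate (regular _ _ ¬osc (inj₂ (inj₁ #≡1)) #≡)        = 2F , 𝒪ˢ⁺ π ¬osc (trans #≡ #≡1)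
    locate (regular _ _ ¬osc (inj₂ (inj₂ #≡3)) #≡)        = 4F , 𝒪ˢ⁺ π ¬osc (trans #≡ #≡3)

  module _ {ρ} (ρ≢0 : ρ ≢ 0#) (ρ≢1 : ρ ≢ 1#) where

    module _ {p π π′} (p∈G : G p) (image≐ : image p (points π) ≐ points π′) where

      private
        maps : Action.Maps p ⟪ π ⟫ ⟪ π′ ⟫
        maps = Action.image⇒Maps p {π} {π′} image≐

      open Stabiliser ρ≢0 ρ≢1 p p∈G

      osculating-invariant : Osculating π → Osculating π′
      osculating-invariant osc = let u , π∼ = osculating⁻ π osc in
        osculating⁺ π′ (τ u) (osculating-Maps (⟪⟫≢0 π′) maps u π∼)

      osculating-invariant⁻ : Osculating π′ → Osculating π
      osculating-invariant⁻ osc =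
        let w , π′∼ = osculating⁻ π′ osc
            u , τu≡w = τ-surjective w in
        osculating⁺ π u (osculating-Maps⁻ (⟪⟫≢0 π) maps u (subst (λ w → ⟪ π′ ⟫ ∼ plane w w) (sym τu≡w) π′∼))

      𝒪ˢ-invariant : ∀ {i} → 𝒪ˢ i π → 𝒪ˢ i π′
      𝒪ˢ-invariant π∈ = let ¬osc , #≡i = 𝒪ˢ⁻ π π∈ in
        𝒪ˢ⁺ π′ (¬osc ∘ osculating-invariant⁻) (trans (sym (#zeros-Maps maps)) #≡i)

    -- The orbit stays in the class because all of `G` preserves it, and covers it because elements
    -- of SL(2,q) already reach every member.
    orbit-of : (O : Pred Plane c) (π₀ : Plane) → O π₀ →
               (∀ {p π π′} → G p → image p (points π) ≐ points π′ → O π → O π′) →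
               (∀ π → O π → ∃[ g ] det g ≡ 1# × ⟪ π₀ ⟫ ∼ act g ⟪ π ⟫) →
               ∃[ π₀ ] O ≐ planeOrbit G π₀
    orbit-of O π₀ π₀∈O invariant transitive = π₀ ,
      (λ {π} π∈O → let g , det≡1 , π₀∼gπ = transitive π π∈O in
        projectivity g det≡1 , projectivity∈G g det≡1 , act⇒image {π₀} {π} g det≡1 π₀∼gπ) ,
      λ {π} (p , p∈G , image≐) → invariant {p} {π₀} {π} p∈G image≐ π₀∈O

    osculating-orbit : ∃[ π₀ ] Osculating ≐ planeOrbit G π₀
    osculating-orbit = orbit-of Osculating (Pt ∞ ˢ) (osculating⁺ (Pt ∞ ˢ) ∞ (∼-reflexive (polar-Pt ∞)))
      (λ {p} {π} {π′} → osculating-invariant {p} {π} {π′})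
      λ π osc → let u , π∼ = osculating⁻ π osc in carry π u π∼ (frame (other≢ u))
      where
      carry : ∀ π u → ⟪ π ⟫ ∼ plane u u → Frame u (other u) →
              ∃[ g ] det g ≡ 1# × ⟪ Pt ∞ ˢ ⟫ ∼ act g ⟪ π ⟫
      carry π u π∼ (g , det≡1 , g∞ , _) = g , det≡1 , ∼-trans (∼-reflexive (polar-Pt ∞))
        (∼-trans (act-plane {g} {∞} {∞} {u} {u} det≡1 1≢0 1≢0 g∞′ g∞′) (act-∼ g (∼-sym π∼)))
        where
        g∞′ = trans g∞ (sym (1•-vec u))

    secant-orbit : ∃[ π₀ ] 𝒪ˢ 2 ≐ planeOrbit G π₀
    secant-orbit = orbit-of (𝒪ˢ 2) π₀ (𝒪ˢ⁺ π₀ (#zeros≢1⇒¬osculating π₀ (λ ()) #≡2) #≡2)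
      (λ {p} {π} {π′} p∈G image≐ → 𝒪ˢ-invariant {p} {π} {π′} p∈G image≐)
      λ π π∈ → let u , w , u≢w , π∼ = secant⁻ π π∈ in carry π u w π∼ (frame u≢w)
      where
      π₀ = pairPlane ∞ (just 0#)
      #≡2 : #zeros ⟪ π₀ ⟫ ≡ 2
      #≡2 = #zeros-plane {∞} {just 0#} (λ ())
      carry : ∀ π u w → ⟪ π ⟫ ∼ plane u w →
              Frame u w →
              ∃[ g ] det g ≡ 1# × ⟪ π₀ ⟫ ∼ act g ⟪ π ⟫
      carry π u w π∼ (g , det≡1 , g∞ , k , k≢0 , g0) = g , det≡1 ,
        ∼-trans (act-plane {g} {∞} {just 0#} {u} {w} det≡1 1≢0 k≢0 (trans g∞ (sym (1•-vec u))) g0) (act-∼ g (∼-sym π∼))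

    regular-orbit : ∀ {i k} (b : Base i (suc k)) → i ≢ 2 →
                    suc k ℕ.* length (orbit (Base.base b)) ≡ length special →
                    suc k ℕ.* length (fibreOf i) ≡ length special → ∃[ π₀ ] 𝒪ˢ i ≐ planeOrbit G π₀
    regular-orbit {i} b i≢2 orbit-size fibre-size = orbit-of (𝒪ˢ i) π₀
      (𝒪ˢ⁺ π₀ (λ osc → let u , π₀∼ = osculating⁻ π₀ osc in det≡1⇒≁plane {base} {u} {u} det≡1 π₀∼) #zeros≡)
      (λ {p} {π} {π′} p∈G image≐ → 𝒪ˢ-invariant {p} {π} {π′} p∈G image≐)
      λ π π∈ → let B , det-B≡1 , π∼B , #B≡i = regular⁻ i≢2 π π∈ in
        carry π B π∼B (transitive b orbit-size fibre-size det-B≡1 #B≡i)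
      where
      open Base b
      π₀ = toPlane base (det≡1⇒≢0 det≡1)
      carry : ∀ π B → ⟪ π ⟫ ∼ B → Orbit base B → ∃[ g ] det g ≡ 1# × ⟪ π₀ ⟫ ∼ act g ⟪ π ⟫
      -- `Orbit base B` substitutes into the base form, while the base has to be obtained from the
      -- given plane; hence the inverse.
      carry π B π∼B (g , det-g≡1 , refl) = inv g , trans (det-inv g) det-g≡1 ,
        ∼-trans (∼-reflexive (sym (act-invʳ {g} base det-g≡1))) (act-∼ (inv g) (∼-sym π∼B))

    plane-orbits : PlaneOrbitsAre G classes
    plane-orbits = orbits , λ π → let i , π∈i = classes-cover π in i , π∈i , λ {j} π∈j → classes-disjoint π i j π∈i π∈j
      where
      orbits : ∀ i → ∃[ π ] Vec.lookup classes i ≐ planeOrbit G π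
      orbits 0F = osculating-orbit
      orbits 1F = regular-orbit base₀ (λ ()) (proj₁ orbit-sizes) (proj₁ fibre-sizes)
      orbits 2F = regular-orbit base₁ (λ ()) (proj₁ (proj₂ orbit-sizes)) (proj₁ (proj₂ fibre-sizes))
      orbits 3F = secant-orbit
      orbits 4F = regular-orbit base₃ (λ ()) (proj₂ (proj₂ orbit-sizes)) (proj₂ (proj₂ fibre-sizes))

    plane-classes :
      PlaneOrbitsAre G classes ×
      HasCardinality planeSetoid Osculating (q ℕ.+ 1) ×
      (HasCardinality planeSetoid (𝒪ˢ 0) ((q ℕ.^ 3 ℕ.∸ q) ℕ./ 3) × 𝒪ˢ 0 ≐ Meets𝒜In 0) ×
      (HasCardinality planeSetoid (𝒪ˢ 1) ((q ℕ.^ 3 ℕ.∸ q) ℕ./ 2) × 𝒪ˢ 1 ≐ ∁ Osculating ∩ Meets𝒜In 1) ×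
      (HasCardinality planeSetoid (𝒪ˢ 2) (q ℕ.^ 2 ℕ.+ q) × 𝒪ˢ 2 ≐ Meets𝒜In 2) ×
      (HasCardinality planeSetoid (𝒪ˢ 3) ((q ℕ.^ 3 ℕ.∸ q) ℕ./ 6) × 𝒪ˢ 3 ≐ Meets𝒜In 3)
    plane-classes = plane-orbits , osculating-count ,
      -- The divisors 3, 2 and 6 are passed as predecessors.
      (regular-count 2 (λ ()) (proj₁ fibre-sizes) , 𝒪ˢ≐Meets (λ ())) ,
      (regular-count 1 (λ ()) (proj₁ (proj₂ fibre-sizes)) , 𝒪ˢ1≐) ,
      (secant-count , 𝒪ˢ≐Meets (λ ())) ,
      (regular-count 5 (λ ()) (proj₂ (proj₂ fibre-sizes)) , 𝒪ˢ≐Meets (λ ()))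

-- Specialisation to q = 2^n

open import Data.Nat using (_≤_; _+_; _∸_; _^_; _/_)
open import Data.Vec.Base using ([]; _∷_)

proposition3p4 : {c : Level} (n h : ℕ) → 3 ≤ n → 1 ≤ h → gcd n h ≡ 1 →
    let q = 2 ^ n in
    (F : FiniteField c q) →
    let open PG3 F
        open Arc h
    in
    PlaneOrbitsAre G (Osculating ∷ 𝒪ˢ 0 ∷ 𝒪ˢ 1 ∷ 𝒪ˢ 2 ∷ 𝒪ˢ 3 ∷ []) ×
    HasCardinality planeSetoid Osculating (q + 1) ×
    (HasCardinality planeSetoid (𝒪ˢ 0) ((q ^ 3 ∸ q) / 3) ×
     𝒪ˢ 0 ≐ Meets𝒜In 0) ×
    (HasCardinality planeSetoid (𝒪ˢ 1) ((q ^ 3 ∸ q) / 2) ×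
     𝒪ˢ 1 ≐ ∁ Osculating ∩ Meets𝒜In 1) ×
    (HasCardinality planeSetoid (𝒪ˢ 2) (q ^ 2 + q) ×
     𝒪ˢ 2 ≐ Meets𝒜In 2) ×
    (HasCardinality planeSetoid (𝒪ˢ 3) ((q ^ 3 ∸ q) / 6) ×
     𝒪ˢ 3 ≐ Meets𝒜In 3)
proposition3p4 n h 3≤n _ coprime F =
  -- A field with more than two elements has some ρ other than 0 and 1; it separates the functions t
  -- and σ(t) in `L-vanishes`.
  let ρ , _ , ρ∉ = ∃∉ _≟_ {ys = 0# ∷ 1# ∷ []} elements-unique 2<q in
  plane-classes {ρ} (λ ρ≡0 → ρ∉ (here ρ≡0)) (λ ρ≡1 → ρ∉ (there (here ρ≡1)))
  where
  open FiniteField F using (0#; 1#)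
  open FiniteFieldProperties F
  1+1≡0 = characteristic-2 n refl
  open TwistedForms F 1+1≡0 h (CharacteristicTwo.φ-fixed⇒0∨1 F 1+1≡0 n h refl coprime)
  2<q : 3 ≤ length elements
  -- 3 ≤ 3 + 5 = 2³ ≤ 2^n = q.
  2<q = ℕ.≤-trans (ℕ.m≤m+n 3 5) (ℕ.≤-trans (ℕ.^-monoʳ-≤ 2 3≤n) (ℕ.≤-reflexive (sym length-elements)))
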